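{- $\mathbf{PCW}\subseteq\mathbf{PTW}$.
   Context: Decision problems are identified with languages over $\Sigma=\{0,1\}$ under a standard encoding; $A\leq_P B$ means that $A$ is many-one reducible to $B$ in polynomial time. $\Vert$ denotes concatenation of bit strings. Circuit outputs are interpreted as numbers written in binary. $\operatorname{sgn}$ is the sign function with values in $\{ -1,0,1\}$. The problem Weak-Tournament-Source: the input is a Boolean circuit $C\colon\{0,1\}^{2n}\to\{0,1\}$; the question is whether there exists $x\in\{0,1\}^n$ such that for all $y\in\{0,1\}^n$ with $y\neq x$ we have $C(x\Vert y)=1$ and $C(y\Vert x)=0$. The problem Ckt-Condorcet: the input is a sequence of Boolean circuits $\langle C_1,\dots,C_m\rangle$, each with $n$ inputs and $n$ outputs; the question is whether there exists $x\in\{0,1\}^n$ such that for all $y\in\{0,1\}^n$ with $y\neq x$ we have $\sum_{i=1}^m\operatorname{sgn}(C_i(x)-C_i(y))>0$. $\mathbf{PTW}=\{L\subseteq\Sigma^*: L\leq_P \text{Weak-Tournament-Source}\}$ and $\mathbf{PCW}=\{L\subseteq\Sigma^*: L\leq_P\text{Ckt-Condorcet}\}$. -}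

module Defs where

open import Data.Bool.Base using (Bool; true; false; _∧_; _∨_; not; if_then_else_)
open import Data.Fin.Base as Fin using (Fin; toℕ)
open import Data.Integer.Base as ℤ using (ℤ; +_; 0ℤ; 1ℤ; -1ℤ)
open import Data.List.Base as List using (List; []; _∷_; [_]; length; replicate; drop)
open import Data.Maybe.Base as Maybe using (Maybe; just; nothing)
open import Data.Nat.Base as ℕ using (ℕ; zero; suc)
open import Data.Product.Base using (Σ-syntax; ∃-syntax; _×_; _,_)
open import Data.Vec.Base as Vec using (Vec; []; _∷_; lookup)
open import Function.Bundles using (_⇔_; _↔_)
open import Level using (0ℓ) renaming (suc to lsuc)
open import Relation.Binary.PropositionalEquality.Core using (_≡_; _≢_)
open import Relation.Unary using (Pred)

Word : Set
Word = List Bool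

Language : Set₁
Language = Pred Word 0ℓ

-- `nothing` is the blank symbol.
Symbol : Set
Symbol = Maybe Bool

data Direction : Set where
  left stay right : Direction

-- A two-way infinite tape.  `before` lists the cells to the left of the
-- head, nearest first; `from` lists the scanned cell and the cells to its
-- right.  All cells not listed are blank.
record Tape : Set where
  constructor tape
  field
    before : List Symbol
    from   : List Symbol

first : List Symbol → Symbol
first []      = nothing
first (s ∷ _) = s

scan : Tape → Symbol
scan t = first (Tape.from t)

-- The symbol to write, and the subsequent head movement.
Action : Set
Action = Symbol × Direction

act : Action → Tape → Tape
act (s , left)  (tape ls rs) = tape (drop 1 ls) (first ls ∷ s ∷ drop 1 rs)
act (s , stay)  (tape ls rs) = tape ls (s ∷ drop 1 rs)
act (s , right) (tape ls rs) = tape (s ∷ ls) (drop 1 rs)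

-- A deterministic Turing machine with 1 + extraTapes tapes.  It halts when δ
-- yields `nothing`.
record Machine : Set₁ where
  field
    State      : Set
    stateCount : ℕ
    finite     : State ↔ Fin stateCount
    extraTapes : ℕ
    start      : State
    δ          : State → Vec Symbol (suc extraTapes) →
                 Maybe (State × Vec Action (suc extraTapes))

module _ (M : Machine) where
  open Machine M

  Config : Set
  Config = State × Vec Tape (suc extraTapes)

  step : Config → Maybe Config
  step (q , ts) =
    Maybe.map (λ (q′ , as) → q′ , Vec.zipWith act as ts) (δ q (Vec.map scan ts))

  -- The input is on tape 0, with the head on its first symbol.
  initial : Word → Config
  initial w = start , tape [] (List.map just w) ∷ Vec.replicate extraTapes (tape [] [])

  data Run : Config → ℕ → Config → Set where
    stop : ∀ {c} → Run c 0 c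
    next : ∀ {c c′ c″ t} → step c ≡ just c′ → Run c′ t c″ → Run c (suc t) c″

  bitPrefix : List Symbol → Word
  bitPrefix (just b ∷ ss) = b ∷ bitPrefix ss
  bitPrefix _             = []

  -- The output is on tape 0, from the scanned cell up to the first blank.
  output : Config → Word
  output (_ , t ∷ _) = bitPrefix (Tape.from t)

  HaltsWithin : ℕ → Word → Word → Set
  HaltsWithin bound w v =
    ∃[ t ] ∃[ c ] t ℕ.≤ bound × Run (initial w) t c × step c ≡ nothing × output c ≡ v

-- The polynomial with the given coefficients, constant term first.
evalPoly : List ℕ → ℕ → ℕ
evalPoly []       x = 0
evalPoly (a ∷ as) x = a ℕ.+ x ℕ.* evalPoly as x

PolyTime : (Word → Word) → Set₁
PolyTime f = Σ[ M ∈ Machine ] Σ[ p ∈ List ℕ ]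
  (∀ w → HaltsWithin M (evalPoly p (length w)) w (f w))

infix 4 _≤ₚ_

_≤ₚ_ : Language → Language → Set₁
A ≤ₚ B = Σ[ f ∈ (Word → Word) ] PolyTime f × (∀ w → A w ⇔ B (f w))

-- A gate of a circuit with n input variables that is preceded by s gates.
-- An operand i : Fin s refers backwards: 0 is the immediately preceding gate.
data Gate (n s : ℕ) : Set where
  input   : Fin n → Gate n s
  const   : Bool → Gate n s
  not′    : Fin s → Gate n s
  and′ or′ : Fin s → Fin s → Gate n s

infixl 5 _▷_

data Gates (n : ℕ) : ℕ → Set where
  []  : Gates n 0
  _▷_ : ∀ {s} → Gates n s → Gate n s → Gates n (suc s)

record Circuit (n k : ℕ) : Set where
  constructor circuit
  field
    {size}  : ℕ
    gates   : Gates n size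
    outputs : Vec (Fin size) k

evalGate : ∀ {n s} → Gate n s → Vec Bool n → Vec Bool s → Bool
evalGate (input i)  x v = lookup x i
evalGate (const b)  x v = b
evalGate (not′ i)   x v = not (lookup v i)
evalGate (and′ i j) x v = lookup v i ∧ lookup v j
evalGate (or′ i j)  x v = lookup v i ∨ lookup v j

-- The values of all gates, last gate first.
evalGates : ∀ {n s} → Gates n s → Vec Bool n → Vec Bool s
evalGates []       x = []
evalGates (gs ▷ g) x = let v = evalGates gs x in evalGate g x v ∷ v

eval : ∀ {n k} → Circuit n k → Vec Bool n → Vec Bool k
eval (circuit gs os) x = Vec.map (lookup (evalGates gs x)) os

-- Numbers are written in unary.  They are only used for gate indices, variable
-- indices and the number of input variables.  Input variables are nodes of the
-- circuit and count towards its size, so all of these are bounded by the size.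
encodeℕ : ℕ → Word
encodeℕ k = replicate k true List.++ [ false ]

encodeFin : ∀ {k} → Fin k → Word
encodeFin i = encodeℕ (toℕ i)

encodeGate : ∀ {n s} → Gate n s → Word
encodeGate (input i)  = false ∷ false ∷ encodeFin i
encodeGate (const b)  = false ∷ true ∷ b ∷ []
encodeGate (not′ i)   = true ∷ false ∷ encodeFin i
encodeGate (and′ i j) = true ∷ true ∷ false ∷ encodeFin i List.++ encodeFin j
encodeGate (or′ i j)  = true ∷ true ∷ true ∷ encodeFin i List.++ encodeFin j

-- In encoded sequences of unknown length, each item is preceded by a 1 and
-- the end is marked by a 0 (for gates, the 0 is added by encodeCircuit).
encodeGates : ∀ {n s} → Gates n s → Word
encodeGates []       = []
encodeGates (gs ▷ g) = encodeGates gs List.++ true ∷ encodeGate g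

encodeOutputs : ∀ {s k} → Vec (Fin s) k → Word
encodeOutputs []       = []
encodeOutputs (o ∷ os) = encodeFin o List.++ encodeOutputs os

encodeCircuit : ∀ {n k} → Circuit n k → Word
encodeCircuit (circuit gs os) = encodeGates gs List.++ false ∷ encodeOutputs os

encodeCircuits : ∀ {n k} → List (Circuit n k) → Word
encodeCircuits []       = [ false ]
encodeCircuits (C ∷ Cs) = true ∷ encodeCircuit C List.++ encodeCircuits Cs

IsWeakSource : ∀ {n} → Circuit (n ℕ.+ n) 1 → Vec Bool n → Set
IsWeakSource C x = ∀ y → y ≢ x →
  Vec.head (eval C (x Vec.++ y)) ≡ true × Vec.head (eval C (y Vec.++ x)) ≡ false

Weak-Tournament-Source : Language
Weak-Tournament-Source w =
  ∃[ n ] Σ[ C ∈ Circuit (n ℕ.+ n) 1 ]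
    w ≡ encodeℕ n List.++ encodeCircuit C × Σ[ x ∈ Vec Bool n ] IsWeakSource {n} C x

-- Most significant bit first.
value : ∀ {n} → Vec Bool n → ℕ
value []               = 0
value {suc n} (b ∷ bs) = (if b then 2 ℕ.^ n else 0) ℕ.+ value bs

sgn : ℤ → ℤ
sgn (+ zero)    = 0ℤ
sgn (+ suc _)   = 1ℤ
sgn ℤ.-[1+ _ ]  = -1ℤ

sumℤ : List ℤ → ℤ
sumℤ = List.foldr ℤ._+_ 0ℤ

margin : ∀ {n} → List (Circuit n n) → Vec Bool n → Vec Bool n → ℤ
margin Cs x y =
  sumℤ (List.map (λ C → sgn (+ value (eval C x) ℤ.- + value (eval C y))) Cs)

IsCondorcetWinner : ∀ {n} → List (Circuit n n) → Vec Bool n → Set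
IsCondorcetWinner Cs x = ∀ y → y ≢ x → margin Cs x y ℤ.> 0ℤ

Ckt-Condorcet : Language
Ckt-Condorcet w =
  ∃[ n ] Σ[ Cs ∈ List (Circuit n n) ]
    w ≡ encodeℕ n List.++ encodeCircuits Cs × Σ[ x ∈ Vec Bool n ] IsCondorcetWinner Cs x

PTW : Pred Language (lsuc 0ℓ)
PTW L = L ≤ₚ Weak-Tournament-Source

PCW : Pred Language (lsuc 0ℓ)
PCW L = L ≤ₚ Ckt-Condorcet

{-# OPTIONS --safe #-}

-- On inputs x and y, the reduced circuit runs every circuit Cᵢ on both x and y, compares the two
-- outputs, and keeps 1 + Σᵢ (1 + sgn (Cᵢ(x) - Cᵢ(y))) in unary; this exceeds the number of circuits plus one
-- iff the margin of x over y is positive.  Since the margin is antisymmetric, x is a Condorcet winner iff it is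
-- a weak source.  As operands refer backwards, a copy of Cᵢ has literally the same text as Cᵢ (up to
-- shifted inputs), and all operands of the other gates are linear forms in a few numbers that are known while
-- Cᵢ is being read.  So the text of the reduced circuit is produced in one pass over the input, with
-- unary counters whose loops are bounded by the input length.

module Submission where

open import Defs
open import Data.Bool.Base using (Bool; true; false; _∧_; _∨_; not; if_then_else_; T)
open import Data.Bool.Properties using (T-∧; ∧-zeroʳ; T-≡; ∨-idem)
open import Data.Empty using (⊥-elim)
open import Data.Fin.Base as Fin using (Fin; zero; suc; toℕ; fromℕ<)
open import Data.Fin.Patterns
open import Data.Fin.Properties using (_≟_; +↔⊎; toℕ-fromℕ<; toℕ<n)
open import Data.List.Base as List
  using (List; []; _∷_; length; replicate; drop; reverse; _ʳ++_; _++_; concatMap)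
open import Data.List.Properties
  using (++-ʳ++; ʳ++-ʳ++; length-++; ++-identityʳ; ++-assoc; length-reverse; reverse-involutive; ʳ++-defn;
         length-map; concatMap-++; map-++; map-replicate; ∷-injectiveʳ)
open import Data.Maybe.Base as Maybe using (Maybe; just; nothing)
open import Data.Nat.Base using (ℕ; zero; suc; _+_; _*_; _≤_; _<_; z≤n; s≤s; pred; _^_; _≤ᵇ_; _<ᵇ_)
open import Data.Nat.Properties
  using (≤-refl; ≤-trans; +-mono-≤; *-mono-≤; m≤m+n; m≤n+m; +-monoʳ-≤; ≤-reflexive; +-monoˡ-≤; *-monoˡ-≤;
         +-identityʳ; +-suc; pred[n]≤n; n≤1+n; +-assoc; m≤m*n; +-comm; module ≤-Reasoning; *-zeroʳ;
         +-monoʳ-<; <-≤-trans; ≤⇒≤ᵇ; ≤ᵇ⇒≤; <⇒≤; m<n⇒0<n∸m)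
open import Data.Nat.Tactic.RingSolver using (solve-∀)
open import Data.Product.Base as Product using (Σ; Σ-syntax; ∃-syntax; _×_; _,_; proj₁; proj₂)
open import Data.Sum.Algebra using (⊎-cong)
open import Data.Sum.Base as Sum using (_⊎_; inj₁; inj₂)
open import Data.Unit.Base using (⊤; tt)
open import Data.Vec.Base as Vec using (Vec; []; _∷_; lookup; toList)
open import Data.Vec.Properties
  using (lookup-map; lookup-zipWith; lookup∘update; lookup∘update′; toList-++; length-toList)
open import Function.Base using (_∘_; id)
open import Function.Bundles using (_↔_; mk↔ₛ′; Equivalence; _⇔_; mk⇔)
open import Function.Properties.Equivalence using (⇔-isEquivalence)
open import Function.Properties.Inverse using (↔-sym; ↔-trans)
open import Relation.Binary.PropositionalEquality
  using (_≡_; _≢_; refl; sym; trans; cong; cong₂; subst; module ≡-Reasoning)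
open import Relation.Binary.Structures using (IsEquivalence)
open import Relation.Nullary.Decidable.Core using (yes; no; does)
open import Relation.Unary using (_⊆_)
import Data.Vec.Properties as Vec

-- Tapes and fragments of machines

-- The initial tally has to be written before the number of circuits is known. The length W of the
-- whole input exceeds that number, so the tally gets W computed cells, and only the output index,
-- which is written last, depends on the number of circuits. Starting the tally at 1 keeps its cells
-- 0 and 1 true throughout, so that every computed cell has two predecessors.
--
-- Both languages quantify over whatever an input encodes. The converse direction of the reduction
-- therefore needs that the text of a circuit determines its values, and that a malformed input is
-- mapped to a non-instance: the input is parsed completely, and any failure produces the empty
-- word, which encodes nothing.
--
-- Polynomial time is proved for the Turing machines themselves. Fragments of machines obey Hoare
-- triples with time bounds, a small language of counter commands is compiled to fragments, and the
-- result is appended to the machine of the given reduction, whose tape 0 may be dirty on both sides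
-- of its output.

cell : List Symbol → ℕ → Symbol
cell []       _       = nothing
cell (s ∷ _)  zero    = s
cell (_ ∷ ss) (suc i) = cell ss i

first≡cell : ∀ ss → first ss ≡ cell ss 0
first≡cell []      = refl
first≡cell (_ ∷ _) = refl

cell-drop : ∀ ss i → cell (drop 1 ss) i ≡ cell ss (suc i)
cell-drop []       i = refl
cell-drop (_ ∷ ss) i = refl

infix 4 _∼_ _≈_ _≐_ _⊨_

_∼_ : List Symbol → List Symbol → Set
xs ∼ ys = ∀ i → cell xs i ≡ cell ys i

∼-first : ∀ {xs ys} → xs ∼ ys → first xs ≡ first ys
∼-first {xs} {ys} e = trans (first≡cell xs) (trans (e 0) (sym (first≡cell ys)))

∼-drop : ∀ {xs ys} → xs ∼ ys → drop 1 xs ∼ drop 1 ys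
∼-drop {xs} {ys} e i = trans (cell-drop xs i) (trans (e (suc i)) (sym (cell-drop ys i)))

∼-cons : ∀ {s s′ xs ys} → s ≡ s′ → xs ∼ ys → s ∷ xs ∼ s′ ∷ ys
∼-cons p e zero    = p
∼-cons p e (suc i) = e i

∼-first∷drop : ∀ ss → first ss ∷ drop 1 ss ∼ ss
∼-first∷drop []       zero    = refl
∼-first∷drop []       (suc i) = refl
∼-first∷drop (_ ∷ ss) i       = refl

∼-blank : nothing ∷ [] ∼ []
∼-blank zero    = refl
∼-blank (suc i) = refl

-- Tapes are compared up to trailing blanks.
record _≈_ (t u : Tape) : Set where
  constructor _,_
  field
    before≈ : Tape.before t ∼ Tape.before u
    from≈   : Tape.from t ∼ Tape.from u
open _≈_ public

≈-refl : ∀ {t} → t ≈ t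
≈-refl = (λ i → refl) , (λ i → refl)

≈-reflexive : ∀ {t u} → t ≡ u → t ≈ u
≈-reflexive refl = ≈-refl

≈-sym : ∀ {t u} → t ≈ u → u ≈ t
≈-sym (p , q) = (λ i → sym (p i)) , (λ i → sym (q i))

≈-trans : ∀ {t u v} → t ≈ u → u ≈ v → t ≈ v
≈-trans (p , q) (p′ , q′) = (λ i → trans (p i) (p′ i)) , (λ i → trans (q i) (q′ i))

scan-cong : ∀ {t u} → t ≈ u → scan t ≡ scan u
scan-cong {tape _ xs} {tape _ ys} e = ∼-first {xs} {ys} (from≈ e)

act-cong : ∀ a {t u} → t ≈ u → act a t ≈ act a u
act-cong (s , left)  {tape ls rs} {tape ls′ rs′} (p , q) =
  ∼-drop {ls} {ls′} p , ∼-cons (∼-first {ls} {ls′} p) (∼-cons refl (∼-drop {rs} {rs′} q))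
act-cong (s , stay)  {tape ls rs} {tape ls′ rs′} (p , q) = p , ∼-cons refl (∼-drop {rs} {rs′} q)
act-cong (s , right) {tape ls rs} {tape ls′ rs′} (p , q) = ∼-cons refl p , ∼-drop {rs} {rs′} q

idle : Symbol → Action
idle s = s , stay

-- Writing back the blank scanned on an empty list of cells lengthens the list. Idling is thus the
-- identity only up to `≈`, which is why all specifications are stated up to trailing blanks.
act-idle : ∀ t → act (idle (scan t)) t ≈ t
act-idle (tape ls rs) = (λ i → refl) , ∼-first∷drop rs

Tapes : ℕ → Set
Tapes K = Fin K → Tape

_≐_ : ∀ {K} → Tapes K → Tapes K → Set
σ ≐ τ = ∀ i → σ i ≈ τ i

_⊨_ : ∀ {K} → Vec Tape K → Tapes K → Set
ts ⊨ σ = ∀ i → lookup ts i ≈ σ i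

infixl 6 _[_↦_]

_[_↦_] : ∀ {K} → Tapes K → Fin K → Tape → Tapes K
(σ [ i ↦ t ]) j = if does (i ≟ j) then t else σ j

update-same : ∀ {K} (σ : Tapes K) i t → (σ [ i ↦ t ]) i ≡ t
update-same σ i t with i ≟ i
... | yes _  = refl
... | no i≢i = ⊥-elim (i≢i refl)

update-other : ∀ {K} (σ : Tapes K) {i j} t → i ≢ j → (σ [ i ↦ t ]) j ≡ σ j
update-other σ {i} {j} t i≢j with i ≟ j
... | yes i≡j = ⊥-elim (i≢j i≡j)
... | no _    = refl

update-≐ : ∀ {K} {σ τ : Tapes K} {i t} → t ≈ τ i → (∀ j → i ≢ j → σ j ≈ τ j) → σ [ i ↦ t ] ≐ τ
update-≐ {i = i} p q j with i ≟ j
... | yes refl = p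
... | no i≢j   = q j i≢j

update-cong : ∀ {K} {σ τ : Tapes K} {i t u} → t ≈ u → σ ≐ τ → σ [ i ↦ t ] ≐ τ [ i ↦ u ]
update-cong {i = i} p q j with i ≟ j
... | yes _ = p
... | no _  = q j

update-idem : ∀ {K} {σ : Tapes K} {i t u} → σ [ i ↦ t ] [ i ↦ u ] ≐ σ [ i ↦ u ]
update-idem {i = i} j with i ≟ j
... | yes _ = ≈-refl
... | no _  = ≈-refl

update-comm : ∀ {K} {σ : Tapes K} {i j t u} → i ≢ j → σ [ i ↦ t ] [ j ↦ u ] ≐ σ [ j ↦ u ] [ i ↦ t ]
update-comm {i = i} {j} i≢j k with i ≟ k | j ≟ k
... | yes refl | yes refl = ⊥-elim (i≢j refl)
... | yes _    | no _     = ≈-refl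
... | no _     | yes _    = ≈-refl
... | no _     | no _     = ≈-refl

update-id : ∀ {K} {σ : Tapes K} {i t} → t ≈ σ i → σ [ i ↦ t ] ≐ σ
update-id p = update-≐ p (λ _ _ → ≈-refl)

≐-refl : ∀ {K} {σ : Tapes K} → σ ≐ σ
≐-refl i = ≈-refl

≐-sym : ∀ {K} {σ τ : Tapes K} → σ ≐ τ → τ ≐ σ
≐-sym p i = ≈-sym (p i)

≐-trans : ∀ {K} {σ τ υ : Tapes K} → σ ≐ τ → τ ≐ υ → σ ≐ υ
≐-trans p q i = ≈-trans (p i) (q i)

-- A piece of a machine with K tapes that leaves through an exit in X.
record Frag (K : ℕ) (X : Set) : Set₁ where
  field
    Ctrl   : Set
    count  : ℕ
    finite : Ctrl ↔ Fin count
    entry  : Ctrl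
    instr   : Ctrl → Vec Symbol K → Vec Action K × (X ⊎ Ctrl)
open Frag public

-- Leaving is itself a step with an action. When fragments are composed, this step becomes the jump
-- into the next one, so that step counts simply add up.
data Exec {K : ℕ} {X S : Set} (nx : S → Vec Symbol K → Vec Action K × (X ⊎ S)) :
          S → Vec Tape K → ℕ → X → Vec Tape K → Set where
  exit : ∀ {s ts as x} → nx s (Vec.map scan ts) ≡ (as , inj₁ x) →
         Exec nx s ts 1 x (Vec.zipWith act as ts)
  more : ∀ {s ts as s′ t x ts′} → nx s (Vec.map scan ts) ≡ (as , inj₂ s′) →
         Exec nx s′ (Vec.zipWith act as ts) t x ts′ → Exec nx s ts (suc t) x ts′

-- A Hoare triple for total correctness with a time bound. Quantifying over all `ts` that model `σ`
-- absorbs the differences in trailing blanks.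
record Spec {K X} (F : Frag K X) (σ : Tapes K) (b : ℕ) (x : X) (τ : Tapes K) : Set where
  constructor spec
  field
    sound : ∀ ts → ts ⊨ σ →
            ∃[ t ] ∃[ ts′ ] t ≤ b × Exec (instr F) (entry F) ts t x ts′ × ts′ ⊨ τ
open Spec public

spec-conv : ∀ {K X} {F : Frag K X} {σ σ′ b b′ x τ τ′} →
            σ′ ≐ σ → b ≤ b′ → τ ≐ τ′ → Spec F σ b x τ → Spec F σ′ b′ x τ′
sound (spec-conv p q r h) ts m with sound h ts (λ i → ≈-trans (m i) (p i))
... | t , ts′ , t≤b , e , m′ = t , ts′ , ≤-trans t≤b q , e , λ i → ≈-trans (m′ i) (r i)

1↔⊤ : ⊤ ↔ Fin 1
1↔⊤ = mk↔ₛ′ (λ _ → zero) (λ _ → tt) (λ { zero → refl }) (λ _ → refl)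

atom : ∀ {K X} → Fin K → (Symbol → Action × X) → Frag K X
atom i f = record
  { Ctrl = ⊤ ; count = 1 ; finite = 1↔⊤ ; entry = tt
  ; instr = λ _ ss → Vec.map idle ss Vec.[ i ]≔ proj₁ (f (lookup ss i)) , inj₁ (proj₂ (f (lookup ss i))) }

atom-spec : ∀ {K X} (i : Fin K) (f : Symbol → Action × X) {σ s} → scan (σ i) ≡ s →
            Spec (atom i f) σ 1 (proj₂ (f s)) (σ [ i ↦ act (proj₁ (f s)) (σ i) ])
sound (atom-spec i f {σ} {s} refl) ts m = 1 , _ , ≤-refl , exit (cong (λ u → as , inj₁ (proj₂ (f u))) scanned) , models
  where
  scanned : lookup (Vec.map scan ts) i ≡ scan (σ i)
  scanned = trans (lookup-map i scan ts) (scan-cong (m i))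
  as = Vec.map idle (Vec.map scan ts) Vec.[ i ]≔ proj₁ (f (lookup (Vec.map scan ts) i))
  models : Vec.zipWith act as ts ⊨ σ [ i ↦ act (proj₁ (f (scan (σ i)))) (σ i) ]
  models j with i ≟ j
  ... | yes refl = ≈-trans
    (≈-reflexive (trans (lookup-zipWith act i as ts)
      (cong (λ a → act a (lookup ts i))
        (trans (lookup∘update i (Vec.map idle (Vec.map scan ts)) _) (cong (proj₁ ∘ f) scanned)))))
    (act-cong (proj₁ (f (scan (σ i)))) (m i))
  ... | no i≢j = ≈-trans
    (≈-reflexive (trans (lookup-zipWith act j as ts)
      (cong (λ a → act a (lookup ts j))
        (trans (lookup∘update′ (i≢j ∘ sym) (Vec.map idle (Vec.map scan ts)) _)
          (trans (lookup-map j idle (Vec.map scan ts)) (cong idle (lookup-map j scan ts)))))))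
    (≈-trans (act-idle (lookup ts j)) (m j))

mapExit : ∀ {K X Y} → (X → Y) → Frag K X → Frag K Y
mapExit g F = record
  { Ctrl = Ctrl F ; count = count F ; finite = finite F ; entry = entry F
  ; instr = λ s ss → Product.map₂ (Sum.map₁ g) (instr F s ss) }

map-exec : ∀ {K X Y S} {nx : S → Vec Symbol K → Vec Action K × (X ⊎ S)} (g : X → Y) {s ts t x ts′} →
           Exec nx s ts t x ts′ →
           Exec (λ s ss → Product.map₂ (Sum.map₁ g) (nx s ss)) s ts t (g x) ts′
map-exec g (exit e)   = exit (cong (Product.map₂ (Sum.map₁ g)) e)
map-exec g (more e r) = more (cong (Product.map₂ (Sum.map₁ g)) e) (map-exec g r)

map-spec : ∀ {K X Y} (g : X → Y) {F : Frag K X} {σ b x τ} →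
           Spec F σ b x τ → Spec (mapExit g F) σ b (g x) τ
sound (map-spec g h) ts m with sound h ts m
... | t , ts′ , t≤b , e , m′ = t , ts′ , t≤b , map-exec g e , m′

sumFin : ∀ k → (Fin k → ℕ) → ℕ
sumFin zero    c = 0
sumFin (suc k) c = c zero + sumFin k (c ∘ suc)

Σ-finite : ∀ k {P : Fin k → Set} {c : Fin k → ℕ} → (∀ i → P i ↔ Fin (c i)) →
           Σ (Fin k) P ↔ Fin (sumFin k c)
Σ-finite zero    f = mk↔ₛ′ (λ { (() , _) }) (λ ()) (λ ()) (λ { (() , _) })
Σ-finite (suc k) {P} {c} f =
  ↔-trans (mk↔ₛ′ to from (λ { (inj₁ _) → refl ; (inj₂ _) → refl })
                         (λ { (zero , _) → refl ; (suc _ , _) → refl }))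
    (↔-trans (⊎-cong (f zero) (Σ-finite k (f ∘ suc))) (↔-sym +↔⊎))
  where
  to : Σ (Fin (suc k)) P → P zero ⊎ Σ (Fin k) (P ∘ suc)
  to (zero  , p) = inj₁ p
  to (suc i , p) = inj₂ (i , p)
  from : P zero ⊎ Σ (Fin k) (P ∘ suc) → Σ (Fin (suc k)) P
  from (inj₁ p)       = zero , p
  from (inj₂ (i , p)) = suc i , p

module _ {K k X} (F : Fin k → Frag K (Fin k ⊎ X)) where

  route : ∀ l → (Fin k ⊎ X) ⊎ Ctrl (F l) → X ⊎ Σ (Fin k) (Ctrl ∘ F)
  route l (inj₁ (inj₁ l′)) = inj₂ (l′ , entry (F l′))
  route l (inj₁ (inj₂ x))  = inj₁ x
  route l (inj₂ s)         = inj₂ (l , s)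

  loopNext : Σ (Fin k) (Ctrl ∘ F) → Vec Symbol K → Vec Action K × (X ⊎ Σ (Fin k) (Ctrl ∘ F))
  loopNext (l , s) ss = Product.map₂ (route l) (instr (F l) s ss)

  -- Execution starts at the given label; an exit inj₁ l is a jump to the label l.
  loop : Fin k → Frag K X
  loop l = record
    { Ctrl = Σ (Fin k) (Ctrl ∘ F) ; count = sumFin k (count ∘ F) ; finite = Σ-finite k (finite ∘ F)
    ; entry = l , entry (F l) ; instr = loopNext }

  loop-exec-jump : ∀ {l s ts t l′ ts′ t′ x ts″} → Exec (instr (F l)) s ts t (inj₁ l′) ts′ →
                   Exec loopNext (l′ , entry (F l′)) ts′ t′ x ts″ →
                   Exec loopNext (l , s) ts (t + t′) x ts″
  loop-exec-jump {l} (exit e)   r = more (cong (Product.map₂ (route l)) e) r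
  loop-exec-jump {l} (more e q) r = more (cong (Product.map₂ (route l)) e) (loop-exec-jump q r)

  loop-exec-exit : ∀ {l s ts t x ts′} → Exec (instr (F l)) s ts t (inj₂ x) ts′ →
                   Exec loopNext (l , s) ts t x ts′
  loop-exec-exit {l} (exit e)   = exit (cong (Product.map₂ (route l)) e)
  loop-exec-exit {l} (more e q) = more (cong (Product.map₂ (route l)) e) (loop-exec-exit q)

  -- Sequencing, branching and all loops are instances of `loop`, so this rule and `loop-exit` are
  -- the only rules for control flow. Iteration needs no rule of its own: a loop is verified by
  -- induction on the number of its remaining passes.
  loop-jump : ∀ {l l′ σ τ υ b c x} → Spec (F l) σ b (inj₁ l′) τ → Spec (loop l′) τ c x υ →
              Spec (loop l) σ (b + c) x υ
  sound (loop-jump h g) ts m with sound h ts m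
  ... | t , ts′ , t≤b , e , m′ with sound g ts′ m′
  ... | u , ts″ , u≤c , e′ , m″ =
    t + u , ts″ , +-mono-≤ t≤b u≤c , loop-exec-jump e e′ , m″

  loop-exit : ∀ {l σ τ b x} → Spec (F l) σ b (inj₂ x) τ → Spec (loop l) σ b x τ
  sound (loop-exit h) ts m with sound h ts m
  ... | t , ts′ , t≤b , e , m′ = t , ts′ , t≤b , loop-exec-exit e , m′

infixr 5 _>>_

seqF : ∀ {K X} → Frag K ⊤ → Frag K X → Fin 2 → Frag K (Fin 2 ⊎ X)
seqF F G zero    = mapExit (λ _ → inj₁ (suc zero)) F
seqF F G (suc _) = mapExit inj₂ G

_>>_ : ∀ {K X} → Frag K ⊤ → Frag K X → Frag K X
F >> G = loop (seqF F G) zero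

>>-spec : ∀ {K X} {F : Frag K ⊤} {G : Frag K X} {σ τ υ b c x} →
          Spec F σ b tt τ → Spec G τ c x υ → Spec (F >> G) σ (b + c) x υ
>>-spec {F = F} {G} h g =
  loop-jump (seqF F G) {zero} (map-spec _ {F} h)
    (loop-exit (seqF F G) {suc zero} (map-spec inj₂ {G} g))

symbolLabel : Symbol → Fin 4
symbolLabel nothing      = suc zero
symbolLabel (just false) = suc (suc zero)
symbolLabel (just true)  = suc (suc (suc zero))

branchF : ∀ {K X} → Fin K → (Symbol → Frag K X) → Fin 4 → Frag K (Fin 4 ⊎ X)
branchF i F zero                   = atom i (λ s → idle s , inj₁ (symbolLabel s))
branchF i F (suc zero)             = mapExit inj₂ (F nothing)
branchF i F (suc (suc zero))       = mapExit inj₂ (F (just false))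
branchF i F (suc (suc (suc zero))) = mapExit inj₂ (F (just true))

branch : ∀ {K X} → Fin K → (Symbol → Frag K X) → Frag K X
branch i F = loop (branchF i F) zero

branch-spec : ∀ {K X} (i : Fin K) (F : Symbol → Frag K X) {σ s b x τ} → scan (σ i) ≡ s →
              Spec (F s) σ b x τ → Spec (branch i F) σ (1 + b) x τ
branch-spec {X = X} i F {σ} {s} p h =
  loop-jump (branchF i F) {zero} {symbolLabel s}
    (spec-conv {F = branchF i F zero} ≐-refl ≤-refl idled
      (atom-spec i (λ s → idle s , inj₁ (symbolLabel s)) p))
    (loop-exit (branchF i F) (selected s h))
  where
  idled : σ [ i ↦ act (idle s) (σ i) ] ≐ σ
  idled = update-id (≈-trans (≈-reflexive (cong (λ s → act (idle s) (σ i)) (sym p))) (act-idle (σ i)))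
  selected : ∀ s {b x τ} → Spec (F s) σ b x τ → Spec (branchF i F (symbolLabel s)) σ b (inj₂ x) τ
  selected nothing      h = map-spec inj₂ {F nothing} h
  selected (just false) h = map-spec inj₂ {F (just false)} h
  selected (just true)  h = map-spec inj₂ {F (just true)} h

-- Counters and words on tapes

goto : ∀ {K X} → Fin (suc K) → X → Frag (suc K) X
goto i x = atom i (λ s → idle s , x)

atom-at : ∀ {K X} {σ : Tapes K} {i t t′} (f : Symbol → Action × X) {s} →
          scan t ≡ s → act (proj₁ (f s)) t ≈ t′ →
          Spec (atom i f) (σ [ i ↦ t ]) 1 (proj₂ (f s)) (σ [ i ↦ t′ ])
atom-at {σ = σ} {i} {t} f {s} p q =
  spec-conv {F = atom i f} ≐-refl ≤-refl
    (≐-trans (update-cong {i = i}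
               (≈-trans (≈-reflexive (cong (act (proj₁ (f s))) (update-same σ i t))) q) ≐-refl)
             (update-idem {i = i}))
    (atom-spec i f (trans (cong scan (update-same σ i t)) p))

focus : ∀ {K X} {F : Frag K X} {σ : Tapes K} {i t b x τ} → t ≈ σ i →
        Spec F (σ [ i ↦ t ]) b x τ → Spec F σ b x τ
focus {F = F} {i = i} p = spec-conv {F = F} (≐-sym (update-id {i = i} p)) ≤-refl ≐-refl

goto-spec : ∀ {K X} {σ : Tapes (suc K)} {i} {x : X} → Spec (goto i x) σ 1 x σ
goto-spec {σ = σ} {i} {x} = focus {F = goto i x} {i = i} ≈-refl
  (spec-conv {F = goto i x} ≐-refl ≤-refl (update-id {i = i} ≈-refl)
    (atom-at (λ s → idle s , x) refl (act-idle (σ i))))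

branch-at : ∀ {K X} {σ : Tapes K} {i t} (F : Symbol → Frag K X) {s b x τ} → scan t ≡ s →
            Spec (F s) (σ [ i ↦ t ]) b x τ → Spec (branch i F) (σ [ i ↦ t ]) (1 + b) x τ
branch-at {σ = σ} {i} {t} F p = branch-spec i F (trans (cong scan (update-same σ i t)) p)

-- A stack with the given cells, top first.  The head is on the top cell.
home : List Symbol → Tape
home cs = tape (drop 1 cs) (first cs ∷ [])

ones : ℕ → List Symbol
ones k = replicate k (just true)

pushF : ∀ {K} → Fin K → Bool → Frag K ⊤
pushF i b = atom i (λ s → (s , right) , tt) >> atom i (λ _ → (just b , stay) , tt)

push-spec : ∀ {K} {σ : Tapes K} {i cs b} →
            Spec (pushF i b) (σ [ i ↦ home cs ]) 2 tt (σ [ i ↦ home (just b ∷ cs) ])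
push-spec {cs = cs} {b} =
  >>-spec {F = atom _ (λ s → (s , right) , tt)} {G = atom _ (λ _ → (just b , stay) , tt)}
    (atom-at {t′ = tape cs []} (λ s → (s , right) , tt) {first cs} refl (∼-first∷drop cs , λ _ → refl))
    (atom-at (λ _ → (just b , stay) , tt) {nothing} refl ≈-refl)

popF : ∀ {K X} → Fin K → X → Frag K X
popF i x = atom i (λ _ → (nothing , left) , x)

pop-spec : ∀ {K X} {σ : Tapes K} {i cs} {x : X} →
           Spec (popF i x) (σ [ i ↦ home cs ]) 1 x (σ [ i ↦ home (drop 1 cs) ])
pop-spec {cs = cs} {x} = atom-at (λ _ → (nothing , left) , x) {first cs} refl
  ((λ _ → refl) , ∼-cons refl ∼-blank)

clearF : ∀ {K} → Fin (suc K) → Fin 1 → Frag (suc K) (Fin 1 ⊎ ⊤)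
clearF i _ = branch i λ { nothing → goto i (inj₂ tt) ; (just _) → popF i (inj₁ zero) }

clear : ∀ {K} → Fin (suc K) → Frag (suc K) ⊤
clear i = loop (clearF i) zero

clear-spec : ∀ {K} {σ : Tapes (suc K)} {i} k →
             Spec (clear i) (σ [ i ↦ home (ones k) ]) (k * 2 + 2) tt (σ [ i ↦ home (ones 0) ])
clear-spec {σ = σ} {i} zero = loop-exit (clearF i) {zero}
  (branch-at _ refl (goto-spec {σ = σ [ i ↦ home [] ]}))
clear-spec {σ = σ} {i} (suc k) = loop-jump (clearF i) {zero}
  (branch-at _ refl (pop-spec {σ = σ} {cs = ones (suc k)})) (clear-spec k)

-- A counter with p ones up to the head and q ones to the right of the head.
slot : ℕ → ℕ → Tape
slot p q = tape (drop 1 (ones p)) (first (ones p) ∷ ones q)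

module _ {K : ℕ} (i : Fin K) (body : Frag K ⊤) where

  -- The head itself counts the passes. It walks down the ones of its tape, with `body` run once on
  -- each, and then back up; so the counter keeps its value and no scratch copy is required.
  forwardF : Fin 1 → Frag K (Fin 1 ⊎ ⊤)
  forwardF _ = branch i λ
    { nothing  → atom i (λ s → (s , right) , inj₂ tt)
    ; (just _) → body >> atom i (λ s → (s , left) , inj₁ zero) }

  returnF : Fin 1 → Frag K (Fin 1 ⊎ ⊤)
  returnF _ = branch i λ
    { nothing  → atom i (λ s → (s , left) , inj₂ tt)
    ; (just _) → atom i (λ s → (s , right) , inj₁ zero) }

  for : Frag K ⊤
  for = loop forwardF zero >> loop returnF zero

  forCost : ℕ → ℕ → ℕ
  forCost k b = (k * (1 + (b + 1)) + 2) + (k * 2 + 2)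

  -- `τ q` is the invariant after q passes. The same q is the number of ones to the right of the
  -- head, so the position of the head records the progress.
  forward-spec : ∀ (τ : ℕ → Tapes K) b →
    (∀ p q → Spec body (τ q [ i ↦ slot (suc p) q ]) b tt (τ (suc q) [ i ↦ slot (suc p) q ])) →
    ∀ p q {k} → p + q ≡ k →
    Spec (loop forwardF zero) (τ q [ i ↦ slot p q ]) (p * (1 + (b + 1)) + 2) tt (τ k [ i ↦ tape [] (ones k) ])
  forward-spec τ b h zero q refl = loop-exit forwardF {zero}
    (branch-at _ refl (atom-at (λ s → (s , right) , inj₂ tt) {nothing} refl (∼-blank , λ _ → refl)))
  forward-spec τ b h (suc p) q e =
    spec-conv {F = loop forwardF zero} ≐-refl
      (≤-reflexive (sym (+-assoc (1 + (b + 1)) (p * (1 + (b + 1))) 2))) ≐-refl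
      (loop-jump forwardF {zero} {zero}
        (branch-at _ refl
          (>>-spec {F = body} {G = atom i (λ s → (s , left) , inj₁ zero)} (h p q)
            (atom-at (λ s → (s , left) , inj₁ zero) {just true} refl ≈-refl)))
        (forward-spec τ b h p (suc q) (trans (+-suc p q) e)))

  return-spec : ∀ {σ : Tapes K} p q {k} → q + p ≡ k →
    Spec (loop returnF zero) (σ [ i ↦ tape (ones p) (ones q) ]) (q * 2 + 2) tt (σ [ i ↦ home (ones k) ])
  return-spec p zero refl = loop-exit returnF {zero}
    (branch-at _ refl (atom-at (λ s → (s , left) , inj₂ tt) {nothing} refl
      ((λ _ → refl) , ∼-cons refl ∼-blank)))
  return-spec p (suc q) e = loop-jump returnF {zero} {zero}
    (branch-at _ refl (atom-at (λ s → (s , right) , inj₁ zero) {just true} refl ≈-refl))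
    (return-spec (suc p) q (trans (+-suc q p) e))

  for-spec : ∀ (τ : ℕ → Tapes K) b →
    (∀ p q → Spec body (τ q [ i ↦ slot (suc p) q ]) b tt (τ (suc q) [ i ↦ slot (suc p) q ])) →
    ∀ k → Spec for (τ 0 [ i ↦ home (ones k) ]) (forCost k b) tt (τ k [ i ↦ home (ones k) ])
  for-spec τ b h k =
    >>-spec {F = loop forwardF zero} {G = loop returnF zero}
      (forward-spec τ b h k 0 (+-identityʳ k)) (return-spec 0 k (+-identityʳ k))

forCost-mono : ∀ {K} (i : Fin K) body {k k′} b → k ≤ k′ → forCost i body k b ≤ forCost i body k′ b
forCost-mono i body b k≤k′ =
  +-mono-≤ (+-monoˡ-≤ 2 (*-monoˡ-≤ (1 + (b + 1)) k≤k′)) (+-monoˡ-≤ 2 (*-monoˡ-≤ 2 k≤k′))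

module _ {K : ℕ} (i j : Fin (suc K)) where

  rewindF : Fin 1 → Frag (suc K) (Fin 1 ⊎ ⊤)
  rewindF _ = branch i λ
    { nothing  → atom i (λ s → (s , right) , inj₂ tt)
    ; (just _) → atom i (λ s → (s , left) , inj₁ zero) }

  transferF : Fin 1 → Frag (suc K) (Fin 1 ⊎ ⊤)
  transferF _ = branch i λ
    { nothing  → goto i (inj₂ tt)
    ; (just b) → pushF j b >> atom i (λ _ → (nothing , right) , inj₁ zero) }

  -- Popping the buffer would reverse it. The head therefore first runs to the bottom of the stack,
  -- and the transfer copies upwards, which preserves the order in which the bits were emitted.
  flushF : Frag (suc K) ⊤
  flushF = loop rewindF zero >> loop transferF zero

  flushCost : ℕ → ℕ
  flushCost k = (k * 2 + 2) + (k * 4 + 2)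

  rewind-spec : ∀ {σ : Tapes (suc K)} (u r : Word) →
    Spec (loop rewindF zero)
      (σ [ i ↦ tape (drop 1 (List.map just u)) (first (List.map just u) ∷ List.map just r) ])
      (length u * 2 + 2) tt (σ [ i ↦ tape [] (List.map just (u ʳ++ r)) ])
  rewind-spec [] r = loop-exit rewindF {zero}
    (branch-at _ refl (atom-at (λ s → (s , right) , inj₂ tt) {nothing} refl (∼-blank , λ _ → refl)))
  rewind-spec (b ∷ u) r = loop-jump rewindF {zero} {zero}
    (branch-at _ refl (atom-at (λ s → (s , left) , inj₁ zero) {just b} refl ≈-refl))
    (rewind-spec u (b ∷ r))

  transfer-spec : i ≢ j → ∀ {σ : Tapes (suc K)} (u v : Word) →
    Spec (loop transferF zero)
      (σ [ j ↦ home (List.map just v) ] [ i ↦ tape [] (List.map just u) ])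
      (length u * 4 + 2) tt (σ [ j ↦ home (List.map just (u ʳ++ v)) ] [ i ↦ home [] ])
  transfer-spec i≢j {σ} [] v = loop-exit transferF {zero}
    (branch-at _ refl
      (spec-conv {F = goto i (inj₂ tt)} ≐-refl ≤-refl
        (update-cong {i = i} ((λ _ → refl) , λ { zero → refl ; (suc _) → refl }) ≐-refl)
        goto-spec))
  transfer-spec i≢j {σ} (b ∷ u) v = loop-jump transferF {zero} {zero}
    (branch-at _ refl
      (>>-spec {F = pushF j b} {G = atom i (λ _ → (nothing , right) , inj₁ zero)}
        (spec-conv {F = pushF j b} (update-comm (i≢j ∘ sym)) ≤-refl (update-comm i≢j)
          (push-spec {σ = σ [ i ↦ _ ]} {cs = List.map just v}))
        -- The erased cell ends up as a trailing blank to the left of the head, invisible to `≈`.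
        (atom-at (λ _ → (nothing , right) , inj₁ zero) {just b} refl (∼-blank , λ _ → refl))))
    (transfer-spec i≢j u (b ∷ v))

  flush-spec : i ≢ j → ∀ {σ : Tapes (suc K)} (u v : Word) →
    Spec flushF (σ [ j ↦ home (List.map just v) ] [ i ↦ home (List.map just u) ])
      (flushCost (length u)) tt (σ [ j ↦ home (List.map just (reverse u ʳ++ v)) ] [ i ↦ home [] ])
  flush-spec i≢j {σ} u v =
    >>-spec {F = loop rewindF zero} {G = loop transferF zero}
      (rewind-spec {σ = σ [ j ↦ _ ]} u [])
      (spec-conv {F = loop transferF zero} ≐-refl
        (≤-reflexive (cong (λ l → l * 4 + 2) (length-reverse u))) ≐-refl
        (transfer-spec i≢j {σ} (reverse u) v))

-- Programs on counters

Counter : Set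
Counter = Fin 9

Counters : Set
Counters = Vec ℕ 9

infixr 6 _·_

-- Words that depend on counters. Operands of gates are written in unary, so a gate whose operands
-- are linear forms in the counters has a text of this shape, and so has a block of gates repeated
-- as often as a counter says.
data Expr : Set where
  ε   : Expr
  bit : Bool → Expr
  _·_ : Expr → Expr → Expr
  rep : Counter → Expr → Expr

copies : ∀ {A : Set} → ℕ → List A → List A
copies zero    xs = []
copies (suc k) xs = xs ++ copies k xs

⟦_⟧ : Expr → Counters → Word
⟦ ε ⟧       ks = []
⟦ bit b ⟧   ks = b ∷ []
⟦ e · f ⟧   ks = ⟦ e ⟧ ks ++ ⟦ f ⟧ ks
⟦ rep c e ⟧ ks = copies (lookup ks c) (⟦ e ⟧ ks)

fresh : Counter → Expr → Bool
fresh c ε          = true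
fresh c (bit b)    = true
fresh c (e · f)    = fresh c e ∧ fresh c f
fresh c (rep c′ e) = not (does (c ≟ c′)) ∧ fresh c e

-- The loop over a counter moves the head on its tape, so that the loop's
-- body must not read that counter.
wellFormed : Expr → Bool
wellFormed ε         = true
wellFormed (bit b)   = true
wellFormed (e · f)   = wellFormed e ∧ wellFormed f
wellFormed (rep c e) = fresh c e ∧ wellFormed e

Tapes₁₂ : Set
Tapes₁₂ = Tapes 12

Fragment : Set → Set₁
Fragment = Frag 12

-- Tape 0 is the input and output tape.
outTape bufTape : Fin 12
outTape = suc zero
bufTape = suc (suc zero)

ct : Counter → Fin 12
ct c = suc (suc (suc c))

emitF : Fin 12 → Expr → Fragment ⊤
emitF d ε         = goto d tt
emitF d (bit b)   = pushF d b
emitF d (e · f)   = emitF d e >> emitF d f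
emitF d (rep c e) = for (ct c) (emitF d e)

emitCost : Expr → ℕ → ℕ
emitCost ε         B = 1
emitCost (bit b)   B = 2
emitCost (e · f)   B = emitCost e B + emitCost f B
emitCost (rep c e) B = (B * (1 + (emitCost e B + 1)) + 2) + (B * 2 + 2)

iter : ℕ → Word → Word → Word
iter zero    w o = o
iter (suc q) w o = w ʳ++ iter q w o

copies-snoc : ∀ k (w : Word) → copies k w ++ w ≡ w ++ copies k w
copies-snoc zero    w = sym (++-identityʳ w)
copies-snoc (suc k) w = trans (++-assoc w (copies k w) w) (cong (w ++_) (copies-snoc k w))

-- The loop adds its last pass on the outside, `copies` its first; the two agree because a word
-- commutes with its own copies.
iter≡copies : ∀ k w o → iter k w o ≡ copies k w ʳ++ o
iter≡copies zero    w o = refl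
iter≡copies (suc k) w o =
  trans (cong (w ʳ++_) (iter≡copies k w o))
    (trans (sym (++-ʳ++ (copies k w))) (cong (_ʳ++ o) (copies-snoc k w)))

does-refl : ∀ {n} (i : Fin n) → does (i ≟ i) ≡ true
does-refl i with i ≟ i
... | yes _  = refl
... | no i≢i = ⊥-elim (i≢i refl)

T-split : ∀ a {b} → T (a ∧ b) → T a × T b
T-split a = Equivalence.to (T-∧ {a})

word : Word → Tape
word w = home (List.map just w)

bounded : Counters → ℕ → Set
bounded ks B = ∀ c → lookup ks c ≤ B

-- Only counters that occur in `e` are assumed to be in home position. Inside a loop over `c`, the
-- head on the tape of `c` is somewhere in the middle, and the induction goes through because the
-- body is `fresh` for `c`.
emit-spec : ∀ d → (∀ c → ct c ≢ d) → ∀ e → T (wellFormed e) → ∀ {σ : Tapes₁₂} {ks B} o → bounded ks B →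
  (∀ c → fresh c e ≡ false → home (ones (lookup ks c)) ≈ σ (ct c)) →
  Spec (emitF d e) (σ [ d ↦ word o ]) (emitCost e B) tt (σ [ d ↦ word (⟦ e ⟧ ks ʳ++ o) ])
emit-spec d d∉ ε wf o ks≤B reg = goto-spec
emit-spec d d∉ (bit b) wf o ks≤B reg = push-spec {cs = List.map just o}
emit-spec d d∉ (e · f) wf {σ} {ks} o ks≤B reg = spec-conv {F = emitF d (e · f)} ≐-refl ≤-refl
  (update-cong {i = d} (≈-reflexive (cong word (sym (++-ʳ++ (⟦ e ⟧ ks))))) ≐-refl)
  (>>-spec {F = emitF d e} {G = emitF d f}
    (emit-spec d d∉ e (proj₁ (T-split (wellFormed e) wf)) o ks≤B (λ c p → reg c (cong (_∧ fresh c f) p)))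
    (emit-spec d d∉ f (proj₂ (T-split (wellFormed e) wf)) (⟦ e ⟧ ks ʳ++ o) ks≤B
      (λ c p → reg c (trans (cong (fresh c e ∧_) p) (∧-zeroʳ (fresh c e))))))
emit-spec d d∉ (rep c e) wf {σ} {ks} {B} o ks≤B reg = spec-conv {F = for (ct c) (emitF d e)} (≐-sym (focused o))
  (forCost-mono (ct c) (emitF d e) {k} {B} (emitCost e B) (ks≤B c))
  (≐-trans (focused (iter k w o)) (update-cong {σ = σ} {σ} {d} (≈-reflexive (cong word (iter≡copies k w o))) ≐-refl))
  (for-spec (ct c) (emitF d e) (λ q → σ [ d ↦ word (iter q w o) ]) (emitCost e B) body k)
  where
  k = lookup ks c
  w = ⟦ e ⟧ ks
  fr  = proj₁ (T-split (fresh c e) wf)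
  wf′ = proj₂ (T-split (fresh c e) wf)
  counter : home (ones k) ≈ σ (ct c)
  counter = reg c (cong (λ b → not b ∧ fresh c e) (does-refl c))
  focused : ∀ o → σ [ d ↦ word o ] [ ct c ↦ home (ones k) ] ≐ σ [ d ↦ word o ]
  focused o = update-id {σ = σ [ d ↦ word o ]} {ct c} {home (ones k)}
    (≈-trans counter (≈-reflexive (sym (update-other σ (word o) (d∉ c ∘ sym)))))
  other : ∀ t c′ → fresh c′ e ≡ false → home (ones (lookup ks c′)) ≈ (σ [ ct c ↦ t ]) (ct c′)
  other t c′ p = ≈-trans (reg c′ (trans (cong (not (does (c′ ≟ c)) ∧_) p) (∧-zeroʳ (not (does (c′ ≟ c))))))
    (≈-reflexive (sym (update-other σ {ct c} {ct c′} t λ { refl → subst T p fr })))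
  body : ∀ p q → Spec (emitF d e) (σ [ d ↦ word (iter q w o) ] [ ct c ↦ slot (suc p) q ]) (emitCost e B) tt
                      (σ [ d ↦ word (iter (suc q) w o) ] [ ct c ↦ slot (suc p) q ])
  body p q = spec-conv {F = emitF d e} (update-comm (d∉ c ∘ sym)) ≤-refl (update-comm (d∉ c))
    (emit-spec d d∉ e wf′ (iter q w o) ks≤B (other (slot (suc p) q)))

length-copies : ∀ k (w : Word) → length (copies k w) ≡ k * length w
length-copies zero    w = refl
length-copies (suc k) w = trans (length-++ w) (cong (length w +_) (length-copies k w))

-- Each bit takes at least one step, so the time bound doubles as a bound on the text emitted, and
-- thereby on the growth of the buffer and of the output.
length≤emitCost : ∀ e {ks B} → bounded ks B → length (⟦ e ⟧ ks) ≤ emitCost e B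
length≤emitCost ε       ks≤B = z≤n
length≤emitCost (bit _) ks≤B = s≤s z≤n
length≤emitCost (e · f) {ks} ks≤B = ≤-trans (≤-reflexive (length-++ (⟦ e ⟧ ks)))
  (+-mono-≤ (length≤emitCost e {ks} ks≤B) (length≤emitCost f {ks} ks≤B))
length≤emitCost (rep c e) {ks} {B} ks≤B =
  ≤-trans (≤-reflexive (length-copies (lookup ks c) (⟦ e ⟧ ks)))
  (≤-trans (*-mono-≤ (ks≤B c)
      (≤-trans (length≤emitCost e {ks} ks≤B) (≤-trans (m≤m+n _ 1) (n≤1+n _))))
    (≤-trans (m≤m+n _ 2) (m≤m+n _ (B * 2 + 2))))

record Memory : Set where
  constructor mem
  field
    out buf  : Word
    counters : Counters
open Memory public

-- `out` and `buf` are kept as stacks with the latest bit on top, hence `reverse`.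
conf : Tape → Memory → Tapes₁₂
conf t (mem o y ks) zero                = t
conf t (mem o y ks) (suc zero)          = word (reverse o)
conf t (mem o y ks) (suc (suc zero))    = word (reverse y)
conf t (mem o y ks) (suc (suc (suc c))) = home (ones (lookup ks c))

data Dest : Set where
  toOut toBuf : Dest

destTape : Dest → Fin 12
destTape toOut = outTape
destTape toBuf = bufTape

data Command : Set where
  emit        : Dest → (e : Expr) {_ : T (wellFormed e)} → Command
  inc dec clr : Counter → Command
  copy        : (c c′ : Counter) {_ : T (not (does (c ≟ c′)))} → Command
  flush       : Command

exec : Command → Memory → Memory
exec (emit toOut e) (mem o y ks) = mem (o ++ ⟦ e ⟧ ks) y ks
exec (emit toBuf e) (mem o y ks) = mem o (y ++ ⟦ e ⟧ ks) ks
exec (inc c)        (mem o y ks) = mem o y (ks Vec.[ c ]≔ suc (lookup ks c))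
exec (dec c)        (mem o y ks) = mem o y (ks Vec.[ c ]≔ pred (lookup ks c))
exec (clr c)        (mem o y ks) = mem o y (ks Vec.[ c ]≔ 0)
exec (copy c c′)    (mem o y ks) = mem o y (ks Vec.[ c ]≔ lookup ks c′)
exec flush          (mem o y ks) = mem (o ++ y) [] ks

execF : Command → Fragment ⊤
execF (emit d e)   = emitF (destTape d) e
execF (inc c)      = pushF (ct c) true
execF (dec c)      = popF (ct c) tt
execF (clr c)      = clear (ct c)
execF (copy c c′)  = clear (ct c) >> for (ct c′) (pushF (ct c) true)
execF flush        = flushF bufTape outTape

-- B bounds the counters, and y the length of the buffer.
cost : Command → ℕ → ℕ → ℕ
cost (emit d e)  B y = emitCost e B
cost (inc c)     B y = 2
cost (dec c)     B y = 1
cost (clr c)     B y = B * 2 + 2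
cost (copy c c′) B y = (B * 2 + 2) + ((B * (1 + (2 + 1)) + 2) + (B * 2 + 2))
cost flush       B y = (y * 2 + 2) + (y * 4 + 2)

record Bounded (B y : ℕ) (μ : Memory) : Set where
  constructor bnd
  field
    counters≤ : bounded (counters μ) B
    buf≤      : length (buf μ) ≤ y
open Bounded public

conf-counter : ∀ {t o y ks} c {k u} → u ≈ home (ones k) →
               conf t (mem o y ks) [ ct c ↦ u ] ≐ conf t (mem o y (ks Vec.[ c ]≔ k))
conf-counter c p zero = ≈-refl
conf-counter c p (suc zero) = ≈-refl
conf-counter c p (suc (suc zero)) = ≈-refl
conf-counter {ks = ks} c {k} p (suc (suc (suc c′))) with c ≟ c′
... | yes refl = ≈-trans p (≈-reflexive (cong (home ∘ ones) (sym (lookup∘update c ks k))))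
... | no c≢c′  = ≈-reflexive (cong (home ∘ ones) (sym (lookup∘update′ (c≢c′ ∘ sym) ks k)))

conf-out : ∀ {t o y ks o′ u} → u ≈ word (reverse o′) →
           conf t (mem o y ks) [ outTape ↦ u ] ≐ conf t (mem o′ y ks)
conf-out p zero = ≈-refl
conf-out p (suc zero) = p
conf-out p (suc (suc zero)) = ≈-refl
conf-out p (suc (suc (suc c))) = ≈-refl

conf-buf : ∀ {t o y ks y′ u} → u ≈ word (reverse y′) →
           conf t (mem o y ks) [ bufTape ↦ u ] ≐ conf t (mem o y′ ks)
conf-buf p zero = ≈-refl
conf-buf p (suc zero) = ≈-refl
conf-buf p (suc (suc zero)) = p
conf-buf p (suc (suc (suc c))) = ≈-refl

conf-input : ∀ {t t′ μ u} → u ≈ t′ → conf t μ [ zero ↦ u ] ≐ conf t′ μ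
conf-input p zero = p
conf-input p (suc zero) = ≈-refl
conf-input p (suc (suc zero)) = ≈-refl
conf-input p (suc (suc (suc c))) = ≈-refl

at : ∀ {X} {F : Fragment X} i {t μ t′ μ′ b x u} → conf t μ i ≡ u →
     ∀ {v} → conf t μ [ i ↦ v ] ≐ conf t′ μ′ →
     Spec F (conf t μ [ i ↦ u ]) b x (conf t μ [ i ↦ v ]) → Spec F (conf t μ) b x (conf t′ μ′)
at {F = F} i p q h = spec-conv {F = F} (≐-sym (update-id {i = i} (≈-reflexive (sym p)))) ≤-refl q h

T-not⇒≢ : ∀ {n} {i j : Fin n} → T (not (does (i ≟ j))) → i ≢ j
T-not⇒≢ {i = i} t refl = subst (T ∘ not) (does-refl i) t

ct-injective : ∀ {c c′} → c ≢ c′ → ct c ≢ ct c′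
ct-injective p refl = p refl

ct≢dest : ∀ d c → ct c ≢ destTape d
ct≢dest toOut c ()
ct≢dest toBuf c ()

drop-ones : ∀ k → drop 1 (ones k) ≡ ones (pred k)
drop-ones zero    = refl
drop-ones (suc k) = refl

exec-spec : ∀ C {t B y} μ → Bounded B y μ →
            Spec (execF C) (conf t μ) (cost C B y) tt (conf t (exec C μ))
exec-spec (emit toOut e {wf}) {t} μ@(mem o y ks) b =
  at {F = emitF outTape e} outTape refl
    (conf-out (≈-reflexive (cong word (sym (++-ʳ++ o)))))
    (emit-spec outTape (ct≢dest toOut) e wf {conf t μ} (reverse o) (counters≤ b) (λ c _ → ≈-refl))
exec-spec (emit toBuf e {wf}) {t} μ@(mem o y ks) b =
  at {F = emitF bufTape e} bufTape refl
    (conf-buf (≈-reflexive (cong word (sym (++-ʳ++ y)))))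
    (emit-spec bufTape (ct≢dest toBuf) e wf {conf t μ} (reverse y) (counters≤ b) (λ c _ → ≈-refl))
exec-spec (inc c) {t} μ b = at {F = pushF (ct c) true} (ct c) refl (conf-counter c ≈-refl)
  (push-spec {σ = conf t μ} {cs = ones (lookup (counters μ) c)})
exec-spec (dec c) {t} μ b = at {F = popF (ct c) tt} (ct c) refl
  (conf-counter c (≈-reflexive (cong home (drop-ones (lookup (counters μ) c)))))
  (pop-spec {σ = conf t μ} {cs = ones (lookup (counters μ) c)})
exec-spec (clr c) {t} {B} μ b = at {F = clear (ct c)} (ct c) refl (conf-counter c ≈-refl)
  (spec-conv {F = clear (ct c)} ≐-refl (+-monoˡ-≤ 2 (*-monoˡ-≤ 2 (counters≤ b c))) ≐-refl
    (clear-spec {σ = conf t μ} (lookup (counters μ) c)))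
exec-spec (copy c c′ {c≠c′}) {t} {B} μ@(mem o y ks) b =
  >>-spec {τ = conf t (mem o y (ks Vec.[ c ]≔ 0))} cleared
    (spec-conv (≐-sym (≐-trans (focused 0) (conf-counter {t} {o} {y} {ks} c ≈-refl)))
      (forCost-mono (ct c′) (pushF (ct c) true) {lookup ks c′} {B} 2 (counters≤ b c′))
      (≐-trans (focused (lookup ks c′)) (conf-counter {t} {o} {y} {ks} c ≈-refl))
      (for-spec (ct c′) (pushF (ct c) true) τ 2 body (lookup ks c′)))
  where
  c≢c′ : ct c ≢ ct c′
  c≢c′ = ct-injective (T-not⇒≢ c≠c′)
  τ : ℕ → Tapes₁₂
  τ q = conf t μ [ ct c ↦ home (ones q) ]
  cleared : Spec (clear (ct c)) (conf t μ) (B * 2 + 2) tt (conf t (mem o y (ks Vec.[ c ]≔ 0)))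
  cleared = at (ct c) refl (conf-counter {t} {o} {y} {ks} c {0} {home []} ≈-refl)
    (spec-conv ≐-refl (+-monoˡ-≤ 2 (*-monoˡ-≤ 2 (counters≤ b c))) ≐-refl
      (clear-spec {σ = conf t μ} (lookup ks c)))
  focused : ∀ q → τ q [ ct c′ ↦ home (ones (lookup ks c′)) ] ≐ τ q
  focused q = update-id {σ = τ q} {ct c′} {home (ones (lookup ks c′))}
    (≈-reflexive (sym (update-other (conf t μ) (home (ones q)) c≢c′)))
  body : ∀ p q → Spec (pushF (ct c) true) (τ q [ ct c′ ↦ slot (suc p) q ]) 2 tt
                      (τ (suc q) [ ct c′ ↦ slot (suc p) q ])
  body p q = spec-conv (update-comm {σ = conf t μ} {ct c} {ct c′} c≢c′) ≤-refl
    (update-comm {σ = conf t μ} {ct c′} {ct c} (c≢c′ ∘ sym))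
    (push-spec {σ = conf t μ [ ct c′ ↦ slot (suc p) q ]} {cs = ones q})
exec-spec flush {t} {B} {y} (mem o w ks) b =
  spec-conv {F = flushF bufTape outTape}
    (λ { zero → ≈-refl ; (suc zero) → ≈-refl ; (suc (suc zero)) → ≈-refl ; (suc (suc (suc c))) → ≈-refl })
    (+-mono-≤ (+-monoˡ-≤ 2 (*-monoˡ-≤ 2 len≤)) (+-monoˡ-≤ 2 (*-monoˡ-≤ 4 len≤)))
    (λ { zero → ≈-refl
       ; (suc zero) → ≈-reflexive (cong word
           (trans (cong (_ʳ++ reverse o) (reverse-involutive w)) (sym (++-ʳ++ o))))
       ; (suc (suc zero)) → ≈-refl ; (suc (suc (suc c))) → ≈-refl })
    (flush-spec bufTape outTape (λ ()) {conf t (mem o w ks)} (reverse w) (reverse o))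
  where
  len≤ : length (reverse w) ≤ y
  len≤ = ≤-trans (≤-reflexive (length-reverse w)) (buf≤ b)

growth : Command → ℕ → ℕ
growth (emit d e)  B = emitCost e B
growth (inc c)     B = 0
growth (dec c)     B = 0
growth (clr c)     B = 0
growth (copy c c′) B = 0
growth flush       B = 0

bounded-weaken : ∀ {B B′ y y′ μ} → B ≤ B′ → y ≤ y′ → Bounded B y μ → Bounded B′ y′ μ
bounded-weaken p q (bnd h l) = bnd (λ c → ≤-trans (h c) p) (≤-trans l q)

bounded-suc : ∀ ks {B} → bounded ks B → bounded ks (suc B)
bounded-suc ks h c = ≤-trans (h c) (n≤1+n _)

bounded-update : ∀ ks {B k} c → bounded ks B → k ≤ suc B → bounded (ks Vec.[ c ]≔ k) (suc B)
bounded-update ks {B} {k} c h k≤ c′ with c ≟ c′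
... | yes refl = ≤-trans (≤-reflexive (lookup∘update c ks k)) k≤
... | no c≢c′  = ≤-trans (≤-reflexive (lookup∘update′ (c≢c′ ∘ sym) ks k)) (bounded-suc ks h c′)

-- No command raises the bound on the counters by more than one; in particular `copy` only repeats a
-- value that is bounded already. This keeps the counters linear in the length of the input, and
-- hence all costs polynomial.
exec-bounded : ∀ C {B y μ} → Bounded B y μ → Bounded (suc B) (y + growth C B) (exec C μ)
exec-bounded (emit toOut e) {μ = mem o w ks} (bnd h l) = bnd (bounded-suc ks h) (≤-trans l (m≤m+n _ _))
exec-bounded (emit toBuf e) {μ = mem o w ks} (bnd h l) = bnd (bounded-suc ks h)
  (≤-trans (≤-reflexive (length-++ w)) (+-mono-≤ l (length≤emitCost e {ks} h)))
exec-bounded (inc c) {μ = mem o w ks} (bnd h l) =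
  bnd (bounded-update ks c h (s≤s (h c))) (≤-trans l (m≤m+n _ _))
exec-bounded (dec c) {μ = mem o w ks} (bnd h l) =
  bnd (bounded-update ks c h (≤-trans pred[n]≤n (bounded-suc ks h c))) (≤-trans l (m≤m+n _ _))
exec-bounded (clr c) {μ = mem o w ks} (bnd h l) = bnd (bounded-update ks c h z≤n) (≤-trans l (m≤m+n _ _))
exec-bounded (copy c c′) {μ = mem o w ks} (bnd h l) =
  bnd (bounded-update ks c h (bounded-suc ks h c′)) (≤-trans l (m≤m+n _ _))
exec-bounded flush {μ = mem o w ks} (bnd h l) = bnd (bounded-suc ks h) z≤n

infixr 5 _⨾_

data Code (M : Set) : Set where
  become : M → Code M
  _⨾_    : Command → Code M → Code M
  -- The first branch is taken if the counter is zero.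
  test   : Counter → Code M → Code M → Code M

module _ {M : Set} where

  zero? : ∀ {A : Set} → ℕ → A → A → A
  zero? zero    a b = a
  zero? (suc _) a b = b

  run : Code M → Memory → M × Memory
  run (become m)   μ = m , μ
  run (C ⨾ P)      μ = run P (exec C μ)
  run (test c P Q) μ = zero? (lookup (counters μ) c) (run P μ) (run Q μ)

  runF : Code M → Fragment M
  runF (become m)   = goto zero m
  runF (C ⨾ P)      = execF C >> runF P
  runF (test c P Q) = branch (ct c) λ { nothing → runF P ; (just _) → runF Q }

  -- Both branches of a test are added up instead of taking their maximum: sums of polynomials are
  -- polynomials again, and the bound may be crude.
  runGrowth : Code M → ℕ → ℕ
  runGrowth (become m)   B = 0
  runGrowth (C ⨾ P)      B = growth C B + runGrowth P (suc B)
  runGrowth (test c P Q) B = runGrowth P B + runGrowth Q B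

  depth : Code M → ℕ
  depth (become m)   = 0
  depth (C ⨾ P)      = suc (depth P)
  depth (test c P Q) = depth P + depth Q

  runCost : Code M → ℕ → ℕ → ℕ
  runCost (become m)   B y = 1
  runCost (C ⨾ P)      B y = cost C B y + runCost P (suc B) (y + growth C B)
  runCost (test c P Q) B y = 1 + (runCost P B y + runCost Q B y)

  run-spec : ∀ P {t B y} μ → Bounded B y μ →
             Spec (runF P) (conf t μ) (runCost P B y) (proj₁ (run P μ)) (conf t (proj₂ (run P μ)))
  run-spec (become m) μ b = goto-spec
  run-spec (C ⨾ P) μ b =
    >>-spec {F = execF C} {G = runF P} (exec-spec C μ b) (run-spec P (exec C μ) (exec-bounded C b))
  run-spec (test c P Q) {t} {B} {y} μ b = by-value (lookup (counters μ) c) refl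
    where
    by-value : ∀ k → lookup (counters μ) c ≡ k →
               Spec (runF (test c P Q)) (conf t μ) (runCost (test c P Q) B y)
                    (proj₁ (zero? k (run P μ) (run Q μ))) (conf t (proj₂ (zero? k (run P μ) (run Q μ))))
    by-value zero eq = spec-conv ≐-refl (s≤s (m≤m+n _ _)) ≐-refl
      (branch-spec (ct c) _ {conf t μ} {nothing} (cong (λ k → first (ones k)) eq) (run-spec P μ b))
    by-value (suc k) eq = spec-conv ≐-refl (s≤s (m≤n+m _ _)) ≐-refl
      (branch-spec (ct c) _ {conf t μ} {just true} (cong (λ k → first (ones k)) eq) (run-spec Q μ b))

  run-bounded : ∀ P {B y μ} → Bounded B y μ →
                Bounded (depth P + B) (y + runGrowth P B) (proj₂ (run P μ))
  run-bounded (become m) {y = y} b = bounded-weaken ≤-refl (m≤m+n y 0) b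
  run-bounded (C ⨾ P) {B} {y} b = bounded-weaken (≤-reflexive (+-suc (depth P) B))
    (≤-reflexive (+-assoc y (growth C B) _)) (run-bounded P (exec-bounded C b))
  run-bounded (test c P Q) {B} {y} {μ} b with lookup (counters μ) c
  ... | zero  = bounded-weaken (+-monoˡ-≤ B (m≤m+n (depth P) (depth Q)))
    (+-monoʳ-≤ y (m≤m+n _ _)) (run-bounded P b)
  ... | suc _ = bounded-weaken (+-monoˡ-≤ B (m≤n+m (depth Q) (depth P)))
    (+-monoʳ-≤ y (m≤n+m _ _)) (run-bounded Q b)

-- Transducers

pattern cN  = zero
pattern cR  = suc zero
pattern cS  = suc (suc zero)
pattern cQ  = suc (suc (suc zero))
pattern cT  = suc (suc (suc (suc zero)))
pattern cB  = suc (suc (suc (suc (suc zero))))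
pattern cM  = suc (suc (suc (suc (suc (suc zero)))))
pattern cW  = suc (suc (suc (suc (suc (suc (suc zero))))))
pattern cW′ = suc (suc (suc (suc (suc (suc (suc (suc zero)))))))

-- W and W′ both hold the length of the input, so that a loop over one can be nested in a loop over the other.
initialCounters : ℕ → Counters
initialCounters l = 0 ∷ 0 ∷ 0 ∷ 0 ∷ 0 ∷ 0 ∷ 0 ∷ l ∷ l ∷ []

initialMemory : ℕ → Memory
initialMemory l = mem [] [] (initialCounters l)

≐-reflexive : ∀ {K} {σ τ : Tapes K} → σ ≡ τ → σ ≐ τ
≐-reflexive refl = ≐-refl

input-at : ∀ {X} {F : Fragment X} {t μ b x t′} → Spec F (conf t μ [ zero ↦ t ]) b x (conf t μ [ zero ↦ t′ ]) →
           Spec F (conf t μ) b x (conf t′ μ)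
input-at = at zero refl (conf-input ≈-refl)

moveF : ∀ {X} → Direction → X → Fragment X
moveF d x = atom zero (λ s → (s , d) , x)

move-spec : ∀ {X} {d} {x : X} {t μ} → Spec (moveF d x) (conf t μ) 1 x (conf (act (scan t , d) t) μ)
move-spec {d = d} {x} = input-at (atom-at (λ s → (s , d) , x) refl ≈-refl)

-- `l` and `J` stand for leftovers of an earlier computation: the output of a machine begins at the
-- head and ends at the first blank, and anything may lie outside.
data-tape : List Symbol → Word → List Symbol → Tape
data-tape l r J = tape l (List.map just r ++ nothing ∷ J)

prepassF : Fin 1 → Fragment (Fin 1 ⊎ ⊤)
prepassF _ = branch zero λ
  { nothing  → goto zero (inj₂ tt)
  ; (just _) → execF (inc cW) >> execF (inc cW′) >> moveF right (inj₁ zero) }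

prepass-spec : ∀ {l J} r q →
  Spec (loop prepassF zero) (conf (data-tape l r J) (initialMemory q)) (length r * 6 + 2) tt
       (conf (data-tape (List.map just r ʳ++ l) [] J) (initialMemory (length r + q)))
prepass-spec [] q = loop-exit prepassF {zero} (branch-spec zero _ refl goto-spec)
prepass-spec {l} {J} (b ∷ r) q = loop-jump prepassF {zero} {zero}
  (branch-spec zero _ {conf _ (initialMemory q)} refl
    (>>-spec (exec-spec (inc cW) (initialMemory q) bounds₀)
      (>>-spec (exec-spec (inc cW′) (exec (inc cW) (initialMemory q)) (exec-bounded (inc cW) bounds₀))
        move-spec)))
  (spec-conv ≐-refl ≤-refl
    (≐-reflexive (cong (conf (data-tape (List.map just (b ∷ r) ʳ++ l) [] J) ∘ initialMemory) (+-suc (length r) q)))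
    (prepass-spec r (suc q)))
  where
  bounds₀ : Bounded q 0 (initialMemory q)
  bounds₀ = bnd (λ { cN → z≤n ; cR → z≤n ; cS → z≤n ; cQ → z≤n ; cT → z≤n ; cB → z≤n ; cM → z≤n
                   ; cW → ≤-refl ; cW′ → ≤-refl }) z≤n

back : ℕ → Tape → Tape
back zero    t = t
back (suc q) t = act (scan (back q t) , left) (back q t)

back-left : ∀ q t → back q (act (scan t , left) t) ≡ back (suc q) t
back-left zero    t = refl
back-left (suc q) t = cong (λ u → act (scan u , left) u) (back-left q t)

back-over : ∀ u {l s r} → back (length u) (tape (u ++ l) (s ∷ r)) ≡ tape l (u ʳ++ s ∷ r)
back-over []      = refl
back-over (x ∷ u) {l} {s} {r} = trans (sym (back-left (length u) (tape (x ∷ u ++ l) (s ∷ r)))) (back-over u)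

back-data : ∀ l w J → back (length w) (data-tape (List.map just w ʳ++ l) [] J) ≡ data-tape l w J
back-data l w J = trans
  (cong₂ (λ k ls → back k (tape ls (nothing ∷ J)))
    (sym (trans (length-reverse (List.map just w)) (length-map just w))) (ʳ++-defn (List.map just w)))
  (trans (back-over (reverse (List.map just w))) (cong (tape l) (ʳ++-ʳ++ (List.map just w))))

-- The cell to the left of the input may hold a leftover bit, so the start of the input cannot be
-- recognised by a blank. Instead the head moves left as often as `cW` says, which is the length
-- just counted.
rewindInput : Fragment ⊤
rewindInput = for (ct cW) (moveF left tt)

counter-id : ∀ {t} μ c → conf t μ [ ct c ↦ home (ones (lookup (counters μ) c)) ] ≐ conf t μ
counter-id {t} μ c = update-id {σ = conf t μ} {ct c} ≈-refl

rewindInput-spec : ∀ {t} n → Spec rewindInput (conf t (initialMemory n)) ((n * 3 + 2) + (n * 2 + 2)) tt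
                                  (conf (back n t) (initialMemory n))
rewindInput-spec {t} n =
  spec-conv (≐-sym (counter-id (initialMemory n) cW)) ≤-refl (counter-id (initialMemory n) cW)
    (for-spec (ct cW) (moveF left tt) (λ q → conf (back q t) (initialMemory n)) 1 body n)
  where
  body : ∀ p q → Spec (moveF left tt) (conf (back q t) (initialMemory n) [ ct cW ↦ slot (suc p) q ]) 1 tt
                      (conf (back (suc q) t) (initialMemory n) [ ct cW ↦ slot (suc p) q ])
  body p q = spec-conv (≐-sym (update-id {σ = τ} {zero} ≈-refl)) ≤-refl
    (λ { zero → ≈-refl ; (suc zero) → ≈-refl ; (suc (suc zero)) → ≈-refl ; (suc (suc (suc c))) → ≈-refl })
    (atom-at {σ = τ} {zero} (λ s → (s , left) , tt) refl ≈-refl)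
    where
    τ = conf (back q t) (initialMemory n) [ ct cW ↦ slot (suc p) q ]

writeF : Fin 1 → Fragment (Fin 1 ⊎ ⊤)
writeF _ = branch outTape λ
  { nothing  → moveF right (inj₂ tt)
  ; (just b) → popF outTape tt >> atom zero (λ _ → (just b , left) , inj₁ zero) }

-- The stack yields the last bit first, so the output is written from right to left, starting just
-- before the blank that ended the input. That blank now terminates the output, and whatever lies to
-- the left is overwritten as far as needed.
finishF : Fragment ⊤
finishF = moveF left tt >> loop writeF zero

write-spec : ∀ {σ : Tapes₁₂} u l x v J → ∃[ l′ ]
  Spec (loop writeF zero) (σ [ outTape ↦ word u ] [ zero ↦ tape l (x ∷ List.map just v ++ nothing ∷ J) ])
       (length u * 3 + 2) tt (σ [ outTape ↦ word [] ] [ zero ↦ data-tape l′ (u ʳ++ v) J ])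
write-spec [] l x v J = x ∷ l , loop-exit writeF {zero}
  (branch-spec outTape _ refl (atom-at (λ s → (s , right) , inj₂ tt) refl ≈-refl))
write-spec {σ} (b ∷ u) l x v J =
  let l′ , h = write-spec {σ} u (drop 1 l) (first l) (b ∷ v) J in
  l′ , loop-jump writeF {zero} {zero}
  (branch-spec outTape _ refl
    (>>-spec {τ = σ [ outTape ↦ word u ] [ zero ↦ tape l (x ∷ List.map just v ++ nothing ∷ J) ]}
      (spec-conv (update-comm {σ = σ} {outTape} {zero} (λ ())) ≤-refl (update-comm {σ = σ} {zero} {outTape} (λ ()))
        (pop-spec {σ = σ [ zero ↦ _ ]} {cs = List.map just (b ∷ u)}))
      (atom-at (λ _ → (just b , left) , inj₁ zero) refl ≈-refl)))
  h

finish-spec : ∀ l J o y ks → ∃[ l′ ]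
  Spec finishF (conf (data-tape l [] J) (mem o y ks)) (1 + (length o * 3 + 2)) tt
       (conf (data-tape l′ o J) (mem [] y ks))
finish-spec l J o y ks =
  let l′ , h = write-spec {conf (data-tape l [] J) (mem o y ks)} (reverse o) (drop 1 l) (first l) [] J in
  l′ , >>-spec move-spec
  (spec-conv (λ { zero → ≈-refl ; (suc zero) → ≈-refl ; (suc (suc zero)) → ≈-refl ; (suc (suc (suc c))) → ≈-refl })
    (≤-reflexive (cong (λ k → k * 3 + 2) (length-reverse o)))
    (λ { zero → ≈-reflexive (cong (λ v → data-tape l′ v J) (reverse-involutive o))
       ; (suc zero) → ≈-refl ; (suc (suc zero)) → ≈-refl ; (suc (suc (suc c))) → ≈-refl })
    h)

-- The final length of the output enters the cost of writing it onto tape 0; the time already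
-- accounted for bounds it.
exec-out : ∀ C {B y μ} → Bounded B y μ → length (out (exec C μ)) ≤ length (out μ) + cost C B y
exec-out (emit toOut e) {μ = mem o w ks} (bnd h l) =
  ≤-trans (≤-reflexive (length-++ o)) (+-monoʳ-≤ (length o) (length≤emitCost e {ks} h))
exec-out (emit toBuf e) b = m≤m+n _ _
exec-out (inc c)        b = m≤m+n _ _
exec-out (dec c)        b = m≤m+n _ _
exec-out (clr c)        b = m≤m+n _ _
exec-out (copy c c′)    b = m≤m+n _ _
exec-out flush {y = y} {μ = mem o w ks} (bnd h l) = ≤-trans (≤-reflexive (length-++ o)) (+-monoʳ-≤ (length o)
  (≤-trans l (≤-trans (m≤m*n y 2) (≤-trans (m≤m+n (y * 2) 2) (m≤m+n _ _)))))

run-out : ∀ {M} (P : Code M) {B y μ} → Bounded B y μ →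
          length (out (proj₂ (run P μ))) ≤ length (out μ) + runCost P B y
run-out (become m) b = m≤m+n _ _
run-out (C ⨾ P) {B} {y} {μ} b = ≤-trans (run-out P (exec-bounded C b))
  (≤-trans (+-monoˡ-≤ _ (exec-out C b)) (≤-reflexive (+-assoc (length (out μ)) _ _)))
run-out (test c P Q) {B} {y} {μ} b with lookup (counters μ) c
... | zero  = ≤-trans (run-out P b) (+-monoʳ-≤ (length (out μ)) (≤-trans (m≤m+n _ _) (n≤1+n _)))
... | suc _ = ≤-trans (run-out Q b) (+-monoʳ-≤ (length (out μ)) (≤-trans (m≤n+m _ _) (n≤1+n _)))

term≤sumFin : ∀ {k} (c : Fin k → ℕ) i → c i ≤ sumFin k c
term≤sumFin c zero    = m≤m+n _ _
term≤sumFin c (suc i) = ≤-trans (term≤sumFin (c ∘ suc) i) (m≤n+m _ _)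

-- A machine that reads its input once, from left to right.
record Transducer : Set where
  field
    modes  : ℕ
    code   : Fin modes → Bool → Code (Fin modes)
    initialMode accept : Fin modes

module _ (Tr : Transducer) where
  open Transducer Tr

  process : Fin modes × Memory → Word → Fin modes × Memory
  process (m , μ) []      = m , μ
  process (m , μ) (b ∷ w) = process (run (code m b) μ) w

  result : Fin modes × Memory → Word
  result (m , μ) = if does (m ≟ accept) then out μ else []

  transduce : Word → Word
  transduce w = result (process (initialMode , initialMemory (length w)) w)

  total : (Code (Fin modes) → ℕ) → ℕ
  total g = sumFin modes (λ m → g (code m true) + g (code m false))

  term≤total : ∀ g m b → g (code m b) ≤ total g
  term≤total g m true  = ≤-trans (m≤m+n _ _) (term≤sumFin (λ m → g (code m true) + g (code m false)) m)
  term≤total g m false = ≤-trans (m≤n+m _ _) (term≤sumFin (λ m → g (code m true) + g (code m false)) m)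

  -- Outside of the mode `accept` the head stays on the blank behind the input, and the output read
  -- from there is the empty word.
  endF : Bool → Fragment (Fin modes ⊎ ⊤)
  endF true  = mapExit inj₂ finishF
  endF false = goto zero (inj₂ tt)

  readF : Fin modes → Fragment (Fin modes ⊎ ⊤)
  readF m = branch zero λ
    { nothing  → endF (does (m ≟ accept))
    ; (just b) → moveF right tt >> mapExit inj₁ (runF (code m b)) }

  module _ (B y : ℕ) where

    stepCost : ℕ
    stepCost = total (λ P → runCost P B y)

    endCost : ℕ → ℕ
    endCost o = 1 + (o * 3 + 2)

    readCost : ℕ → ℕ → ℕ
    readCost n o = n * (2 + stepCost) + (1 + endCost (o + n * stepCost))

    end-spec : ∀ a l J μ c → length (out μ) ≤ c → ∃[ l′ ] ∃[ μ′ ]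
      Spec (endF a) (conf (data-tape l [] J) μ) (endCost c) (inj₂ tt)
           (conf (data-tape l′ (if a then out μ else []) J) μ′)
    end-spec true l J μ@(mem o w ks) c o≤c =
      let l′ , h = finish-spec l J o w ks in
      l′ , _ , map-spec inj₂ (spec-conv ≐-refl (s≤s (+-monoˡ-≤ 2 (*-monoˡ-≤ 3 o≤c))) ≐-refl h)
    end-spec false l J μ c o≤c = l , μ , spec-conv ≐-refl (s≤s z≤n) ≐-refl goto-spec

    -- The fixed bounds `B` and `y` price every single step. The current bounds `B₀` and `y₀` grow
    -- along the way, and the last two hypotheses say that the growth over the rest of the input
    -- stays within the fixed ones.
    read-spec : ∀ {l J} m w μ {B₀ y₀ c} → Bounded B₀ y₀ μ → length (out μ) ≤ c →
      B₀ + length w * total depth ≤ B → y₀ + length w * total (λ P → runGrowth P B) ≤ y → ∃[ l′ ] ∃[ μ′ ]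
      Spec (loop readF m) (conf (data-tape l w J) μ) (readCost (length w) c) tt
           (conf (data-tape l′ (result (process (m , μ) w)) J) μ′)
    read-spec {l} {J} m [] μ {c = c} b o≤c B≤ y≤ =
      let l′ , μ′ , h = end-spec (does (m ≟ accept)) l J μ (c + 0) (≤-trans o≤c (m≤m+n c 0)) in
      l′ , μ′ , loop-exit readF (branch-spec zero _ refl h)
    read-spec {l} {J} m (x ∷ w) μ {B₀} {y₀} {c} b o≤c B≤ y≤ =
      let l′ , μ′ , h = read-spec {just x ∷ l} {J} (proj₁ (run (code m x) μ)) w (proj₂ (run (code m x) μ))
            {total depth + B₀} {y₀ + total (λ P → runGrowth P B)} {c + stepCost} b′
            (≤-trans (run-out (code m x) b₁) (+-mono-≤ o≤c (term≤total (λ P → runCost P B y) m x)))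
            (≤-trans (≤-reflexive (trans (cong (_+ n * total depth) (+-comm (total depth) B₀)) (+-assoc B₀ _ _))) B≤)
            (≤-trans (≤-reflexive (+-assoc y₀ _ _)) y≤)
      in l′ , μ′ , spec-conv ≐-refl cost≤ ≐-refl
        (loop-jump readF (branch-spec zero _ refl
          (>>-spec move-spec (map-spec inj₁ (run-spec (code m x) μ b₁)))) h)
      where
      n = length w
      B₀≤B : B₀ ≤ B
      B₀≤B = ≤-trans (m≤m+n _ _) B≤
      b₁ : Bounded B y μ
      b₁ = bounded-weaken B₀≤B (≤-trans (m≤m+n _ _) y≤) b
      b′ : Bounded (total depth + B₀) (y₀ + total (λ P → runGrowth P B)) (proj₂ (run (code m x) μ))
      b′ = bnd
        (λ i → ≤-trans (counters≤ (run-bounded (code m x) b) i) (+-monoˡ-≤ B₀ (term≤total depth m x)))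
        (≤-trans (buf≤ (run-bounded (code m x) (bounded-weaken B₀≤B (≤-refl {y₀}) b)))
          (+-monoʳ-≤ y₀ (term≤total (λ P → runGrowth P B) m x)))
      cost≤ : (1 + (1 + runCost (code m x) B y)) + readCost n (c + stepCost) ≤ readCost (suc n) c
      cost≤ = begin
        (2 + runCost (code m x) B y) + readCost n (c + stepCost)
          ≤⟨ +-monoˡ-≤ _ (+-monoʳ-≤ 2 (term≤total (λ P → runCost P B y) m x)) ⟩
        (2 + stepCost) + (n * (2 + stepCost) + (1 + endCost (c + stepCost + n * stepCost)))
          ≡⟨ +-assoc (2 + stepCost) _ _ ⟨
        suc n * (2 + stepCost) + (1 + endCost (c + stepCost + n * stepCost))
          ≡⟨ cong (λ k → suc n * (2 + stepCost) + (1 + endCost k)) (+-assoc c stepCost _) ⟩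
        readCost (suc n) c ∎
        where open ≤-Reasoning

  programF : Fragment ⊤
  programF = loop prepassF zero >> (rewindInput >> loop readF initialMode)

  counterBound bufferBound programCost : ℕ → ℕ
  counterBound n = n + n * total depth
  bufferBound n = n * total (λ P → runGrowth P (counterBound n))
  programCost n = (n * 6 + 2) + (((n * 3 + 2) + (n * 2 + 2)) + readCost (counterBound n) (bufferBound n) n 0)

  program-spec : ∀ l w J → ∃[ l′ ] ∃[ μ′ ]
    Spec programF (conf (data-tape l w J) (initialMemory 0)) (programCost (length w)) tt
         (conf (data-tape l′ (transduce w) J) μ′)
  program-spec l w J =
    let l′ , μ′ , h = read-spec (counterBound (length w)) (bufferBound (length w)) {l} {J} initialMode w
                        (initialMemory (length w)) {length w} {0} {0} initialBounds z≤n ≤-refl ≤-refl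
    in l′ , μ′ ,
      >>-spec (spec-conv ≐-refl ≤-refl
          (≐-reflexive (cong (conf (data-tape (List.map just w ʳ++ l) [] J) ∘ initialMemory) (+-identityʳ (length w))))
          (prepass-spec w 0))
        (>>-spec (spec-conv ≐-refl ≤-refl
            (≐-reflexive (cong (λ t → conf t (initialMemory (length w))) (back-data l w J)))
            (rewindInput-spec (length w)))
          h)
    where
    initialBounds : Bounded (length w) 0 (initialMemory (length w))
    initialBounds = bnd (λ { cN → z≤n ; cR → z≤n ; cS → z≤n ; cQ → z≤n ; cT → z≤n ; cB → z≤n ; cM → z≤n
                           ; cW → ≤-refl ; cW′ → ≤-refl }) z≤n

-- Polynomial bounds

addP : List ℕ → List ℕ → List ℕ
addP []      q       = q
addP (a ∷ p) []      = a ∷ p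
addP (a ∷ p) (b ∷ q) = a + b ∷ addP p q

scaleP : ℕ → List ℕ → List ℕ
scaleP a = List.map (a *_)

mulP : List ℕ → List ℕ → List ℕ
mulP []      q = []
mulP (a ∷ p) q = addP (scaleP a q) (0 ∷ mulP p q)

compP : List ℕ → List ℕ → List ℕ
compP []      q = []
compP (a ∷ p) q = addP (a ∷ []) (mulP q (compP p q))

eval-addP : ∀ p q x → evalPoly (addP p q) x ≡ evalPoly p x + evalPoly q x
eval-addP []      q       x = refl
eval-addP (a ∷ p) []      x = sym (+-identityʳ _)
eval-addP (a ∷ p) (b ∷ q) x =
  trans (cong (λ e → a + b + x * e) (eval-addP p q x)) (lemma a b x (evalPoly p x) (evalPoly q x))
  where
  lemma : ∀ a b x p q → a + b + x * (p + q) ≡ a + x * p + (b + x * q)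
  lemma = solve-∀

eval-scaleP : ∀ a p x → evalPoly (scaleP a p) x ≡ a * evalPoly p x
eval-scaleP a []      x = sym (*-zeroʳ a)
eval-scaleP a (b ∷ p) x = trans (cong (λ e → a * b + x * e) (eval-scaleP a p x)) (lemma a b x (evalPoly p x))
  where
  lemma : ∀ a b x p → a * b + x * (a * p) ≡ a * (b + x * p)
  lemma = solve-∀

eval-mulP : ∀ p q x → evalPoly (mulP p q) x ≡ evalPoly p x * evalPoly q x
eval-mulP []      q x = refl
eval-mulP (a ∷ p) q x = trans (eval-addP (scaleP a q) (0 ∷ mulP p q) x)
  (trans (cong₂ (λ e f → e + x * f) (eval-scaleP a q x) (eval-mulP p q x))
    (lemma a x (evalPoly p x) (evalPoly q x)))
  where
  lemma : ∀ a x p q → a * q + x * (p * q) ≡ (a + x * p) * q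
  lemma = solve-∀

eval-compP : ∀ p q x → evalPoly (compP p q) x ≡ evalPoly p (evalPoly q x)
eval-compP []      q x = refl
eval-compP (a ∷ p) q x = trans (eval-addP (a ∷ []) (mulP q (compP p q)) x)
  (cong₂ _+_ (trans (cong (a +_) (*-zeroʳ x)) (+-identityʳ a))
    (trans (eval-mulP q (compP p q) x) (cong (evalPoly q x *_) (eval-compP p q x))))

evalPoly-mono : ∀ p {x y} → x ≤ y → evalPoly p x ≤ evalPoly p y
evalPoly-mono []      x≤y = z≤n
evalPoly-mono (a ∷ p) x≤y = +-monoʳ-≤ a (*-mono-≤ x≤y (evalPoly-mono p x≤y))

record PolyBounded (f : ℕ → ℕ) : Set where
  constructor _,_
  field
    poly    : List ℕ
    bounds  : ∀ x → f x ≤ evalPoly poly x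
open PolyBounded

pb-poly : ∀ p → PolyBounded (evalPoly p)
pb-poly p = p , λ x → ≤-refl

pb-const : ∀ c → PolyBounded (λ _ → c)
pb-const c = (c ∷ []) , λ x → m≤m+n c _

pb-id : PolyBounded (λ x → x)
pb-id = (0 ∷ 1 ∷ []) , λ x → ≤-reflexive (lemma x)
  where
  lemma : ∀ x → x ≡ x * (1 + x * 0)
  lemma = solve-∀

infixl 6 _⊕_
infixl 7 _⊗_

_⊕_ : ∀ {f g} → PolyBounded f → PolyBounded g → PolyBounded (λ x → f x + g x)
(p , h) ⊕ (q , k) = addP p q , λ x → ≤-trans (+-mono-≤ (h x) (k x)) (≤-reflexive (sym (eval-addP p q x)))

_⊗_ : ∀ {f g} → PolyBounded f → PolyBounded g → PolyBounded (λ x → f x * g x)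
(p , h) ⊗ (q , k) = mulP p q , λ x → ≤-trans (*-mono-≤ (h x) (k x)) (≤-reflexive (sym (eval-mulP p q x)))

pb-comp : ∀ p {f} → PolyBounded f → PolyBounded (λ x → evalPoly p (f x))
pb-comp p (q , h) = compP p q , λ x → ≤-trans (evalPoly-mono p (h x)) (≤-reflexive (sym (eval-compP p q x)))

pb-suc : ∀ {f} → PolyBounded f → PolyBounded (λ x → suc (f x))
pb-suc f = pb-const 1 ⊕ f

pb-times : ∀ {f} c → PolyBounded f → PolyBounded (λ x → f x * c)
pb-times c f = f ⊗ pb-const c

pb-emit : ∀ e {f} → PolyBounded f → PolyBounded (λ x → emitCost e (f x))
pb-emit ε         f = pb-const 1
pb-emit (bit _)   f = pb-const 2
pb-emit (e · e′)  f = pb-emit e f ⊕ pb-emit e′ f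
pb-emit (rep c e) f =
  (f ⊗ pb-suc (pb-emit e f ⊕ pb-const 1) ⊕ pb-const 2) ⊕ (pb-times 2 f ⊕ pb-const 2)

pb-cost : ∀ C {f g} → PolyBounded f → PolyBounded g → PolyBounded (λ x → cost C (f x) (g x))
pb-cost (emit d e)  f g = pb-emit e f
pb-cost (inc c)     f g = pb-const 2
pb-cost (dec c)     f g = pb-const 1
pb-cost (clr c)     f g = pb-times 2 f ⊕ pb-const 2
pb-cost (copy c c′) f g =
  (pb-times 2 f ⊕ pb-const 2) ⊕ ((pb-times 4 f ⊕ pb-const 2) ⊕ (pb-times 2 f ⊕ pb-const 2))
pb-cost flush       f g = (pb-times 2 g ⊕ pb-const 2) ⊕ (pb-times 4 g ⊕ pb-const 2)

pb-growth : ∀ C {f} → PolyBounded f → PolyBounded (λ x → growth C (f x))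
pb-growth (emit d e)  f = pb-emit e f
pb-growth (inc c)     f = pb-const 0
pb-growth (dec c)     f = pb-const 0
pb-growth (clr c)     f = pb-const 0
pb-growth (copy c c′) f = pb-const 0
pb-growth flush       f = pb-const 0

pb-runCost : ∀ {M} (P : Code M) {f g} → PolyBounded f → PolyBounded g → PolyBounded (λ x → runCost P (f x) (g x))
pb-runCost (become m)   f g = pb-const 1
pb-runCost (C ⨾ P)      f g = pb-cost C f g ⊕ pb-runCost P (pb-suc f) (g ⊕ pb-growth C f)
pb-runCost (test c P Q) f g = pb-suc (pb-runCost P f g ⊕ pb-runCost Q f g)

pb-runGrowth : ∀ {M} (P : Code M) {f} → PolyBounded f → PolyBounded (λ x → runGrowth P (f x))
pb-runGrowth (become m)   f = pb-const 0
pb-runGrowth (C ⨾ P)      f = pb-growth C f ⊕ pb-runGrowth P (pb-suc f)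
pb-runGrowth (test c P Q) f = pb-runGrowth P f ⊕ pb-runGrowth Q f

pb-sum : ∀ k (g : Fin k → ℕ → ℕ) → (∀ i → PolyBounded (g i)) → PolyBounded (λ x → sumFin k (λ i → g i x))
pb-sum zero    g h = pb-const 0
pb-sum (suc k) g h = h zero ⊕ pb-sum k (g ∘ suc) (h ∘ suc)

module _ (Tr : Transducer) where
  open Transducer Tr

  pb-total : (g : Code (Fin modes) → ℕ → ℕ) → (∀ P → PolyBounded (g P)) →
             PolyBounded (λ x → total Tr (λ P → g P x))
  pb-total g h = pb-sum modes _ (λ m → h (code m true) ⊕ h (code m false))

  pb-counterBound : PolyBounded (counterBound Tr)
  pb-counterBound = pb-id ⊕ pb-times (total Tr depth) pb-id

  pb-bufferBound : PolyBounded (bufferBound Tr)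
  pb-bufferBound = pb-id ⊗ pb-total (λ P x → runGrowth P (counterBound Tr x)) (λ P → pb-runGrowth P pb-counterBound)

  pb-stepCost : PolyBounded (λ x → stepCost Tr (counterBound Tr x) (bufferBound Tr x))
  pb-stepCost = pb-total (λ P x → runCost P (counterBound Tr x) (bufferBound Tr x))
                         (λ P → pb-runCost P pb-counterBound pb-bufferBound)

  pb-programCost : PolyBounded (programCost Tr)
  pb-programCost = (pb-times 6 pb-id ⊕ pb-const 2) ⊕
    (((pb-times 3 pb-id ⊕ pb-const 2) ⊕ (pb-times 2 pb-id ⊕ pb-const 2)) ⊕
      (pb-id ⊗ (pb-const 2 ⊕ pb-stepCost) ⊕
        pb-suc (pb-suc (pb-times 3 (pb-id ⊗ pb-stepCost) ⊕ pb-const 2))))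

-- Appending a fragment to a machine

take-++ : ∀ {A : Set} {m n} (xs : Vec A m) (ys : Vec A n) → Vec.take m (xs Vec.++ ys) ≡ xs
take-++ []       ys = refl
take-++ (x ∷ xs) ys = cong (x ∷_) (take-++ xs ys)

drop-++ : ∀ {A : Set} {m n} (xs : Vec A m) (ys : Vec A n) → Vec.drop m (xs Vec.++ ys) ≡ ys
drop-++ []       ys = refl
drop-++ (x ∷ xs) ys = drop-++ xs ys

zipWith-++ : ∀ {A B C : Set} (f : A → B → C) {m n} (as : Vec A m) (as′ : Vec A n) bs bs′ →
             Vec.zipWith f (as Vec.++ as′) (bs Vec.++ bs′) ≡ Vec.zipWith f as bs Vec.++ Vec.zipWith f as′ bs′
zipWith-++ f []       as′ []       bs′ = refl
zipWith-++ f (a ∷ as) as′ (b ∷ bs) bs′ = cong (f a b ∷_) (zipWith-++ f as as′ bs bs′)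

idling : ∀ {n} → Vec Tape n → Vec Tape n
idling ts = Vec.zipWith act (Vec.map idle (Vec.map scan ts)) ts

idling-≈ : ∀ {n} (ts : Vec Tape n) i → lookup (idling ts) i ≈ lookup ts i
idling-≈ (t ∷ ts) zero    = act-idle t
idling-≈ (t ∷ ts) (suc i) = idling-≈ ts i

-- The machine M, followed by the fragment F on tape 0 and 11 fresh tapes.
module _ (M : Machine) (F : Fragment ⊤) where
  open Machine M

  -- The summand `⊤` is the halting state, reached when `F` exits. Where `M` would halt, one idle
  -- step leads to the entry of `F` instead.
  CtrlA : Set
  CtrlA = State ⊎ (⊤ ⊎ Ctrl F)

  afterM : Symbol → Vec Symbol 11 → Vec Symbol extraTapes → Maybe (State × Vec Action (suc extraTapes)) →
           Maybe (CtrlA × Vec Action (suc (11 + extraTapes)))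
  afterM s ss os nothing              = just (inj₂ (inj₂ (entry F)) , idle s ∷ Vec.map idle ss Vec.++ Vec.map idle os)
  afterM s ss os (just (q , a ∷ as)) = just (inj₁ q , a ∷ Vec.map idle ss Vec.++ as)

  afterF : Vec Symbol extraTapes → Vec Action 12 × (⊤ ⊎ Ctrl F) →
           Maybe (CtrlA × Vec Action (suc (11 + extraTapes)))
  afterF os (a ∷ as , c) = just (inj₂ c , a ∷ as Vec.++ Vec.map idle os)

  δA : CtrlA → Symbol → Vec Symbol 11 → Vec Symbol extraTapes →
       Maybe (CtrlA × Vec Action (suc (11 + extraTapes)))
  δA (inj₁ q)         s ss os = afterM s ss os (δ q (s ∷ os))
  δA (inj₂ (inj₁ _))  s ss os = nothing
  δA (inj₂ (inj₂ c))  s ss os = afterF os (instr F c (s ∷ ss))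

  appended : Machine
  appended = record
    { State      = CtrlA
    ; stateCount = stateCount + (1 + count F)
    ; finite     = ↔-trans (⊎-cong (Machine.finite M) (↔-trans (⊎-cong 1↔⊤ (Frag.finite F)) (↔-sym +↔⊎))) (↔-sym +↔⊎)
    ; extraTapes = 11 + extraTapes
    ; start      = inj₁ start
    ; δ          = λ { c (s ∷ ss) → δA c s (Vec.take 11 ss) (Vec.drop 11 ss) }
    }

  config : CtrlA → Tape → Vec Tape 11 → Vec Tape extraTapes → Config appended
  config c t rs os = c , t ∷ rs Vec.++ os

  step-appended : ∀ c t rs os → step appended (config c t rs os) ≡
    Maybe.map (λ { (c′ , as) → c′ , Vec.zipWith act as (t ∷ rs Vec.++ os) })
              (δA c (scan t) (Vec.map scan rs) (Vec.map scan os))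
  step-appended c t rs os
    rewrite Vec.map-++ scan rs os | take-++ (Vec.map scan rs) (Vec.map scan os)
          | drop-++ (Vec.map scan rs) (Vec.map scan os) = refl

  blank : Vec Tape 11 → Set
  blank rs = ∀ i → lookup rs i ≈ tape [] []

  step-M : ∀ {q q′ t t′ os os′} rs → step M (q , t ∷ os) ≡ just (q′ , t′ ∷ os′) →
           step appended (config (inj₁ q) t rs os) ≡ just (config (inj₁ q′) t′ (idling rs) os′)
  step-M {q} {t = t} {os = os} rs e = trans (step-appended (inj₁ q) t rs os)
    (go (δ q (scan t ∷ Vec.map scan os)) e)
    where
    go : ∀ d {q′ t′ os′} → Maybe.map (λ { (q′ , as) → q′ , Vec.zipWith act as (t ∷ os) }) d ≡ just (q′ , t′ ∷ os′) →
         Maybe.map (λ { (c′ , as) → c′ , Vec.zipWith act as (t ∷ rs Vec.++ os) })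
           (afterM (scan t) (Vec.map scan rs) (Vec.map scan os) d) ≡ just (config (inj₁ q′) t′ (idling rs) os′)
    go (just (q , a ∷ as)) refl =
      cong (λ ts → just (inj₁ q , act a t ∷ ts)) (zipWith-++ act (Vec.map idle (Vec.map scan rs)) as rs os)

  -- Stated with a continuation, which spares a lemma on concatenating runs. The fresh tapes idle
  -- meanwhile and are blank only up to `≈`, so their final contents are existential.
  run-M : ∀ {q t os k q′ t′ os′} rs → blank rs → Run M (q , t ∷ os) k (q′ , t′ ∷ os′) →
          ∃[ rs′ ] blank rs′ × ∀ {j c} → Run appended (config (inj₁ q′) t′ rs′ os′) j c →
                                         Run appended (config (inj₁ q) t rs os) (k + j) c
  run-M rs rs-blank stop = rs , rs-blank , id
  run-M rs rs-blank (next {c′ = q″ , t″ ∷ os″} e r) =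
    let rs′ , rs′-blank , continue = run-M (idling rs) (λ i → ≈-trans (idling-≈ rs i) (rs-blank i)) r
    in rs′ , rs′-blank , λ r′ → next (step-M rs e) (continue r′)

  step-switch : ∀ {q t os} rs → step M (q , t ∷ os) ≡ nothing →
    step appended (config (inj₁ q) t rs os) ≡
      just (config (inj₂ (inj₂ (entry F))) (act (idle (scan t)) t) (idling rs) (idling os))
  step-switch {q} {t} {os} rs e = trans (step-appended (inj₁ q) t rs os)
    (go (δ q (scan t ∷ Vec.map scan os)) e)
    where
    go : ∀ d → Maybe.map (λ { (q′ , as) → q′ , Vec.zipWith act as (t ∷ os) }) d ≡ nothing →
         Maybe.map (λ { (c′ , as) → c′ , Vec.zipWith act as (t ∷ rs Vec.++ os) })
           (afterM (scan t) (Vec.map scan rs) (Vec.map scan os) d) ≡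
         just (config (inj₂ (inj₂ (entry F))) (act (idle (scan t)) t) (idling rs) (idling os))
    go nothing _ = cong (λ ts → just (inj₂ (inj₂ (entry F)) , act (idle (scan t)) t ∷ ts))
      (zipWith-++ act (Vec.map idle (Vec.map scan rs)) (Vec.map idle (Vec.map scan os)) rs os)

  step-F : ∀ {c t rs as c′} os → instr F c (scan t ∷ Vec.map scan rs) ≡ (as , c′) →
           step appended (config (inj₂ (inj₂ c)) t rs os) ≡
             just (inj₂ c′ , Vec.zipWith act as (t ∷ rs) Vec.++ idling os)
  step-F {c} {t} {rs} {a ∷ as} {c′} os e = trans (step-appended (inj₂ (inj₂ c)) t rs os)
    (trans (cong (λ d → Maybe.map (λ { (c′ , as) → c′ , Vec.zipWith act as (t ∷ rs Vec.++ os) })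
                          (afterF (Vec.map scan os) d)) e)
      (cong (λ ts → just (inj₂ c′ , act a t ∷ ts))
        (zipWith-++ act as (Vec.map idle (Vec.map scan os)) rs os)))

  run-F : ∀ {c t rs k x t′ rs′} os → Exec (instr F) c (t ∷ rs) k x (t′ ∷ rs′) →
          ∃[ os′ ] Run appended (config (inj₂ (inj₂ c)) t rs os) k (config (inj₂ (inj₁ tt)) t′ rs′ os′)
  run-F {t = t} {rs} os e = go os e
    where
    go : ∀ {c ts k x ts′} os → Exec (instr F) c ts k x ts′ →
         ∃[ os′ ] Run appended (inj₂ (inj₂ c) , ts Vec.++ os) k (inj₂ (inj₁ tt) , ts′ Vec.++ os′)
    go {ts = t ∷ rs} os (exit e) = idling os , next (step-F os e) stop
    go {ts = t ∷ rs} os (more e r) = let os′ , r′ = go (idling os) r in os′ , next (step-F os e) r′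

bitPrefix-data : ∀ M v {J ss} → ss ∼ List.map just v ++ nothing ∷ J → bitPrefix M ss ≡ v
bitPrefix-data M []      {ss = []}           e = refl
bitPrefix-data M []      {ss = nothing ∷ ss} e = refl
bitPrefix-data M []      {ss = just _ ∷ ss}  e with () ← e 0
bitPrefix-data M (b ∷ v) {ss = []}           e with () ← e 0
bitPrefix-data M (b ∷ v) {ss = nothing ∷ ss} e with () ← e 0
bitPrefix-data M (b ∷ v) {ss = just b′ ∷ ss} e with refl ← e 0 =
  cong (b ∷_) (bitPrefix-data M v (λ i → e (suc i)))

data-bitPrefix : ∀ M ss → ∃[ J ] ss ∼ List.map just (bitPrefix M ss) ++ nothing ∷ J
data-bitPrefix M []             = [] , λ { zero → refl ; (suc _) → refl }
data-bitPrefix M (nothing ∷ ss) = ss , λ _ → refl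
data-bitPrefix M (just b ∷ ss)  = let J , e = data-bitPrefix M ss in J , ∼-cons refl e

length-bitPrefix : ∀ M ss → length (bitPrefix M ss) ≤ length ss
length-bitPrefix M []             = z≤n
length-bitPrefix M (nothing ∷ ss) = z≤n
length-bitPrefix M (just b ∷ ss)  = s≤s (length-bitPrefix M ss)

-- The running time of the appended fragment depends on the length of the output of `M`, which is
-- bounded through the listed cells. The constant 2 is attained by a move to the left from an empty
-- list.
length-act : ∀ a t → length (Tape.from (act a t)) ≤ 2 + length (Tape.from t)
length-act (s , left)  (tape ls [])      = ≤-refl
length-act (s , left)  (tape ls (_ ∷ r)) = n≤1+n _
length-act (s , stay)  (tape ls [])      = n≤1+n _
length-act (s , stay)  (tape ls (_ ∷ r)) = ≤-trans (n≤1+n _) (n≤1+n _)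
length-act (s , right) (tape ls [])      = z≤n
length-act (s , right) (tape ls (_ ∷ r)) = ≤-trans (n≤1+n _) (≤-trans (n≤1+n _) (n≤1+n _))

length-run : ∀ M {q t os k q′ t′ os′} → Run M (q , t ∷ os) k (q′ , t′ ∷ os′) →
             length (Tape.from t′) ≤ k * 2 + length (Tape.from t)
length-run M stop = ≤-refl
length-run M {q} {t} {os} {suc k} (next {c′ = q″ , t″ ∷ os″} e r) = ≤-trans (length-run M r)
  (≤-trans (+-monoʳ-≤ (k * 2) (go (Machine.δ M q (scan t ∷ Vec.map scan os)) e))
    (≤-reflexive (trans (sym (+-assoc (k * 2) 2 _)) (cong (_+ length (Tape.from t)) (+-comm (k * 2) 2)))))
  where
  go : ∀ d → Maybe.map (λ { (q′ , as) → q′ , Vec.zipWith act as (t ∷ os) }) d ≡ just (q″ , t″ ∷ os″) →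
       length (Tape.from t″) ≤ 2 + length (Tape.from t)
  go (just (q , a ∷ as)) refl = length-act a t

replicate-++ : ∀ m n {x : Tape} → Vec.replicate m x Vec.++ Vec.replicate n x ≡ Vec.replicate (m + n) x
replicate-++ zero    n = refl
replicate-++ (suc m) n = cong (_ ∷_) (replicate-++ m n)

replicate-blank : ∀ n i → lookup (Vec.replicate n (tape [] [])) i ≈ tape [] []
replicate-blank (suc n) zero    = ≈-refl
replicate-blank (suc n) (suc i) = replicate-blank n i

blank-registers : ∀ {t} i → tape [] [] ≈ conf t (initialMemory 0) (suc i)
blank-registers i = ≈-trans blank≈ (≈-reflexive (empty i))
  where
  blank≈ : tape [] [] ≈ home []
  blank≈ = (λ _ → refl) , λ i → sym (∼-blank i)
  empty : ∀ {t} i → home [] ≡ conf t (initialMemory 0) (suc i)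
  empty zero             = refl
  empty (suc zero)       = refl
  empty (suc (suc cN))  = refl
  empty (suc (suc cR))  = refl
  empty (suc (suc cS))  = refl
  empty (suc (suc cQ))  = refl
  empty (suc (suc cT))  = refl
  empty (suc (suc cB))  = refl
  empty (suc (suc cM))  = refl
  empty (suc (suc cW))  = refl
  empty (suc (suc cW′)) = refl

Transforms : Fragment ⊤ → ℕ → Word → Word → Set
Transforms F c v u = ∀ l J → ∃[ l′ ] ∃[ μ ]
  Spec F (conf (data-tape l v J) (initialMemory 0)) c tt (conf (data-tape l′ u J) μ)

appended-halts : ∀ M F {b c w v u} → Transforms F c v u → HaltsWithin M b w v →
                 HaltsWithin (appended M F) (b + (1 + c)) w u
appended-halts M F {b} {c} {w} {u = u} transforms (k , (q , t ∷ os) , k≤b , r , halted , refl) =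
  finished executed
  where
  v = bitPrefix M (Tape.from t)
  l = Tape.before t
  J = proj₁ (data-bitPrefix M (Tape.from t))
  simulated = run-M M F (Vec.replicate 11 (tape [] [])) (replicate-blank 11) r
  rs = proj₁ simulated
  models : act (idle (scan t)) t ∷ idling rs ⊨ conf (data-tape l v J) (initialMemory 0)
  models zero    = ≈-trans (act-idle t) ((λ _ → refl) , proj₂ (data-bitPrefix M (Tape.from t)))
  models (suc i) = ≈-trans (≈-trans (idling-≈ rs i) (proj₁ (proj₂ simulated) i)) (blank-registers i)
  l′ = proj₁ (transforms l J)
  μ  = proj₁ (proj₂ (transforms l J))
  executed = sound (proj₂ (proj₂ (transforms l J))) (act (idle (scan t)) t ∷ idling rs) models
  finished : (∃[ j ] ∃[ ts ] j ≤ c ×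
                Exec (instr F) (entry F) (act (idle (scan t)) t ∷ idling rs) j tt ts × ts ⊨ conf (data-tape l′ u J) μ) →
             HaltsWithin (appended M F) (b + (1 + c)) w u
  finished (j , t′ ∷ rs′ , j≤c , e , m) =
    k + (1 + j) , config M F (inj₂ (inj₁ tt)) t′ rs′ (proj₁ (run-F M F (idling os) e)) ,
    +-mono-≤ k≤b (s≤s j≤c) ,
    subst (λ ts → Run (appended M F) (inj₁ (Machine.start M) , tape [] (List.map just w) ∷ ts) (k + (1 + j))
                      (config M F (inj₂ (inj₁ tt)) t′ rs′ (proj₁ (run-F M F (idling os) e))))
      (replicate-++ 11 (Machine.extraTapes M))
      (proj₂ (proj₂ simulated) (next (step-switch M F rs halted) (proj₂ (run-F M F (idling os) e)))) ,
    refl , bitPrefix-data (appended M F) u (from≈ (m zero))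

halts-length : ∀ M {b w v} → HaltsWithin M b w v → length v ≤ b * 2 + length w
halts-length M {w = w} (k , (q , t ∷ os) , k≤b , r , _ , refl) =
  ≤-trans (length-bitPrefix M (Tape.from t)) (≤-trans (length-run M r)
    (+-mono-≤ (*-monoˡ-≤ 2 k≤b) (≤-reflexive (length-map just w))))

halts-weaken : ∀ M {b b′ w v} → b ≤ b′ → HaltsWithin M b w v → HaltsWithin M b′ w v
halts-weaken M b≤b′ (k , c , k≤b , rest) = k , c , ≤-trans k≤b b≤b′ , rest

polyTime-transduce : ∀ Tr f → PolyTime f → PolyTime (transduce Tr ∘ f)
polyTime-transduce Tr f (M , p , halts) = appended M (programF Tr) , poly bound , correct
  where
  P = poly (pb-programCost Tr)
  -- The transducer reads `f w`, and a word produced within time b from an input of length x has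
  -- length at most `b * 2 + x`. The 1 is the step that switches machines.
  bound : PolyBounded (λ x → evalPoly p x + (1 + evalPoly P (evalPoly p x * 2 + x)))
  bound = pb-poly p ⊕ pb-suc (pb-comp P (pb-times 2 (pb-poly p) ⊕ pb-id))
  correct : ∀ w → HaltsWithin (appended M (programF Tr)) (evalPoly (poly bound) (length w)) w (transduce Tr (f w))
  correct w = halts-weaken (appended M (programF Tr))
    (≤-trans
      (+-monoʳ-≤ (evalPoly p (length w)) (s≤s (≤-trans (bounds (pb-programCost Tr) (length (f w)))
        (evalPoly-mono P (halts-length M (halts w))))))
      (bounds bound (length w)))
    (appended-halts M (programF Tr) (λ l J → program-spec Tr l (f w) J) (halts w))

-- Evaluation of gates

-- Untyped gates, so that operands can be given by arithmetic before they are known to be in range.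
data RawGate (I : Set) : Set where
  inp       : I → RawGate I
  cst       : Bool → RawGate I
  neg       : I → RawGate I
  conj disj : I → I → RawGate I

RawGates : Set
RawGates = List (RawGate ℕ)

encodeRaw : RawGate ℕ → Word
encodeRaw (inp i)    = false ∷ false ∷ encodeℕ i
encodeRaw (cst b)    = false ∷ true ∷ b ∷ []
encodeRaw (neg i)    = true ∷ false ∷ encodeℕ i
encodeRaw (conj i j) = true ∷ true ∷ false ∷ encodeℕ i ++ encodeℕ j
encodeRaw (disj i j) = true ∷ true ∷ true ∷ encodeℕ i ++ encodeℕ j

encodeRaws : RawGates → Word
encodeRaws = concatMap (λ g → true ∷ encodeRaw g)

nth : ∀ {A : Set} → List A → ℕ → Maybe A
nth []       _       = nothing
nth (x ∷ _)  zero    = just x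
nth (_ ∷ xs) (suc i) = nth xs i

nth-++ˡ : ∀ {A : Set} (xs : List A) {ys i a} → nth xs i ≡ just a → nth (xs ++ ys) i ≡ just a
nth-++ˡ (x ∷ xs) {i = zero}  e = e
nth-++ˡ (x ∷ xs) {i = suc i} e = nth-++ˡ xs e

nth-++ʳ : ∀ {A : Set} (xs : List A) {ys i} → nth (xs ++ ys) (length xs + i) ≡ nth ys i
nth-++ʳ []       = refl
nth-++ʳ (x ∷ xs) = nth-++ʳ xs

nth-length : ∀ {A : Set} (xs : List A) {i a} → nth xs i ≡ just a → i < length xs
nth-length (x ∷ xs) {zero}  e = s≤s z≤n
nth-length (x ∷ xs) {suc i} e = s≤s (nth-length xs e)

nth-toList : ∀ {A : Set} {n} (xs : Vec A n) i → nth (toList xs) (toℕ i) ≡ just (lookup xs i)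
nth-toList (x ∷ xs) zero    = refl
nth-toList (x ∷ xs) (suc i) = nth-toList xs i

-- The value of a gate for inputs x and earlier gate values v (last gate first);
-- it exists only if all operands are in range.
data Computes (x v : List Bool) : RawGate ℕ → Bool → Set where
  inp  : ∀ {i b} → nth x i ≡ just b → Computes x v (inp i) b
  cst  : ∀ {b} → Computes x v (cst b) b
  neg  : ∀ {i b r} → nth v i ≡ just b → r ≡ not b → Computes x v (neg i) r
  conj : ∀ {i j a b r} → nth v i ≡ just a → nth v j ≡ just b → r ≡ a ∧ b → Computes x v (conj i j) r
  disj : ∀ {i j a b r} → nth v i ≡ just a → nth v j ≡ just b → r ≡ a ∨ b → Computes x v (disj i j) r

infixr 5 _∷_ _⊙_

data Runs (x : List Bool) : RawGates → List Bool → List Bool → Set where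
  []  : ∀ {v} → Runs x [] v v
  _∷_ : ∀ {g gs b v v′} → Computes x v g b → Runs x gs (b ∷ v) v′ → Runs x (g ∷ gs) v v′

_⊙_ : ∀ {x gs hs u v w} → Runs x gs u v → Runs x hs v w → Runs x (gs ++ hs) u w
[]      ⊙ s = s
(c ∷ r) ⊙ s = c ∷ (r ⊙ s)

data InRange (n s : ℕ) : RawGate ℕ → Set where
  inp  : ∀ {i} → i < n → InRange n s (inp i)
  cst  : ∀ {b} → InRange n s (cst b)
  neg  : ∀ {i} → i < s → InRange n s (neg i)
  conj : ∀ {i j} → i < s → j < s → InRange n s (conj i j)
  disj : ∀ {i j} → i < s → j < s → InRange n s (disj i j)

data AllInRange (n : ℕ) : ℕ → RawGates → Set where
  []  : ∀ {s} → AllInRange n s []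
  _∷_ : ∀ {s g gs} → InRange n s g → AllInRange n (suc s) gs → AllInRange n s (g ∷ gs)

computes-inRange : ∀ {x v g b} → Computes x v g b → InRange (length x) (length v) g
computes-inRange {x} {v} (inp e)      = inp (nth-length x e)
computes-inRange {x} {v} cst          = cst
computes-inRange {x} {v} (neg e _)    = neg (nth-length v e)
computes-inRange {x} {v} (conj e f _) = conj (nth-length v e) (nth-length v f)
computes-inRange {x} {v} (disj e f _) = disj (nth-length v e) (nth-length v f)

-- A successful evaluation on a single input already shows that every operand is in range. The typed
-- circuit is thus obtained from the semantic correctness proof, with no separate bookkeeping of
-- indices.
runs-inRange : ∀ {x gs v v′} → Runs x gs v v′ → AllInRange (length x) (length v) gs
runs-inRange []      = []
runs-inRange (c ∷ r) = computes-inRange c ∷ runs-inRange r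

typedGate : ∀ {n s g} → InRange n s g → Gate n s
typedGate (inp p)       = input (fromℕ< p)
typedGate (cst {b})     = const b
typedGate (neg p)       = not′ (fromℕ< p)
typedGate (conj p q)    = and′ (fromℕ< p) (fromℕ< q)
typedGate (disj p q)    = or′ (fromℕ< p) (fromℕ< q)

extend : ∀ {n s gs} → Gates n s → AllInRange n s gs → ∃[ s′ ] Gates n s′
extend Γ []      = _ , Γ
extend Γ (p ∷ r) = extend (Γ ▷ typedGate p) r

rawGate : ∀ {n s} → Gate n s → RawGate ℕ
rawGate (input i)  = inp (toℕ i)
rawGate (const b)  = cst b
rawGate (not′ i)   = neg (toℕ i)
rawGate (and′ i j) = conj (toℕ i) (toℕ j)
rawGate (or′ i j)  = disj (toℕ i) (toℕ j)

rawGates : ∀ {n s} → Gates n s → RawGates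
rawGates []       = []
rawGates (Γ ▷ g) = rawGates Γ ++ rawGate g ∷ []

rawGate-typed : ∀ {n s g} (p : InRange n s g) → rawGate (typedGate p) ≡ g
rawGate-typed (inp p)    = cong inp (toℕ-fromℕ< p)
rawGate-typed cst        = refl
rawGate-typed (neg p)    = cong neg (toℕ-fromℕ< p)
rawGate-typed (conj p q) = cong₂ conj (toℕ-fromℕ< p) (toℕ-fromℕ< q)
rawGate-typed (disj p q) = cong₂ disj (toℕ-fromℕ< p) (toℕ-fromℕ< q)

rawGates-extend : ∀ {n s gs} (Γ : Gates n s) (r : AllInRange n s gs) →
                  rawGates (proj₂ (extend Γ r)) ≡ rawGates Γ ++ gs
rawGates-extend Γ []                = sym (++-identityʳ _)
rawGates-extend Γ (_∷_ {gs = gs} p r) = trans (rawGates-extend (Γ ▷ typedGate p) r)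
  (trans (++-assoc (rawGates Γ) _ gs) (cong (λ g → rawGates Γ ++ g ∷ gs) (rawGate-typed p)))

encodeRaw-raw : ∀ {n s} (g : Gate n s) → encodeRaw (rawGate g) ≡ encodeGate g
encodeRaw-raw (input i)  = refl
encodeRaw-raw (const b)  = refl
encodeRaw-raw (not′ i)   = refl
encodeRaw-raw (and′ i j) = refl
encodeRaw-raw (or′ i j)  = refl

encodeRaws-++ : ∀ gs hs → encodeRaws (gs ++ hs) ≡ encodeRaws gs ++ encodeRaws hs
encodeRaws-++ = concatMap-++ _

encodeRaws-raw : ∀ {n s} (Γ : Gates n s) → encodeRaws (rawGates Γ) ≡ encodeGates Γ
encodeRaws-raw []      = refl
encodeRaws-raw (Γ ▷ g) = trans (encodeRaws-++ (rawGates Γ) _)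
  (cong₂ _++_ (encodeRaws-raw Γ) (cong (true ∷_) (trans (++-identityʳ _) (encodeRaw-raw g))))

runs-raw : ∀ {n s} (Γ : Gates n s) x → Runs (toList x) (rawGates Γ) [] (toList (evalGates Γ x))
runs-raw []       x = []
runs-raw (Γ ▷ g) x = runs-raw Γ x ⊙ (value-of g ∷ [])
  where
  v = evalGates Γ x
  value-of : ∀ g → Computes (toList x) (toList v) (rawGate g) (evalGate g x v)
  value-of (input i)  = inp (nth-toList x i)
  value-of (const b)  = cst
  value-of (not′ i)   = neg (nth-toList v i) refl
  value-of (and′ i j) = conj (nth-toList v i) (nth-toList v j) refl
  value-of (or′ i j)  = disj (nth-toList v i) (nth-toList v j) refl

just-unique : ∀ {A : Set} {m : Maybe A} {a b} → m ≡ just a → m ≡ just b → a ≡ b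
just-unique refl refl = refl

computes-unique : ∀ {x v g b b′} → Computes x v g b → Computes x v g b′ → b ≡ b′
computes-unique (inp e)         (inp e′)          = just-unique e e′
computes-unique cst             cst               = refl
computes-unique (neg e refl)    (neg e′ refl)     = cong not (just-unique e e′)
computes-unique (conj e f refl) (conj e′ f′ refl) = cong₂ _∧_ (just-unique e e′) (just-unique f f′)
computes-unique (disj e f refl) (disj e′ f′ refl) = cong₂ _∨_ (just-unique e e′) (just-unique f f′)

runs-unique : ∀ {x gs v w w′} → Runs x gs v w → Runs x gs v w′ → w ≡ w′
runs-unique []      []        = refl
runs-unique (c ∷ r) (c′ ∷ r′) with refl ← computes-unique c c′ = runs-unique r r′

computes-inputs : ∀ {x x′ v g b} → (∀ {i b} → nth x i ≡ just b → nth x′ i ≡ just b) →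
                  Computes x v g b → Computes x′ v g b
computes-inputs h (inp e)      = inp (h e)
computes-inputs h cst          = cst
computes-inputs h (neg e r)    = neg e r
computes-inputs h (conj e f r) = conj e f r
computes-inputs h (disj e f r) = disj e f r

computes-below : ∀ {x v w g b} → Computes x v g b → Computes x (v ++ w) g b
computes-below {v = v} (inp e)      = inp e
computes-below {v = v} cst          = cst
computes-below {v = v} (neg e r)    = neg (nth-++ˡ v e) r
computes-below {v = v} (conj e f r) = conj (nth-++ˡ v e) (nth-++ˡ v f) r
computes-below {v = v} (disj e f r) = disj (nth-++ˡ v e) (nth-++ˡ v f) r

-- A backward index that is in range never reaches below the block it belongs to, so a circuit may
-- be placed on top of any other gates.
runs-below : ∀ {x gs v v′} w → Runs x gs v v′ → Runs x gs (v ++ w) (v′ ++ w)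
runs-below w []      = []
runs-below w (c ∷ r) = computes-below c ∷ runs-below w r

runs-left : ∀ {x gs v v′} y → Runs x gs v v′ → Runs (x ++ y) gs v v′
runs-left y []      = []
runs-left {x} y (c ∷ r) = computes-inputs (nth-++ˡ x) c ∷ runs-left y r

shiftInput : ℕ → RawGate ℕ → RawGate ℕ
shiftInput n (inp i)    = inp (n + i)
shiftInput n (cst b)    = cst b
shiftInput n (neg i)    = neg i
shiftInput n (conj i j) = conj i j
shiftInput n (disj i j) = disj i j

runs-right : ∀ {y gs v v′} x {n} → length x ≡ n → Runs y gs v v′ → Runs (x ++ y) (List.map (shiftInput n) gs) v v′
runs-right x refl [] = []
runs-right x {n} refl (inp e ∷ r)      = inp (trans (nth-++ʳ x) e) ∷ runs-right x refl r
runs-right x refl (cst ∷ r)          = cst ∷ runs-right x refl r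
runs-right x refl (neg e p ∷ r)      = neg e p ∷ runs-right x refl r
runs-right x refl (conj e f p ∷ r)   = conj e f p ∷ runs-right x refl r
runs-right x refl (disj e f p ∷ r)   = disj e f p ∷ runs-right x refl r

consts : ℕ → Bool → RawGates
consts k b = replicate k (cst b)

runs-consts : ∀ {x} k {b v} → Runs x (consts k b) v (replicate k b ++ v)
runs-consts {x} k {b} {v} = subst (Runs x (consts k b) v) (replicate-shift k) (go k v)
  where
  push : ℕ → List Bool → List Bool
  push zero    v = v
  push (suc k) v = push k (b ∷ v)
  go : ∀ k v → Runs x (consts k b) v (push k v)
  go zero    v = []
  go (suc k) v = cst ∷ go k (b ∷ v)
  shift : ∀ k v → push k (b ∷ v) ≡ b ∷ push k v
  shift zero    v = refl
  shift (suc k) v = shift k (b ∷ v)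
  replicate-shift : ∀ k {v} → push k v ≡ replicate k b ++ v
  replicate-shift zero        = refl
  replicate-shift (suc k) {v} = trans (shift k v) (cong (b ∷_) (replicate-shift k))

-- Comparison and tally gates

-- g and l say whether the first number is already known to be greater, or less.
compareStep : Bool × Bool → Bool → Bool → Bool × Bool
compareStep (g , l) a b = (not (l ∨ not a) ∧ not b) ∨ g , (not (g ∨ not b) ∧ not a) ∨ l

compareBits : ∀ {n} → Bool × Bool → Vec Bool n → Vec Bool n → Bool × Bool
compareBits gl []       []       = gl
compareBits gl (a ∷ as) (b ∷ bs) = compareBits (compareStep gl a b) as bs

data Compared (a b : ℕ) : Bool × Bool → Set where
  greater : b < a → Compared a b (true , false)
  equal   : a ≡ b → Compared a b (false , false)
  less    : a < b → Compared a b (false , true)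

compareBits-greater : ∀ {n} (as bs : Vec Bool n) → compareBits (true , false) as bs ≡ (true , false)
compareBits-greater []           []           = refl
compareBits-greater (true  ∷ as) (true  ∷ bs) = compareBits-greater as bs
compareBits-greater (true  ∷ as) (false ∷ bs) = compareBits-greater as bs
compareBits-greater (false ∷ as) (true  ∷ bs) = compareBits-greater as bs
compareBits-greater (false ∷ as) (false ∷ bs) = compareBits-greater as bs

compareBits-less : ∀ {n} (as bs : Vec Bool n) → compareBits (false , true) as bs ≡ (false , true)
compareBits-less []           []           = refl
compareBits-less (true  ∷ as) (true  ∷ bs) = compareBits-less as bs
compareBits-less (true  ∷ as) (false ∷ bs) = compareBits-less as bs
compareBits-less (false ∷ as) (true  ∷ bs) = compareBits-less as bs
compareBits-less (false ∷ as) (false ∷ bs) = compareBits-less as bs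

value<2^ : ∀ {n} (as : Vec Bool n) → value as < 2 ^ n
value<2^ [] = s≤s z≤n
value<2^ {suc n} (true ∷ as) = subst (2 ^ n + value as <_) (cong (2 ^ n +_) (sym (+-identityʳ (2 ^ n))))
  (+-monoʳ-< (2 ^ n) (value<2^ as))
value<2^ {suc n} (false ∷ as) = <-≤-trans (value<2^ as) (m≤m+n (2 ^ n) _)

compared-+ : ∀ k {a b gl} → Compared a b gl → Compared (k + a) (k + b) gl
compared-+ k (greater p) = greater (+-monoʳ-< k p)
compared-+ k (equal p)   = equal (cong (k +_) p)
compared-+ k (less p)    = less (+-monoʳ-< k p)

-- The first differing bit decides: all later bits together are worth less than its weight `2 ^ n`.
compareBits-correct : ∀ {n} (as bs : Vec Bool n) →
                      Compared (value as) (value bs) (compareBits (false , false) as bs)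
compareBits-correct [] [] = equal refl
compareBits-correct {suc n} (true  ∷ as) (true  ∷ bs) = compared-+ (2 ^ n) (compareBits-correct as bs)
compareBits-correct {suc n} (true  ∷ as) (false ∷ bs) =
  subst (Compared _ _) (sym (compareBits-greater as bs)) (greater (<-≤-trans (value<2^ bs) (m≤m+n _ _)))
compareBits-correct {suc n} (false ∷ as) (true  ∷ bs) =
  subst (Compared _ _) (sym (compareBits-less as bs)) (less (<-≤-trans (value<2^ as) (m≤m+n _ _)))
compareBits-correct {suc n} (false ∷ as) (false ∷ bs) = compareBits-correct as bs

-- The comparison gates for an output bit, where the value g of compareStep is at
-- index 4 and l at index 0, before and after these gates.  The operands p and q
-- refer to the output bits of the two copies of the circuit.
compareGates : ∀ {I : Set} → (ℕ → I) → I → I → List (RawGate I)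
compareGates # p q =
  neg p ∷ neg q ∷ disj (# 2) (# 1) ∷ neg (# 0) ∷ conj (# 0) (# 2) ∷ disj (# 0) (# 9) ∷
  disj (# 10) (# 4) ∷ neg (# 0) ∷ conj (# 0) (# 7) ∷ disj (# 0) (# 9) ∷ []

record Flags (g l : Bool) (k : ℕ) (u : List Bool) : Set where
  constructor flags
  field
    {f₁ f₂ f₃} : Bool
    {rest}     : List Bool
    shape      : u ≡ l ∷ f₁ ∷ f₂ ∷ f₃ ∷ g ∷ rest
    size       : length u ≡ k

-- The formulas of `compareStep` have exactly the shape that the ten gates compute, whence `refl`
-- throughout. The operand `q` is looked up after the first gate, with one more value `z` in front.
compare-runs : ∀ {x g l k u v a b p q} → Flags g l k u →
               nth (u ++ v) p ≡ just a → (∀ z → nth (z ∷ u ++ v) q ≡ just b) →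
               ∃[ u′ ] Flags (proj₁ (compareStep (g , l) a b)) (proj₂ (compareStep (g , l) a b)) (10 + k) u′ ×
               Runs x (compareGates id p q) (u ++ v) (u′ ++ v)
compare-runs (flags refl size) p q = _ , flags refl (cong (10 +_) size) ,
  (neg p refl ∷ neg (q _) refl ∷ disj refl refl refl ∷ neg refl refl ∷ conj refl refl refl ∷ disj refl refl refl ∷
   disj refl refl refl ∷ neg refl refl ∷ conj refl refl refl ∷ disj refl refl refl ∷ [])

-- The tally keeps a number c in unary: the cell i, which says whether i ≤ c,
-- is at index 7 i + 1, for i ≤ W + 1.
Tally : ℕ → ℕ → List Bool → Set
Tally W c v = ∀ i → i < 2 + W → nth v (i * 7 + 1) ≡ just (i ≤ᵇ c)

bitℕ : Bool → ℕ
bitℕ true  = 1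
bitℕ false = 0

-- A circuit contributes 1 + sgn, so that the tally never decreases.
advance : Bool × Bool → ℕ → ℕ
advance (g , l) c = bitℕ g + (bitℕ (not l) + c)

-- The gates for a new cell i.  The operands p, q and r refer to the old cells i - 2, i - 1 and i.
tallyGates : ∀ {I : Set} → (ℕ → I) → I → I → I → List (RawGate I)
tallyGates # p q r =
  neg (# 0) ∷ conj (# 5) p ∷ disj (# 6) (# 6) ∷ conj (# 2) q ∷ disj (# 0) (# 2) ∷ disj (# 0) r ∷
  disj (# 6) (# 6) ∷ []

data Exclusive : Bool × Bool → Set where
  exclusive-g : Exclusive (true , false)
  exclusive-0 : Exclusive (false , false)
  exclusive-l : Exclusive (false , true)

≤ᵇ-suc : ∀ i c → (suc i ≤ᵇ c) ≡ (suc i ≤ᵇ c) ∧ (i ≤ᵇ c)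
≤ᵇ-suc zero    zero    = refl
≤ᵇ-suc zero    (suc c) = refl
≤ᵇ-suc (suc i) zero    = refl
≤ᵇ-suc (suc i) (suc c) = ≤ᵇ-suc′ i c
  where
  ≤ᵇ-suc′ : ∀ i c → (suc i <ᵇ suc c) ≡ (suc i <ᵇ suc c) ∧ (i <ᵇ suc c)
  ≤ᵇ-suc′ zero    zero    = refl
  ≤ᵇ-suc′ zero    (suc c) = refl
  ≤ᵇ-suc′ (suc i) zero    = refl
  ≤ᵇ-suc′ (suc i) (suc c) = ≤ᵇ-suc′ i c

suc≤ᵇsuc : ∀ i c → (suc i ≤ᵇ suc c) ≡ (i ≤ᵇ c)
suc≤ᵇsuc zero    c = refl
suc≤ᵇsuc (suc i) c = refl

-- As the count rises by 2, 1 or 0, the answer is the old cell i, i + 1 or i + 2. The disjunction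
-- may also contain higher old cells, since these imply the lower ones.
new-cell : ∀ {g l} i c → Exclusive (g , l) →
           (2 + i ≤ᵇ advance (g , l) c) ≡ ((not l ∧ (1 + i ≤ᵇ c)) ∨ (g ∧ (i ≤ᵇ c))) ∨ (2 + i ≤ᵇ c)
new-cell i c exclusive-g
  rewrite suc≤ᵇsuc (1 + i) (1 + c) | suc≤ᵇsuc i c | ≤ᵇ-suc (1 + i) c | ≤ᵇ-suc i c
  with i ≤ᵇ c | 1 + i ≤ᵇ c | 2 + i ≤ᵇ c
... | true  | true  | true  = refl
... | true  | true  | false = refl
... | true  | false | true  = refl
... | true  | false | false = refl
... | false | true  | true  = refl
... | false | true  | false = refl
... | false | false | true  = refl
... | false | false | false = refl
new-cell i c exclusive-0
  rewrite suc≤ᵇsuc (1 + i) c | ≤ᵇ-suc (1 + i) c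
  with 1 + i ≤ᵇ c | 2 + i ≤ᵇ c
... | true  | true  = refl
... | true  | false = refl
... | false | true  = refl
... | false | false = refl
new-cell i c exclusive-l = refl

-- The cells are renewed from the highest down. Each group puts seven gates in front, while the old
-- cells wanted next lie seven places nearer; and each group ends with g and l copied back to
-- indices 4 and 0. So all groups have the same text. The offsets 0, 9 and 18 include the 1, 3 and 5
-- gates of the group that precede the respective use.
tallyGroup : ℕ → ℕ → ℕ → RawGates
tallyGroup W s n = tallyGates id (W * 7 + (s * 2 + (n * 10 + 0))) (W * 7 + (s * 2 + (n * 10 + 9)))
                                 (W * 7 + (s * 2 + (n * 10 + 18)))

NewCells : ℕ → ℕ → List Bool → Set
NewCells k c u = ∀ i → i < k → nth u (i * 7 + 1) ≡ just (2 + i ≤ᵇ c)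

<-split : ∀ {i k} {P : ℕ → Set} → i < suc k → (∀ {i} → i < k → P i) → P k → P i
<-split {zero}  {zero}  p         h q = q
<-split {zero}  {suc k} p         h q = h (s≤s z≤n)
<-split {suc i} {suc k} {P} (s≤s p) h q = <-split {i} {k} {P ∘ suc} p (λ r → h (s≤s r)) q
<-split {suc i} {zero}  (s≤s ())  h q

nth-index : ∀ {A : Set} {xs : List A} {i j a} → i ≡ j → nth xs j ≡ just a → nth xs i ≡ just a
nth-index refl e = e

-- `d` groups are done and `k` are left. `q` is all that lies in front of the old tally `v`: two
-- copies of s gates, five initial flags, ten gates for each of n outputs, and the d groups.
tally-runs : ∀ {x g l c v n s} W d k → d + k ≡ W → Exclusive (g , l) → Tally W c v →
  ∀ q → Flags g l (s + (s + (n * 10 + 5)) + d * 7) q →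
  ∃[ u ] Runs x (copies k (tallyGroup W s n)) (q ++ v) (u ++ q ++ v) ×
         length u ≡ k * 7 × NewCells k (advance (g , l) c) u
tally-runs W d zero e ex t q fl = [] , [] , refl , λ i ()
tally-runs {x} {g} {l} {c} {v} {n} {s} W d (suc k) refl ex t q (flags {f₁} {f₂} {f₃} {rest} refl size) =
  u ++ r , subst (Runs x (copies (suc k) (tallyGroup W s n)) (q ++ v)) (sym (++-assoc u r (q ++ v)))
    (group ⊙ proj₁ (proj₂ tailRun)) ,
  trans (length-++ u) (trans (cong (_+ 7) (proj₁ (proj₂ (proj₂ tailRun)))) (+-comm (k * 7) 7)) ,
  cells
  where
  h₂ = g ∧ (k ≤ᵇ c)
  h₄ = not l ∧ (1 + k ≤ᵇ c)
  new = 2 + k ≤ᵇ advance (g , l) c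
  r : List Bool
  r = l ∷ new ∷ (h₄ ∨ h₂) ∷ h₄ ∷ g ∷ h₂ ∷ not l ∷ []
  old : ∀ i j m → i < 2 + W → j ≡ m + (length q + (i * 7 + 1)) → ∀ {ps} → length ps ≡ m →
        nth (ps ++ q ++ v) j ≡ just (i ≤ᵇ c)
  old i j m i< e {ps} refl = nth-index {xs = ps ++ q ++ v} e
    (trans (nth-++ʳ ps {q ++ v} {length q + (i * 7 + 1)}) (trans (nth-++ʳ q {v} {i * 7 + 1}) (t i i<)))
  index : ∀ m e j → m + (s + (s + (n * 10 + 5)) + d * 7 + (j * 7 + 1)) ≡ e → m + (length q + (j * 7 + 1)) ≡ e
  index m e j p = trans (cong (λ z → m + (z + (j * 7 + 1))) size) p
  e₂ : ∀ d k s n → 1 + (s + (s + (n * 10 + 5)) + d * 7 + (k * 7 + 1)) ≡ (d + suc k) * 7 + (s * 2 + (n * 10 + 0))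
  e₂ = solve-∀
  e₁ : ∀ d k s n → 3 + (s + (s + (n * 10 + 5)) + d * 7 + ((1 + k) * 7 + 1)) ≡ (d + suc k) * 7 + (s * 2 + (n * 10 + 9))
  e₁ = solve-∀
  e₀ : ∀ d k s n → 5 + (s + (s + (n * 10 + 5)) + d * 7 + ((2 + k) * 7 + 1)) ≡ (d + suc k) * 7 + (s * 2 + (n * 10 + 18))
  e₀ = solve-∀
  k<W : k < d + suc k
  k<W = m≤n+m (suc k) d
  group : Runs x (tallyGroup W s n) (q ++ v) (r ++ q ++ v)
  group =
    neg refl refl ∷
    conj refl
      (old k _ 1 (≤-trans k<W (≤-trans (n≤1+n _) (n≤1+n _))) (sym (index 1 _ k (e₂ d k s n))) {_ ∷ []} refl)
      refl ∷
    disj refl refl (sym (∨-idem g)) ∷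
    conj refl
      (old (1 + k) _ 3 (≤-trans (s≤s k<W) (n≤1+n _)) (sym (index 3 _ (1 + k) (e₁ d k s n))) {_ ∷ _ ∷ _ ∷ []} refl)
      refl ∷
    disj refl refl refl ∷
    disj refl (old (2 + k) _ 5 (s≤s (s≤s k<W)) (sym (index 5 _ (2 + k) (e₀ d k s n))) {_ ∷ _ ∷ _ ∷ _ ∷ _ ∷ []} refl)
      (new-cell k c ex) ∷
    disj refl refl (sym (∨-idem l)) ∷ []
  flags′ : Flags g l (s + (s + (n * 10 + 5)) + suc d * 7) (r ++ q)
  flags′ = flags refl (trans (cong (7 +_) size) (reassoc (s + (s + (n * 10 + 5))) (d * 7)))
    where
    reassoc : ∀ a b → 7 + (a + b) ≡ a + (7 + b)
    reassoc = solve-∀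
  tailRun = tally-runs {x} {g} {l} {c} {v} {n} {s} W (suc d) k (sym (+-suc d k)) ex t (r ++ q) flags′
  u = proj₁ tailRun
  cells : NewCells (suc k) (advance (g , l) c) (u ++ r)
  cells i i< = <-split {P = λ i → nth (u ++ r) (i * 7 + 1) ≡ just (2 + i ≤ᵇ advance (g , l) c)} i<
    (λ {i} p → nth-++ˡ u (proj₂ (proj₂ (proj₂ tailRun)) i p))
    (trans (cong (λ z → nth (u ++ r) (z + 1)) (sym (proj₁ (proj₂ (proj₂ tailRun))))) (nth-++ʳ u))

open import Data.Integer.Base as ℤ using (ℤ; +_; 0ℤ; 1ℤ; -1ℤ; +<+)
import Data.Integer.Properties as ℤ
import Data.Integer.Tactic.RingSolver as ℤ-Solver

-- In front of the copy for y there are `j * 10 + 5` gates, to which the copy for x adds s more. The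
-- second operand has 6 instead of 5 because its gate comes one later.
compareGroup : ℕ → ℕ → ℕ → RawGates
compareGroup s j o = compareGates id (o * 1 + (s * 1 + (j * 10 + 5))) (o * 1 + (j * 10 + 6))

compareOutputs : ∀ {s k} → ℕ → Vec (Fin s) k → RawGates
compareOutputs     j []       = []
compareOutputs {s} j (o ∷ os) = compareGroup s j (toℕ o) ++ compareOutputs (suc j) os

compareOutputs-runs : ∀ {x g l s n v} {k} j u (os : Vec (Fin s) k) (as bs : Vec Bool s) → k + j ≡ n →
  Flags g l (j * 10 + 5) u →
  let gl = compareBits (g , l) (Vec.map (lookup as) os) (Vec.map (lookup bs) os) in
  ∃[ u′ ] Flags (proj₁ gl) (proj₂ gl) (n * 10 + 5) u′ ×
          Runs x (compareOutputs j os) (u ++ toList bs ++ toList as ++ v) (u′ ++ toList bs ++ toList as ++ v)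
compareOutputs-runs j u []       as bs refl fl = u , fl , []
compareOutputs-runs {x} {g} {l} {s} {n} {v} {suc k} j u (o ∷ os) as bs e fl =
  proj₁ tailRun , proj₁ (proj₂ tailRun) , proj₂ (proj₂ group) ⊙ proj₂ (proj₂ tailRun)
  where
  a-index : ∀ u′ b′ o j s → u′ ≡ j * 10 + 5 → b′ ≡ s → o * 1 + (s * 1 + (j * 10 + 5)) ≡ u′ + (b′ + o)
  a-index _ _ o j s refl refl = lemma o j s
    where
    lemma : ∀ o j s → o * 1 + (s * 1 + (j * 10 + 5)) ≡ (j * 10 + 5) + (s + o)
    lemma = solve-∀
  b-index : ∀ u′ o j → u′ ≡ j * 10 + 5 → o * 1 + (j * 10 + 6) ≡ suc (u′ + o)
  b-index _ o j refl = lemma o j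
    where
    lemma : ∀ o j → o * 1 + (j * 10 + 6) ≡ suc ((j * 10 + 5) + o)
    lemma = solve-∀
  at-a : nth (u ++ toList bs ++ toList as ++ v) (toℕ o * 1 + (s * 1 + (j * 10 + 5))) ≡ just (lookup as o)
  at-a = nth-index {xs = u ++ toList bs ++ toList as ++ v}
    (a-index (length u) (length (toList bs)) (toℕ o) j s (Flags.size fl) (length-toList bs))
    (trans (nth-++ʳ u) (trans (nth-++ʳ (toList bs)) (nth-++ˡ (toList as) (nth-toList as o))))
  at-b : ∀ z → nth (z ∷ u ++ toList bs ++ toList as ++ v) (toℕ o * 1 + (j * 10 + 6)) ≡ just (lookup bs o)
  at-b z = nth-index {xs = z ∷ u ++ toList bs ++ toList as ++ v} (b-index (length u) (toℕ o) j (Flags.size fl))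
    (trans (nth-++ʳ u) (nth-++ˡ (toList bs) (nth-toList bs o)))
  group = compare-runs {x} {v = toList bs ++ toList as ++ v} fl at-a at-b
  tailRun = compareOutputs-runs {x} {v = v} (suc j) (proj₁ group) os as bs (trans (+-suc k j) e) (proj₁ (proj₂ group))

-- Signs, tallies and margins

compared-exclusive : ∀ {a b gl} → Compared a b gl → Exclusive gl
compared-exclusive (greater _) = exclusive-g
compared-exclusive (equal _)   = exclusive-0
compared-exclusive (less _)    = exclusive-l

1≤advance : ∀ gl {c} → 1 ≤ c → 1 ≤ advance gl c
1≤advance (g , l) p = ≤-trans p (≤-trans (m≤n+m _ (bitℕ (not l))) (m≤n+m _ (bitℕ g)))

signOf : Bool × Bool → ℤ
signOf (true  , _)     = 1ℤ
signOf (false , true)  = -1ℤ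
signOf (false , false) = 0ℤ

sgn-positive : ∀ {a b} → b < a → sgn (+ a ℤ.- + b) ≡ 1ℤ
sgn-positive {a} {b} b<a = trans (cong sgn (trans (ℤ.m-n≡m⊖n a b) (ℤ.⊖-≥ (<⇒≤ b<a)))) (positive (m<n⇒0<n∸m b<a))
  where
  positive : ∀ {k} → 0 < k → sgn (+ k) ≡ 1ℤ
  positive (s≤s _) = refl

sgn-negative : ∀ {a b} → a < b → sgn (+ a ℤ.- + b) ≡ -1ℤ
sgn-negative {a} {b} a<b = trans (cong sgn (trans (ℤ.m-n≡m⊖n a b) (ℤ.⊖-≤ (<⇒≤ a<b)))) (negative (m<n⇒0<n∸m a<b))
  where
  negative : ∀ {k} → 0 < k → sgn (ℤ.- + k) ≡ -1ℤ
  negative (s≤s _) = refl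

sgn-compared : ∀ {a b gl} → Compared a b gl → sgn (+ a ℤ.- + b) ≡ signOf gl
sgn-compared (greater p)       = sgn-positive p
sgn-compared {a} (equal refl)  = cong sgn (ℤ.+-inverseʳ (+ a))
sgn-compared (less p)          = sgn-negative p

sgn-antisym : ∀ {a b gl} → Compared a b gl → sgn (+ b ℤ.- + a) ≡ ℤ.- sgn (+ a ℤ.- + b)
sgn-antisym {a} {b} (greater p) = trans (sgn-negative p) (cong ℤ.-_ (sym (sgn-positive p)))
sgn-antisym {a} (equal refl)    =
  trans (cong sgn (ℤ.+-inverseʳ (+ a))) (cong (λ z → ℤ.- sgn z) (sym (ℤ.+-inverseʳ (+ a))))
sgn-antisym {a} {b} (less p)    = trans (sgn-positive p) (cong ℤ.-_ (sym (sgn-negative p)))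

advance-sign : ∀ {gl} c → Exclusive gl → + advance gl c ≡ + c ℤ.+ (signOf gl ℤ.+ 1ℤ)
advance-sign c exclusive-g = cong +_ (+-comm 2 c)
advance-sign c exclusive-0 = cong +_ (+-comm 1 c)
advance-sign c exclusive-l = cong +_ (sym (+-identityʳ c))

module _ {n : ℕ} where

  compareAt : Circuit n n → Vec Bool n → Vec Bool n → Bool × Bool
  compareAt C x y = compareBits (false , false) (eval C x) (eval C y)

  compareAt-correct : ∀ C x y → Compared (value (eval C x)) (value (eval C y)) (compareAt C x y)
  compareAt-correct C x y = compareBits-correct (eval C x) (eval C y)

  tallyAll : List (Circuit n n) → Vec Bool n → Vec Bool n → ℕ → ℕ
  tallyAll []       x y c = c
  tallyAll (C ∷ Cs) x y c = tallyAll Cs x y (advance (compareAt C x y) c)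

  margin-antisym : ∀ Cs x y → margin Cs y x ≡ ℤ.- margin Cs x y
  margin-antisym []       x y = refl
  margin-antisym (C ∷ Cs) x y = trans (cong₂ ℤ._+_ (sgn-antisym (compareAt-correct C x y)) (margin-antisym Cs x y))
    (sym (ℤ.neg-distrib-+ (sgn (+ value (eval C x) ℤ.- + value (eval C y))) (margin Cs x y)))

  tallyAll-margin : ∀ Cs x y c → + tallyAll Cs x y c ≡ + c ℤ.+ (margin Cs x y ℤ.+ + length Cs)
  tallyAll-margin []       x y c = cong +_ (sym (+-identityʳ c))
  tallyAll-margin (C ∷ Cs) x y c = trans (tallyAll-margin Cs x y (advance (compareAt C x y) c))
    (trans (cong (ℤ._+ (margin Cs x y ℤ.+ + length Cs))
             (trans (advance-sign c (compared-exclusive (compareAt-correct C x y)))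
               (cong (λ z → + c ℤ.+ (z ℤ.+ 1ℤ)) (sym (sgn-compared (compareAt-correct C x y))))))
      (rearrange (+ c) (sgn (+ value (eval C x) ℤ.- + value (eval C y))) (margin Cs x y) (+ length Cs)))
    where
    rearrange : ∀ c s m k → (c ℤ.+ (s ℤ.+ 1ℤ)) ℤ.+ (m ℤ.+ k) ≡ c ℤ.+ ((s ℤ.+ m) ℤ.+ (1ℤ ℤ.+ k))
    rearrange = ℤ-Solver.solve-∀

  tallyAll-margin₁ : ∀ Cs x y → + tallyAll Cs x y 1 ≡ + suc (length Cs) ℤ.+ margin Cs x y
  tallyAll-margin₁ Cs x y = trans (tallyAll-margin Cs x y 1) (rearrange (margin Cs x y) (+ length Cs))
    where
    rearrange : ∀ m k → 1ℤ ℤ.+ (m ℤ.+ k) ≡ (1ℤ ℤ.+ k) ℤ.+ m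
    rearrange = ℤ-Solver.solve-∀

  tally⇔margin : ∀ Cs x y → (2 + length Cs ≤ᵇ tallyAll Cs x y 1) ≡ true ⇔ margin Cs x y ℤ.> 0ℤ
  tally⇔margin Cs x y = mk⇔ to from
    where
    k = suc (length Cs)
    to : (suc k ≤ᵇ tallyAll Cs x y 1) ≡ true → margin Cs x y ℤ.> 0ℤ
    to e = ℤ.≰⇒> λ m≤0 → ℤ.<⇒≱
      (subst (+ k ℤ.<_) (tallyAll-margin₁ Cs x y) (+<+ (≤ᵇ⇒≤ (suc k) _ (Equivalence.from T-≡ e))))
      (subst (+ k ℤ.+ margin Cs x y ℤ.≤_) (ℤ.+-identityʳ (+ k)) (ℤ.+-monoʳ-≤ (+ k) m≤0))
    from : margin Cs x y ℤ.> 0ℤ → (suc k ≤ᵇ tallyAll Cs x y 1) ≡ true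
    from p = Equivalence.to T-≡ (≤⇒≤ᵇ (ℤ.drop‿+<+
      (subst (+ k ℤ.<_) (sym (tallyAll-margin₁ Cs x y))
        (subst (ℤ._< + k ℤ.+ margin Cs x y) (ℤ.+-identityʳ (+ k)) (ℤ.+-monoʳ-< (+ k) p)))))

  -- The place `(2 + length Cs) * 7 + 1` of the tally cell that is true iff the margin is positive.
  outputIndex : List (Circuit n n) → ℕ
  outputIndex Cs = length Cs * 7 + 15

-- Assembly of the reduced circuit

initialTally : ℕ → RawGates
initialTally W = copies W (consts 7 false) ++ consts 14 true

-- The 14 constants are the cells 0 and 1, seven gates each like every other cell; they are correct
-- because the tally never falls below 1.
tally-complete : ∀ {W c} u {q} → 1 ≤ c → length u ≡ W * 7 → NewCells W c u →
                 Tally W c (replicate 14 true ++ u ++ q)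
tally-complete {c = suc c} u p e cells zero          i< = refl
tally-complete {c = suc c} u p e cells (suc zero)    i< = refl
tally-complete u p e cells (suc (suc i)) (s≤s (s≤s i<)) = nth-++ˡ u (cells i i<)

empty-runs : ∀ {x} k {v} → ∃[ u ] Runs x (copies k (consts 7 false)) v (u ++ v) × length u ≡ k * 7 × NewCells k 1 u
empty-runs zero    = [] , [] , refl , λ i ()
empty-runs {x} (suc k) {v} =
  let u , r , e , cells = empty-runs {x} k {replicate 7 false ++ v}
  in u ++ replicate 7 false ,
     subst (Runs x _ v) (sym (++-assoc u (replicate 7 false) v)) (runs-consts 7 ⊙ r) ,
     trans (length-++ u) (trans (cong (_+ 7) e) (+-comm (k * 7) 7)) ,
     λ i i< → <-split {P = λ i → nth (u ++ replicate 7 false) (i * 7 + 1) ≡ just false} i<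
       (λ {i} p → nth-++ˡ u (cells i p))
       (trans (cong (λ z → nth (u ++ replicate 7 false) (z + 1)) (sym e)) (nth-++ʳ u))

tally-output : ∀ {W c} m v → m < W → Tally W c v → nth v (m * 7 + 15) ≡ just (2 + m ≤ᵇ c)
tally-output m v m<W t = nth-index {xs = v} (lemma m) (t (2 + m) (s≤s (s≤s m<W)))
  where
  lemma : ∀ m → m * 7 + 15 ≡ (2 + m) * 7 + 1
  lemma = solve-∀

module _ {n : ℕ} (W : ℕ) where

  -- The five constants are the initial flags: g at index 4 and l at index 0, with three fillers
  -- between them.
  stage : Circuit n n → RawGates
  stage (circuit {s} Γ os) =
    rawGates Γ ++ List.map (shiftInput n) (rawGates Γ) ++ consts 5 false ++ compareOutputs 0 os ++
    copies W (tallyGroup W s n) ++ consts 14 true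

  allGates : List (Circuit n n) → RawGates
  allGates Cs = initialTally W ++ concatMap stage Cs

  stage-runs : ∀ C x y {c v} → 1 ≤ c → Tally W c v →
    ∃[ v′ ] Runs (toList x ++ toList y) (stage C) v v′ × Tally W (advance (compareAt C x y) c) v′
  stage-runs C@(circuit {s} Γ os) x y {c} {v} 1≤c t =
    replicate 14 true ++ proj₁ tallied ++ q ++ v ,
    runs-left (toList y) (runs-below v (runs-raw Γ x)) ⊙
    runs-right (toList x) (length-toList x) (runs-below (toList as ++ v) (runs-raw Γ y)) ⊙
    runs-consts 5 ⊙ proj₂ (proj₂ compared) ⊙
    subst (λ z → Runs (toList x ++ toList y) (copies W (tallyGroup W s n)) z (proj₁ tallied ++ q ++ v)) q++v
      (proj₁ (proj₂ tallied)) ⊙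
    runs-consts 14 ,
    tally-complete (proj₁ tallied) (1≤advance (compareAt C x y) 1≤c)
      (proj₁ (proj₂ (proj₂ tallied))) (proj₂ (proj₂ (proj₂ tallied)))
    where
    as = evalGates Γ x
    bs = evalGates Γ y
    compared = compareOutputs-runs {toList x ++ toList y} {v = v} 0 (replicate 5 false) os as bs
                 (+-identityʳ n) (flags refl refl)
    u = proj₁ compared
    q = u ++ toList bs ++ toList as
    q++v : q ++ v ≡ u ++ toList bs ++ toList as ++ v
    q++v = trans (++-assoc u _ v) (cong (u ++_) (++-assoc (toList bs) _ v))
    q-flags : ∀ {g l} → Flags g l (n * 10 + 5) u → Flags g l (s + (s + (n * 10 + 5)) + 0 * 7) q
    q-flags (flags {f₁} {f₂} {f₃} {rest} p size) = flags (cong (_++ toList bs ++ toList as) p)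
      (trans (length-++ u) (trans (cong₂ _+_ size (trans (length-++ (toList bs))
        (cong₂ _+_ (length-toList bs) (length-toList as)))) (lemma s (n * 10 + 5))))
      where
      lemma : ∀ s k → k + (s + s) ≡ s + (s + k) + 0
      lemma = solve-∀
    tallied = tally-runs {toList x ++ toList y} {c = c} {v} {n} {s} W 0 W refl
      (compared-exclusive (compareAt-correct C x y)) t q (q-flags (proj₁ (proj₂ compared)))

  stages-run : ∀ Cs x y {c v} → 1 ≤ c → Tally W c v →
    ∃[ v′ ] Runs (toList x ++ toList y) (concatMap stage Cs) v v′ × Tally W (tallyAll Cs x y c) v′
  stages-run []       x y {v = v} 1≤c t = v , [] , t
  stages-run (C ∷ Cs) x y 1≤c t =
    let v , r , t′ = stage-runs C x y 1≤c t
        v′ , r′ , t″ = stages-run Cs x y (1≤advance (compareAt C x y) 1≤c) t′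
    in v′ , r ⊙ r′ , t″

  all-run : ∀ Cs x y → ∃[ v ] Runs (toList x ++ toList y) (allGates Cs) [] v × Tally W (tallyAll Cs x y 1) v
  all-run Cs x y =
    let u , r , e , cells = empty-runs {toList x ++ toList y} W {[]}
        v , r′ , t = stages-run Cs x y (s≤s z≤n) (tally-complete u (s≤s z≤n) e cells)
    in v , (r ⊙ runs-consts 14) ⊙ r′ , t

  -- The tally has cells up to W + 1, so `length Cs < W` provides the cell that is output.
  tournament : ∀ Cs → length Cs < W → Σ[ C ∈ Circuit (n + n) 1 ]
    encodeCircuit C ≡ encodeRaws (allGates Cs) ++ false ∷ encodeℕ (outputIndex Cs) ×
    (∀ x y → Vec.head (eval C (x Vec.++ y)) ≡ true ⇔ margin Cs x y ℤ.> 0ℤ)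
  tournament Cs m<W = circuit Γ (fromℕ< index< ∷ []) , text , λ x y →
    subst (λ b → b ≡ true ⇔ margin Cs x y ℤ.> 0ℤ) (sym (evaluates x y)) (tally⇔margin Cs x y)
    where
    -- Ranges do not depend on the inputs, so the run on zeros settles them; the same trick bounds
    -- the output index in `index<`.
    inRange : AllInRange (n + n) 0 (allGates Cs)
    inRange = subst (λ k → AllInRange k 0 (allGates Cs))
      (trans (length-++ (toList zeros)) (cong₂ _+_ (length-toList zeros) (length-toList zeros)))
      (runs-inRange (proj₁ (proj₂ (all-run Cs zeros zeros))))
      where
      zeros = Vec.replicate n false
    Γ = proj₂ (extend [] inRange)
    final : ∀ x y → toList (evalGates Γ (x Vec.++ y)) ≡ proj₁ (all-run Cs x y)
    final x y = runs-unique
      (subst (λ gs → Runs (toList x ++ toList y) gs [] (toList (evalGates Γ (x Vec.++ y)))) (rawGates-extend [] inRange)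
        (subst (λ z → Runs z (rawGates Γ) [] (toList (evalGates Γ (x Vec.++ y)))) (toList-++ x y)
          (runs-raw Γ (x Vec.++ y))))
      (proj₁ (proj₂ (all-run Cs x y)))
    output-at : ∀ x y → nth (toList (evalGates Γ (x Vec.++ y))) (outputIndex Cs) ≡
                        just (2 + length Cs ≤ᵇ tallyAll Cs x y 1)
    output-at x y = trans (cong (λ v → nth v (outputIndex Cs)) (final x y))
      (tally-output (length Cs) (proj₁ (all-run Cs x y)) m<W (proj₂ (proj₂ (all-run Cs x y))))
    index< : outputIndex Cs < proj₁ (extend [] inRange)
    index< = subst (outputIndex Cs <_) (length-toList (evalGates Γ zeros))
      (nth-length (toList (evalGates Γ zeros)) (output-at (Vec.replicate n false) (Vec.replicate n false)))
      where
      zeros = Vec.replicate n false Vec.++ Vec.replicate n false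
    evaluates : ∀ x y → lookup (evalGates Γ (x Vec.++ y)) (fromℕ< index<) ≡ (2 + length Cs ≤ᵇ tallyAll Cs x y 1)
    evaluates x y = just-unique (trans (cong (nth (toList (evalGates Γ (x Vec.++ y)))) (sym (toℕ-fromℕ< index<)))
      (nth-toList (evalGates Γ (x Vec.++ y)) (fromℕ< index<))) (output-at x y)
    text : encodeGates Γ ++ false ∷ encodeFin (fromℕ< index<) ++ [] ≡
           encodeRaws (allGates Cs) ++ false ∷ encodeℕ (outputIndex Cs)
    text = cong₂ (λ gs o → gs ++ false ∷ o)
      (trans (sym (encodeRaws-raw Γ)) (cong encodeRaws (rawGates-extend [] inRange)))
      (trans (++-identityʳ _) (cong encodeℕ (toℕ-fromℕ< index<)))

-- The reduction as a transducer

-- Operands as functions of the counters. Sums and products in `compareGroup` and `tallyGroup`, such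
-- as `s * 1`, are written exactly as `linear` evaluates them, so that symbolic and actual gates
-- agree by computation.
record Linear : Set where
  constructor _⊞_
  field
    terms  : List (Counter × ℕ)
    offset : ℕ

linear : Counters → Linear → ℕ
linear ks ([] ⊞ k)             = k
linear ks (((c , a) ∷ ts) ⊞ k) = lookup ks c * a + linear ks (ts ⊞ k)

mapGate : ∀ {I J : Set} → (I → J) → RawGate I → RawGate J
mapGate f (inp i)    = inp (f i)
mapGate f (cst b)    = cst b
mapGate f (neg i)    = neg (f i)
mapGate f (conj i j) = conj (f i) (f j)
mapGate f (disj i j) = disj (f i) (f j)

onesE : ℕ → Expr
onesE zero    = ε
onesE (suc k) = bit true · onesE k

linearE : List (Counter × ℕ) → ℕ → Expr
linearE []             k = onesE k · bit false
linearE ((c , a) ∷ ts) k = rep c (onesE a) · linearE ts k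

unaryE : Linear → Expr
unaryE (ts ⊞ k) = linearE ts k

gateE : RawGate Linear → Expr
gateE (inp i)    = bit false · bit false · unaryE i
gateE (cst b)    = bit false · bit true · bit b
gateE (neg i)    = bit true · bit false · unaryE i
gateE (conj i j) = bit true · bit true · bit false · unaryE i · unaryE j
gateE (disj i j) = bit true · bit true · bit true · unaryE i · unaryE j

gatesE : List (RawGate Linear) → Expr
gatesE []       = ε
gatesE (g ∷ gs) = (bit true · gateE g) · gatesE gs

onesE-correct : ∀ k ks → ⟦ onesE k ⟧ ks ≡ replicate k true
onesE-correct zero    ks = refl
onesE-correct (suc k) ks = cong (true ∷_) (onesE-correct k ks)

replicate-+ : ∀ {A : Set} m n {a : A} → replicate (m + n) a ≡ replicate m a ++ replicate n a
replicate-+ zero    n = refl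
replicate-+ (suc m) n = cong (_ ∷_) (replicate-+ m n)

copies-replicate : ∀ {A : Set} m n {b : A} → copies m (replicate n b) ≡ replicate (m * n) b
copies-replicate zero    n = refl
copies-replicate (suc m) n = trans (cong (replicate n _ ++_) (copies-replicate m n)) (sym (replicate-+ n (m * n)))

encodeℕ-+ : ∀ m n → replicate m true ++ encodeℕ n ≡ encodeℕ (m + n)
encodeℕ-+ zero    n = refl
encodeℕ-+ (suc m) n = cong (true ∷_) (encodeℕ-+ m n)

unaryE-correct : ∀ i ks → ⟦ unaryE i ⟧ ks ≡ encodeℕ (linear ks i)
unaryE-correct ([] ⊞ k) ks = cong (_++ false ∷ []) (onesE-correct k ks)
unaryE-correct (((c , a) ∷ ts) ⊞ k) ks = trans
  (cong₂ _++_ (trans (cong (copies (lookup ks c)) (onesE-correct a ks)) (copies-replicate (lookup ks c) a))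
    (unaryE-correct (ts ⊞ k) ks))
  (encodeℕ-+ (lookup ks c * a) _)

gateE-correct : ∀ g ks → ⟦ gateE g ⟧ ks ≡ encodeRaw (mapGate (linear ks) g)
gateE-correct (inp i)    ks = cong (λ w → false ∷ false ∷ w) (unaryE-correct i ks)
gateE-correct (cst b)    ks = refl
gateE-correct (neg i)    ks = cong (λ w → true ∷ false ∷ w) (unaryE-correct i ks)
gateE-correct (conj i j) ks =
  cong₂ (λ v w → true ∷ true ∷ false ∷ v ++ w) (unaryE-correct i ks) (unaryE-correct j ks)
gateE-correct (disj i j) ks =
  cong₂ (λ v w → true ∷ true ∷ true ∷ v ++ w) (unaryE-correct i ks) (unaryE-correct j ks)

gatesE-correct : ∀ gs ks → ⟦ gatesE gs ⟧ ks ≡ encodeRaws (List.map (mapGate (linear ks)) gs)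
gatesE-correct []       ks = refl
gatesE-correct (g ∷ gs) ks = cong₂ (λ v w → true ∷ v ++ w) (gateE-correct g ks) (gatesE-correct gs ks)

copies-encodeRaws : ∀ k gs → copies k (encodeRaws gs) ≡ encodeRaws (copies k gs)
copies-encodeRaws zero    gs = refl
copies-encodeRaws (suc k) gs =
  trans (cong (encodeRaws gs ++_) (copies-encodeRaws k gs)) (sym (encodeRaws-++ gs (copies k gs)))

# : ℕ → Linear
# k = [] ⊞ k

-- `cB` serves twice: while outputs are being read it is the number j of those done, and after the
-- last one it is n, as the operands of the tally require.
symbolicCompare symbolicTally : List (RawGate Linear)
symbolicCompare = compareGates # (((cT , 1) ∷ (cS , 1) ∷ (cB , 10) ∷ []) ⊞ 5) (((cT , 1) ∷ (cB , 10) ∷ []) ⊞ 6)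
symbolicTally = tallyGates # (operand 0) (operand 9) (operand 18)
  where
  operand : ℕ → Linear
  operand k = ((cW′ , 7) ∷ (cS , 2) ∷ (cB , 10) ∷ []) ⊞ k

symbolicConsts : ℕ → Bool → List (RawGate Linear)
symbolicConsts k b = replicate k (cst b)

tallyE initialE finalE : Expr
tallyE   = rep cW (gatesE symbolicTally) · gatesE (symbolicConsts 14 true)
initialE = rep cW (gatesE (symbolicConsts 7 false)) · gatesE (symbolicConsts 14 true)
finalE   = bit false · unaryE (((cM , 7) ∷ []) ⊞ 15)

counters₉ : (n r s q t b m W : ℕ) → Counters
counters₉ n r s q t b m W = n ∷ r ∷ s ∷ q ∷ t ∷ b ∷ m ∷ W ∷ W ∷ []

consts-correct : ∀ k b ks → ⟦ gatesE (symbolicConsts k b) ⟧ ks ≡ encodeRaws (consts k b)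
consts-correct k b ks = trans (gatesE-correct (symbolicConsts k b) ks)
  (cong encodeRaws (map-replicate (mapGate (linear ks)) k (cst b)))

tallyE-correct : ∀ n r s q t b m W → ⟦ tallyE ⟧ (counters₉ n r s q t b m W) ≡
                 encodeRaws (copies W (tallyGroup W s b) ++ consts 14 true)
tallyE-correct n r s q t b m W = trans
  (cong₂ _++_ (trans (cong (copies W) (gatesE-correct symbolicTally ks)) (copies-encodeRaws W (tallyGroup W s b)))
    (consts-correct 14 true ks))
  (sym (encodeRaws-++ (copies W (tallyGroup W s b)) (consts 14 true)))
  where
  ks = counters₉ n r s q t b m W

initialE-correct : ∀ n r s q t b m W → ⟦ initialE ⟧ (counters₉ n r s q t b m W) ≡
                   encodeRaws (copies W (consts 7 false) ++ consts 14 true)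
initialE-correct n r s q t b m W = trans
  (cong₂ _++_ (trans (cong (copies W) (consts-correct 7 false ks)) (copies-encodeRaws W (consts 7 false)))
    (consts-correct 14 true ks))
  (sym (encodeRaws-++ (copies W (consts 7 false)) (consts 14 true)))
  where
  ks = counters₉ n r s q t b m W

compareE-correct : ∀ n r s q t b m W → ⟦ gatesE symbolicCompare ⟧ (counters₉ n r s q t b m W) ≡
                   encodeRaws (compareGroup s b t)
compareE-correct n r s q t b m W = gatesE-correct symbolicCompare (counters₉ n r s q t b m W)

finalE-correct : ∀ n r s q t b m W → ⟦ finalE ⟧ (counters₉ n r s q t b m W) ≡ false ∷ encodeℕ (m * 7 + 15)
finalE-correct n r s q t b m W = cong (false ∷_) (unaryE-correct (((cM , 7) ∷ []) ⊞ 15) (counters₉ n r s q t b m W))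

pattern readSize    = 0F
pattern nextCircuit = 1F
pattern nextGate    = 2F
pattern gateTag     = 3F
pattern gateTag0    = 4F
pattern gateTag1    = 5F
pattern gateTag11   = 6F
pattern constant    = 7F
pattern index₂      = 8F
pattern index₁      = 9F
pattern nextOutput  = suc 9F
pattern finished    = suc (suc 9F)
pattern failed      = suc (suc (suc 9F))

Mode : Set
Mode = Fin 13

-- The gates of a circuit are copied to the output, and for the second copy to
-- the buffer, where inputs are shifted.
copyBit : Bool → Code Mode → Code Mode
copyBit b P = emit toOut (bit b) ⨾ emit toBuf (bit b) ⨾ P

-- `afterOutput` is also run before the first output, which covers n = 0.
endCircuit afterOutput : Code Mode
endCircuit  = emit toOut tallyE ⨾ clr cS ⨾ clr cB ⨾ copy cR cN ⨾ become nextCircuit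
afterOutput = test cR endCircuit (copy cQ cS ⨾ become nextOutput)

-- While an index is read, Q is the number of values that it can still take.  R is the number of outputs yet
-- to be read, B the number of outputs already read, T the part of the current output's index already read,
-- S the number of gates, and M the number of circuits.
reduction : Mode → Bool → Code Mode
reduction readSize    true  = emit toOut (bit true) ⨾ inc cN ⨾ inc cR ⨾ become readSize
reduction readSize    false = emit toOut (bit false · initialE) ⨾ become nextCircuit
reduction nextCircuit true  = inc cM ⨾ become nextGate
reduction nextCircuit false = emit toOut finalE ⨾ become finished
reduction nextGate    true  = copyBit true (become gateTag)
-- The buffered second copy goes behind the first, followed by the initial flags.
reduction nextGate    false = flush ⨾ emit toOut (gatesE (symbolicConsts 5 false)) ⨾ afterOutput
reduction gateTag     false = copyBit false (become gateTag0)
reduction gateTag     true  = copyBit true (become gateTag1)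
-- Indices are in unary, so n ones in front of one shift it to the second half of the inputs.
reduction gateTag0    false = copyBit false (emit toBuf (rep cN (bit true)) ⨾ copy cQ cN ⨾ become index₁)
reduction gateTag0    true  = copyBit true (become constant)
reduction gateTag1    false = copyBit false (copy cQ cS ⨾ become index₁)
reduction gateTag1    true  = copyBit true (become gateTag11)
reduction gateTag11   b     = copyBit b (copy cQ cS ⨾ become index₂)
reduction constant    b     = copyBit b (inc cS ⨾ become nextGate)
reduction index₂      true  = test cQ (become failed) (copyBit true (dec cQ ⨾ become index₂))
-- The second operand ranges over all s gates anew and is read like the operand of a negation.
reduction index₂      false = test cQ (become failed) (copyBit false (copy cQ cS ⨾ become index₁))
reduction index₁      true  = test cQ (become failed) (copyBit true (dec cQ ⨾ become index₁))
reduction index₁      false = test cQ (become failed) (copyBit false (inc cS ⨾ become nextGate))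
reduction nextOutput  true  = test cQ (become failed) (dec cQ ⨾ inc cT ⨾ become nextOutput)
reduction nextOutput  false =
  test cQ (become failed) (emit toOut (gatesE symbolicCompare) ⨾ clr cT ⨾ inc cB ⨾ dec cR ⨾ afterOutput)
reduction finished    b     = become failed
reduction failed      b     = become failed

reducer : Transducer
reducer = record { modes = 13 ; code = reduction ; initialMode = readSize ; accept = finished }

-- Behaviour of the transducer on encodings

state : (o y : Word) (n r s q t b m W : ℕ) → Memory
state o y n r s q t b m W = mem o y (counters₉ n r s q t b m W)

infix 4 _↝_

_↝_ : (Mode × Memory) × Word → (Mode × Memory) × Word → Set
(c , w) ↝ (c′ , w′) = process reducer c w ≡ process reducer c′ w′

snoc-++ : ∀ (v : Word) b w → (v ++ b ∷ []) ++ w ≡ v ++ b ∷ w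
snoc-++ v b w = ++-assoc v (b ∷ []) w

-- `cQ` is set anew before every index, so what remains in it is merely asserted to exist.
index₁-step : ∀ {o y n r s t b m W} i q w → i < q → ∃[ q′ ]
  ((index₁ , state o y n r s q t b m W) , encodeℕ i ++ w) ↝
  ((nextGate , state (o ++ encodeℕ i) (y ++ encodeℕ i) n r (suc s) q′ t b m W) , w)
index₁-step zero (suc q) w i<q = suc q , refl
index₁-step {o} {y} {n} {r} {s} {t} {b} {m} {W} (suc i) (suc q) w (s≤s i<q) =
  let q′ , e = index₁-step {o ++ true ∷ []} {y ++ true ∷ []} {n} {r} {s} {t} {b} {m} {W} i q w i<q
  in q′ , trans e (cong₂ (λ o y → process reducer (nextGate , state o y n r (suc s) q′ t b m W) w)
                    (snoc-++ o true (encodeℕ i)) (snoc-++ y true (encodeℕ i)))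

index₂-step : ∀ {o y n r s t b m W} i q w → i < q →
  ((index₂ , state o y n r s q t b m W) , encodeℕ i ++ w) ↝
  ((index₁ , state (o ++ encodeℕ i) (y ++ encodeℕ i) n r s s t b m W) , w)
index₂-step zero (suc q) w i<q = refl
index₂-step {o} {y} {n} {r} {s} {t} {b} {m} {W} (suc i) (suc q) w (s≤s i<q) =
  trans (index₂-step {o ++ true ∷ []} {y ++ true ∷ []} {n} {r} {s} {t} {b} {m} {W} i q w i<q)
    (cong₂ (λ o y → process reducer (index₁ , state o y n r s s t b m W) w)
      (snoc-++ o true (encodeℕ i)) (snoc-++ y true (encodeℕ i)))

copies-true : ∀ n → copies n (true ∷ []) ≡ replicate n true
copies-true zero    = refl
copies-true (suc n) = cong (true ∷_) (copies-true n)

snoc₃ : ∀ (v : Word) {a₁ a₂ a₃} w → (((v ++ a₁ ∷ []) ++ a₂ ∷ []) ++ a₃ ∷ []) ++ w ≡ v ++ a₁ ∷ a₂ ∷ a₃ ∷ w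
snoc₃ v {a₁} {a₂} w =
  trans (snoc-++ ((v ++ a₁ ∷ []) ++ a₂ ∷ []) _ w) (trans (snoc-++ (v ++ a₁ ∷ []) _ _) (snoc-++ v _ _))

snoc₄ : ∀ (v : Word) {a₁ a₂ a₃ a₄} w →
        ((((v ++ a₁ ∷ []) ++ a₂ ∷ []) ++ a₃ ∷ []) ++ a₄ ∷ []) ++ w ≡ v ++ a₁ ∷ a₂ ∷ a₃ ∷ a₄ ∷ w
snoc₄ v {a₁} {a₂} {a₃} w = trans (snoc-++ (((v ++ a₁ ∷ []) ++ a₂ ∷ []) ++ a₃ ∷ []) _ w) (snoc₃ v _)

shifted : ∀ {n s} → Gates n s → Word
shifted {n} Γ = encodeRaws (List.map (shiftInput n) (rawGates Γ))

shifted-▷ : ∀ {n s} (Γ : Gates n s) g → shifted (Γ ▷ g) ≡ shifted Γ ++ true ∷ encodeRaw (shiftInput n (rawGate g))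
shifted-▷ {n} Γ g = trans (cong encodeRaws (map-++ (shiftInput n) (rawGates Γ) (rawGate g ∷ [])))
  (trans (encodeRaws-++ (List.map (shiftInput n) (rawGates Γ)) _) (cong (shifted Γ ++_) (++-identityʳ _)))

module _ {n r t b m W : ℕ} where

  at-nextGate : (o y : Word) (s q : ℕ) → Mode × Memory
  at-nextGate o y s q = nextGate , state o y n r s q t b m W

  index₁-gate : ∀ {o y s} i q w {o′ y′} → i < q → o ++ encodeℕ i ≡ o′ → y ++ encodeℕ i ≡ y′ → ∃[ q′ ]
    ((index₁ , state o y n r s q t b m W) , encodeℕ i ++ w) ↝ (at-nextGate o′ y′ (suc s) q′ , w)
  index₁-gate i q w i<q refl refl = index₁-step i q w i<q

  index₂-gate : ∀ {o y s} i j w {o′ y′} → i < s → j < s →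
    o ++ encodeℕ i ++ encodeℕ j ≡ o′ → y ++ encodeℕ i ++ encodeℕ j ≡ y′ → ∃[ q′ ]
    ((index₂ , state o y n r s s t b m W) , (encodeℕ i ++ encodeℕ j) ++ w) ↝ (at-nextGate o′ y′ (suc s) q′ , w)
  index₂-gate {o} {y} {s} i j w i<s j<s refl refl =
    let q′ , e = index₁-gate {o ++ encodeℕ i} {y ++ encodeℕ i} {s} j s w j<s
                   (++-assoc o (encodeℕ i) (encodeℕ j)) (++-assoc y (encodeℕ i) (encodeℕ j))
    in q′ , trans (cong (process reducer (index₂ , state o y n r s s t b m W)) (++-assoc (encodeℕ i) (encodeℕ j) w))
              (trans (index₂-step {o} {y} {n} {r} {s} {t} {b} {m} {W} i s (encodeℕ j ++ w) i<s) e)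

  gate-step : ∀ {o y s} q (g : Gate n s) w → ∃[ q′ ]
    (at-nextGate o y s q , true ∷ encodeGate g ++ w) ↝
    (at-nextGate (o ++ true ∷ encodeGate g) (y ++ true ∷ encodeRaw (shiftInput n (rawGate g))) (suc s) q′ , w)
  gate-step {o} {y} {s} q (input i) w = index₁-gate (toℕ i) n w (toℕ<n i) (snoc₃ o _)
    (trans (++-assoc (((y ++ _) ++ _) ++ _) (copies n (true ∷ [])) _)
      (trans (snoc₃ y _) (cong (λ z → y ++ true ∷ false ∷ false ∷ z)
        (trans (cong (_++ encodeFin i) (copies-true n)) (encodeℕ-+ n (toℕ i))))))
  gate-step {o} {y} {s} q (const c) w = q ,
    cong₂ (λ o y → process reducer (at-nextGate o y (suc s) q) w) (snoc₃ o _) (snoc₃ y _)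
  gate-step {o} {y} {s} q (not′ i) w =
    index₁-gate (toℕ i) s w (toℕ<n i) (snoc₃ o _) (snoc₃ y _)
  gate-step {o} {y} {s} q (and′ i j) w =
    index₂-gate (toℕ i) (toℕ j) w (toℕ<n i) (toℕ<n j) (snoc₄ o _) (snoc₄ y _)
  gate-step {o} {y} {s} q (or′ i j) w =
    index₂-gate (toℕ i) (toℕ j) w (toℕ<n i) (toℕ<n j) (snoc₄ o _) (snoc₄ y _)

  gates-step : ∀ {o y s} q (Γ : Gates n s) w → ∃[ q′ ]
    (at-nextGate o y 0 q , encodeGates Γ ++ w) ↝ (at-nextGate (o ++ encodeGates Γ) (y ++ shifted Γ) s q′ , w)
  gates-step {o} {y} q [] w =
    q , cong₂ (λ o y → process reducer (at-nextGate o y 0 q) w) (sym (++-identityʳ o)) (sym (++-identityʳ y))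
  gates-step {o} {y} {suc s} q (Γ ▷ g) w =
    let q₁ , e₁ = gates-step {o} {y} q Γ (true ∷ encodeGate g ++ w)
        q₂ , e₂ = gate-step {o ++ encodeGates Γ} {y ++ shifted Γ} q₁ g w
    in q₂ , trans (cong (process reducer (at-nextGate o y 0 q)) (++-assoc (encodeGates Γ) _ w))
         (trans e₁ (trans e₂ (cong₂ (λ o y → process reducer (at-nextGate o y (suc s) q₂) w)
           (++-assoc o (encodeGates Γ) _)
           (trans (++-assoc y (shifted Γ) _) (cong (y ++_) (sym (shifted-▷ Γ g)))))))

-- The index being read is `i + t`, of which t ones are already counted in `cT`; this generality
-- carries the induction.
output-step : ∀ {o n r s t b m W} i q w → i < q → ∃[ q′ ]
  ((nextOutput , state o [] n (suc r) s q t b m W) , encodeℕ i ++ w) ↝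
  (run afterOutput (state (o ++ encodeRaws (compareGroup s b (i + t))) [] n r s q′ 0 (suc b) m W) , w)
output-step {o} {n} {r} {s} {t} {b} {m} {W} zero (suc q) w i<q = suc q ,
  cong (λ v → process reducer (run afterOutput (state (o ++ v) [] n r s (suc q) 0 (suc b) m W)) w)
    (compareE-correct n (suc r) s (suc q) t b m W)
output-step {o} {n} {r} {s} {t} {b} {m} {W} (suc i) (suc q) w (s≤s i<q) =
  let q′ , e = output-step {o} {n} {r} {s} {suc t} {b} {m} {W} i q w i<q
  in q′ , trans e (cong (λ k → process reducer
            (run afterOutput (state (o ++ encodeRaws (compareGroup s b k)) [] n r s q′ 0 (suc b) m W)) w) (+-suc i t))

at-nextCircuit : (n W : ℕ) (o : Word) (q m : ℕ) → Mode × Memory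
at-nextCircuit n W o q m = nextCircuit , state o [] n n 0 q 0 0 m W

circuitEnd : (n W s : ℕ) → RawGates
circuitEnd n W s = copies W (tallyGroup W s n) ++ consts 14 true

module _ {n m W : ℕ} where

  outputs-step : ∀ {o s k} b q (os : Vec (Fin s) k) w → k + b ≡ n → ∃[ q′ ]
    (run afterOutput (state o [] n k s q 0 b m W) , encodeOutputs os ++ w) ↝
    (at-nextCircuit n W (o ++ encodeRaws (compareOutputs b os ++ circuitEnd n W s)) q′ m , w)
  outputs-step {o} {s} b q [] w refl = q ,
    cong (λ v → process reducer (at-nextCircuit n W (o ++ v) q m) w) (tallyE-correct n 0 s q 0 n m W)
  outputs-step {o} {s} {suc k} b q (i ∷ os) w e =
    let q₁ , e₁ = output-step {o} {n} {k} {s} {0} {b} {m} {W} (toℕ i) s (encodeOutputs os ++ w) (toℕ<n i)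
        q₂ , e₂ = outputs-step {o ++ encodeRaws (compareGroup s b (toℕ i + 0))} (suc b) q₁ os w (trans (+-suc k b) e)
    in q₂ , trans (cong (process reducer (nextOutput , state o [] n (suc k) s s 0 b m W))
                    (++-assoc (encodeFin i) (encodeOutputs os) w))
         (trans e₁ (trans e₂ (cong (λ v → process reducer (at-nextCircuit n W v q₂ m) w) text)))
    where
    others = compareOutputs (suc b) os ++ circuitEnd n W s
    text : (o ++ encodeRaws (compareGroup s b (toℕ i + 0))) ++ encodeRaws others ≡
           o ++ encodeRaws (compareOutputs b (i ∷ os) ++ circuitEnd n W s)
    text = trans (++-assoc o _ _) (cong (o ++_)
      (trans (cong (λ j → encodeRaws (compareGroup s b j) ++ encodeRaws others) (+-identityʳ (toℕ i)))
        (trans (sym (encodeRaws-++ (compareGroup s b (toℕ i)) others))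
          (cong encodeRaws (sym (++-assoc (compareGroup s b (toℕ i)) (compareOutputs (suc b) os) _))))))

circuit-step : ∀ {n m W o} q (C : Circuit n n) w → ∃[ q′ ]
  (at-nextCircuit n W o q m , true ∷ encodeCircuit C ++ w) ↝
  (at-nextCircuit n W (o ++ encodeRaws (stage W C)) q′ (suc m) , w)
circuit-step {n} {m} {W} {o} q (circuit {s} Γ os) w =
  let q₁ , e₁ = gates-step {n} {n} {0} {0} {suc m} {W} {o} {[]} q Γ (false ∷ encodeOutputs os ++ w)
      o₁ = (o ++ encodeGates Γ) ++ shifted Γ
      o₂ = o₁ ++ ⟦ gatesE (symbolicConsts 5 false) ⟧ (counters₉ n n s q₁ 0 0 (suc m) W)
      q₂ , e₂ = outputs-step {n} {suc m} {W} {o₂} 0 q₁ os w (+-identityʳ n)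
  in q₂ , trans (cong (process reducer (nextGate , state o [] n n 0 q 0 0 (suc m) W)) (++-assoc (encodeGates Γ) _ w))
       (trans e₁ (trans e₂ (cong (λ v → process reducer (at-nextCircuit n W v q₂ (suc m)) w)
         (text q₁))))
  where
  Ys = List.map (shiftInput n) (rawGates Γ)
  Zs = compareOutputs 0 os ++ circuitEnd n W s
  text : ∀ q₁ → (((o ++ encodeGates Γ) ++ encodeRaws Ys) ++
                 ⟦ gatesE (symbolicConsts 5 false) ⟧ (counters₉ n n s q₁ 0 0 (suc m) W)) ++ encodeRaws Zs ≡
                o ++ encodeRaws (stage W (circuit Γ os))
  text q₁ = begin
    (((o ++ encodeGates Γ) ++ encodeRaws Ys) ++ ⟦ gatesE (symbolicConsts 5 false) ⟧ ks) ++ encodeRaws Zs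
      ≡⟨ cong (λ v → (((o ++ encodeGates Γ) ++ encodeRaws Ys) ++ v) ++ encodeRaws Zs) (consts-correct 5 false ks) ⟩
    (((o ++ encodeGates Γ) ++ encodeRaws Ys) ++ encodeRaws (consts 5 false)) ++ encodeRaws Zs
      ≡⟨ ++-assoc ((o ++ encodeGates Γ) ++ encodeRaws Ys) _ _ ⟩
    ((o ++ encodeGates Γ) ++ encodeRaws Ys) ++ encodeRaws (consts 5 false) ++ encodeRaws Zs
      ≡⟨ cong (((o ++ encodeGates Γ) ++ encodeRaws Ys) ++_) (sym (encodeRaws-++ (consts 5 false) Zs)) ⟩
    ((o ++ encodeGates Γ) ++ encodeRaws Ys) ++ encodeRaws (consts 5 false ++ Zs)
      ≡⟨ ++-assoc (o ++ encodeGates Γ) _ _ ⟩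
    (o ++ encodeGates Γ) ++ encodeRaws Ys ++ encodeRaws (consts 5 false ++ Zs)
      ≡⟨ cong ((o ++ encodeGates Γ) ++_) (sym (encodeRaws-++ Ys _)) ⟩
    (o ++ encodeGates Γ) ++ encodeRaws (Ys ++ consts 5 false ++ Zs)
      ≡⟨ ++-assoc o _ _ ⟩
    o ++ encodeGates Γ ++ encodeRaws (Ys ++ consts 5 false ++ Zs)
      ≡⟨ cong (λ v → o ++ v ++ encodeRaws (Ys ++ consts 5 false ++ Zs)) (sym (encodeRaws-raw Γ)) ⟩
    o ++ encodeRaws (rawGates Γ) ++ encodeRaws (Ys ++ consts 5 false ++ Zs)
      ≡⟨ cong (o ++_) (sym (encodeRaws-++ (rawGates Γ) _)) ⟩
    o ++ encodeRaws (stage W (circuit Γ os)) ∎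
    where
    open ≡-Reasoning
    ks = counters₉ n n s q₁ 0 0 (suc m) W

circuits-step : ∀ {n m W o} q (Cs : List (Circuit n n)) →
  ∃[ μ ] process reducer (at-nextCircuit n W o q m) (encodeCircuits Cs) ≡ (finished , μ) ×
         out μ ≡ o ++ encodeRaws (concatMap (stage W) Cs) ++ false ∷ encodeℕ ((length Cs + m) * 7 + 15)
circuits-step {n} {m} {W} {o} q [] = _ , refl , cong (o ++_) (finalE-correct n n 0 q 0 0 m W)
circuits-step {n} {m} {W} {o} q (C ∷ Cs) =
  let q₁ , e₁ = circuit-step {n} {m} {W} {o} q C (encodeCircuits Cs)
      μ , e₂ , p = circuits-step {n} {suc m} {W} {o ++ encodeRaws (stage W C)} q₁ Cs
  in μ , trans e₁ e₂ , trans p (trans (++-assoc o _ _) (cong (o ++_)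
       (trans (sym (++-assoc (encodeRaws (stage W C)) _ _))
         (cong₂ (λ v k → v ++ false ∷ encodeℕ (k * 7 + 15)) (sym (encodeRaws-++ (stage W C) (concatMap (stage W) Cs)))
           (+-suc (length Cs) m)))))

size-step : ∀ {W} o k n w →
  ((readSize , state o [] k k 0 0 0 0 0 W) , encodeℕ n ++ w) ↝
  (at-nextCircuit (n + k) W (o ++ encodeℕ n ++ encodeRaws (initialTally W)) 0 0 , w)
size-step {W} o k zero w =
  cong (λ v → process reducer (at-nextCircuit k W (o ++ false ∷ v) 0 0) w) (initialE-correct k k 0 0 0 0 0 W)
size-step {W} o k (suc n) w = trans (size-step {W} (o ++ true ∷ []) (suc k) n w)
  (cong₂ (λ v j → process reducer (at-nextCircuit j W v 0 0) w) (snoc-++ o true _) (+-suc n k))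

reduced : ∀ {n} → List (Circuit n n) → Word
reduced {n} Cs = encodeℕ n ++ encodeRaws (allGates W Cs) ++ false ∷ encodeℕ (outputIndex Cs)
  where
  W = length (encodeℕ n ++ encodeCircuits Cs)

transduce-encoding : ∀ {n} (Cs : List (Circuit n n)) →
                     transduce reducer (encodeℕ n ++ encodeCircuits Cs) ≡ reduced Cs
transduce-encoding {n} Cs = final (circuits-step {n} {0} {W} {encodeℕ n ++ encodeRaws (initialTally W)} 0 Cs)
  where
  W = length (encodeℕ n ++ encodeCircuits Cs)
  started : process reducer (readSize , initialMemory W) (encodeℕ n ++ encodeCircuits Cs) ≡
            process reducer (at-nextCircuit n W (encodeℕ n ++ encodeRaws (initialTally W)) 0 0) (encodeCircuits Cs)
  started = trans (size-step {W} [] 0 n (encodeCircuits Cs))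
    (cong (λ j → process reducer (at-nextCircuit j W (encodeℕ n ++ encodeRaws (initialTally W)) 0 0)
                         (encodeCircuits Cs))
      (+-identityʳ n))
  final : (∃[ μ ] process reducer (at-nextCircuit n W (encodeℕ n ++ encodeRaws (initialTally W)) 0 0)
                    (encodeCircuits Cs) ≡ (finished , μ) ×
           out μ ≡ (encodeℕ n ++ encodeRaws (initialTally W)) ++ encodeRaws (concatMap (stage W) Cs) ++
                   false ∷ encodeℕ ((length Cs + 0) * 7 + 15)) →
          transduce reducer (encodeℕ n ++ encodeCircuits Cs) ≡ reduced Cs
  final (μ , e , p) = trans (cong (result reducer) (trans started e)) (trans p
    (trans (++-assoc (encodeℕ n) _ _) (cong (encodeℕ n ++_)
      (trans (sym (++-assoc (encodeRaws (initialTally W)) _ _))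
        (cong₂ (λ v k → v ++ false ∷ encodeℕ (k * 7 + 15))
          (sym (encodeRaws-++ (initialTally W) (concatMap (stage W) Cs))) (+-identityʳ (length Cs)))))))

-- Rejection of words that are not encodings

Accepts : Mode × Memory → Word → Set
Accepts c r = proj₁ (process reducer c r) ≡ finished

failed-rejects : ∀ {A : Set} {μ} r → Accepts (failed , μ) r → A
failed-rejects []          ()
failed-rejects (true  ∷ r) e = failed-rejects r e
failed-rejects (false ∷ r) e = failed-rejects r e

CircuitsText : ℕ → Word → Set
CircuitsText n r = Σ[ Cs ∈ List (Circuit n n) ] r ≡ encodeCircuits Cs

OutputsText : ℕ → ℕ → ℕ → Word → Set
OutputsText n s k r = Σ[ os ∈ Vec (Fin s) k ] ∃[ r′ ] r ≡ encodeOutputs os ++ r′ × CircuitsText n r′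

GatesText : ℕ → Word → Set
GatesText n r = ∃[ s ] Σ[ Γ ∈ Gates n s ] ∃[ r′ ] r ≡ encodeGates Γ ++ false ∷ r′ × OutputsText n s n r′

-- What is known about the part that has been read is passed along as a partial syntax tree:
-- mk is the gate or output as a function of the remaining part of an index.
mutual
  sound-nextCircuit : ∀ {o y n q t b m W} r → Accepts (nextCircuit , state o y n n 0 q t b m W) r → CircuitsText n r
  sound-nextCircuit []                  ()
  sound-nextCircuit (false ∷ [])        e = [] , refl
  sound-nextCircuit (false ∷ true  ∷ r) e = failed-rejects r e
  sound-nextCircuit (false ∷ false ∷ r) e = failed-rejects r e
  sound-nextCircuit (true ∷ r)          e with sound-nextGate r [] e
  ... | s , Γ , _ , refl , os , _ , refl , Cs , refl =
    circuit Γ os ∷ Cs , cong (true ∷_) (sym (++-assoc (encodeGates Γ) (false ∷ encodeOutputs os) (encodeCircuits Cs)))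

  sound-nextGate : ∀ {o y n s q t b m W} r (Γ : Gates n s) → Accepts (nextGate , state o y n n s q t b m W) r →
                   GatesText n (encodeGates Γ ++ r)
  sound-nextGate []          Γ ()
  sound-nextGate (false ∷ r) Γ e = _ , Γ , r , refl , sound-afterOutput _ r e
  sound-nextGate (true ∷ r)  Γ e = sound-gateTag r Γ e

  sound-gateTag : ∀ {o y n s q t b m W} r (Γ : Gates n s) → Accepts (gateTag , state o y n n s q t b m W) r →
                  GatesText n (encodeGates Γ ++ true ∷ r)
  sound-gateTag []                         Γ ()
  sound-gateTag (false ∷ [])               Γ ()
  sound-gateTag (false ∷ true  ∷ [])       Γ ()
  sound-gateTag (false ∷ true  ∷ true  ∷ r) Γ e =
    subst (GatesText _) (++-assoc (encodeGates Γ) _ r) (sound-nextGate r (Γ ▷ const true) e)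
  sound-gateTag (false ∷ true  ∷ false ∷ r) Γ e =
    subst (GatesText _) (++-assoc (encodeGates Γ) _ r) (sound-nextGate r (Γ ▷ const false) e)
  sound-gateTag (false ∷ false ∷ r)        Γ e = sound-index₁ r Γ input (false ∷ false ∷ []) (λ _ → refl) e
  sound-gateTag (true  ∷ [])               Γ ()
  sound-gateTag (true  ∷ false ∷ r)        Γ e = sound-index₁ r Γ not′ (true ∷ false ∷ []) (λ _ → refl) e
  sound-gateTag (true  ∷ true  ∷ [])       Γ ()
  sound-gateTag (true  ∷ true  ∷ false ∷ r) Γ e =
    sound-index₂ r Γ and′ (true ∷ true ∷ false ∷ []) (λ _ _ → refl) e
  sound-gateTag (true  ∷ true  ∷ true  ∷ r) Γ e =
    sound-index₂ r Γ or′ (true ∷ true ∷ true ∷ []) (λ _ _ → refl) e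

  -- The value q of `cQ` is also the size of the type of indices still possible, so the transducer
  -- fails exactly when the partial gate `mk` has no completion. `p` is the text of the gate read so
  -- far.
  sound-index₁ : ∀ {o y n s q t b m W} r (Γ : Gates n s) (mk : Fin q → Gate n s) p →
                 (∀ i → encodeGate (mk i) ≡ p ++ encodeFin i) →
                 Accepts (index₁ , state o y n n s q t b m W) r → GatesText n (encodeGates Γ ++ true ∷ p ++ r)
  sound-index₁             []          Γ mk p h ()
  sound-index₁ {q = zero}  (true  ∷ r) Γ mk p h e = failed-rejects r e
  sound-index₁ {q = zero}  (false ∷ r) Γ mk p h e = failed-rejects r e
  sound-index₁ {q = suc q} (true  ∷ r) Γ mk p h e =
    subst (λ v → GatesText _ (encodeGates Γ ++ true ∷ v)) (snoc-++ p true r)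
      (sound-index₁ r Γ (mk ∘ suc) (p ++ true ∷ []) (λ i → trans (h (suc i)) (sym (snoc-++ p true (encodeFin i)))) e)
  sound-index₁ {q = suc q} (false ∷ r) Γ mk p h e =
    subst (GatesText _)
      (trans (++-assoc (encodeGates Γ) _ r)
        (cong (λ v → encodeGates Γ ++ true ∷ v) (trans (cong (_++ r) (h zero)) (snoc-++ p false r))))
      (sound-nextGate r (Γ ▷ mk zero) e)

  sound-index₂ : ∀ {o y n s q t b m W} r (Γ : Gates n s) (mk : Fin q → Fin s → Gate n s) p →
                 (∀ i j → encodeGate (mk i j) ≡ p ++ encodeFin i ++ encodeFin j) →
                 Accepts (index₂ , state o y n n s q t b m W) r → GatesText n (encodeGates Γ ++ true ∷ p ++ r)
  sound-index₂             []          Γ mk p h ()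
  sound-index₂ {q = zero}  (true  ∷ r) Γ mk p h e = failed-rejects r e
  sound-index₂ {q = zero}  (false ∷ r) Γ mk p h e = failed-rejects r e
  sound-index₂ {q = suc q} (true  ∷ r) Γ mk p h e =
    subst (λ v → GatesText _ (encodeGates Γ ++ true ∷ v)) (snoc-++ p true r)
      (sound-index₂ r Γ (mk ∘ suc) (p ++ true ∷ [])
        (λ i j → trans (h (suc i) j) (sym (snoc-++ p true (encodeFin i ++ encodeFin j)))) e)
  sound-index₂ {q = suc q} (false ∷ r) Γ mk p h e =
    subst (λ v → GatesText _ (encodeGates Γ ++ true ∷ v)) (snoc-++ p false r)
      (sound-index₁ r Γ (mk zero) (p ++ false ∷ []) (λ j → trans (h zero j) (sym (snoc-++ p false (encodeFin j)))) e)

  sound-afterOutput : ∀ {o y n s q t b m W} k r → Accepts (run afterOutput (state o y n k s q t b m W)) r →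
                      OutputsText n s k r
  sound-afterOutput zero    r e = [] , r , refl , sound-nextCircuit r e
  sound-afterOutput (suc k) r e = sound-nextOutput r id [] (λ _ → refl) e

  sound-nextOutput : ∀ {o y n k s q t b m W} r (mk : Fin q → Fin s) p → (∀ i → encodeFin (mk i) ≡ p ++ encodeFin i) →
                     Accepts (nextOutput , state o y n (suc k) s q t b m W) r → OutputsText n s (suc k) (p ++ r)
  sound-nextOutput             []          mk p h ()
  sound-nextOutput {q = zero}  (true  ∷ r) mk p h e = failed-rejects r e
  sound-nextOutput {q = zero}  (false ∷ r) mk p h e = failed-rejects r e
  sound-nextOutput {q = suc q} (true  ∷ r) mk p h e =
    subst (OutputsText _ _ _) (snoc-++ p true r)
      (sound-nextOutput r (mk ∘ suc) (p ++ true ∷ []) (λ i → trans (h (suc i)) (sym (snoc-++ p true (encodeFin i)))) e)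
  sound-nextOutput {k = k} {q = suc q} (false ∷ r) mk p h e with sound-afterOutput k r e
  ... | os , r′ , refl , rest = mk zero ∷ os , r′ ,
    trans (sym (snoc-++ p false (encodeOutputs os ++ r′)))
      (trans (cong (_++ encodeOutputs os ++ r′) (sym (h zero)))
        (sym (++-assoc (encodeFin (mk zero)) (encodeOutputs os) r′))) ,
    rest

ones-snoc : ∀ k r → replicate k true ++ true ∷ r ≡ true ∷ replicate k true ++ r
ones-snoc zero    r = refl
ones-snoc (suc k) r = cong (true ∷_) (ones-snoc k r)

sound-readSize : ∀ {o y W} k r → Accepts (readSize , state o y k k 0 0 0 0 0 W) r →
  ∃[ n ] Σ[ Cs ∈ List (Circuit n n) ] replicate k true ++ r ≡ encodeℕ n ++ encodeCircuits Cs
sound-readSize k []          ()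
sound-readSize k (true  ∷ r) e =
  let n , Cs , p = sound-readSize (suc k) r e in n , Cs , trans (ones-snoc k r) p
sound-readSize k (false ∷ r) e =
  let Cs , p = sound-nextCircuit r e
  in k , Cs , trans (sym (snoc-++ (replicate k true) false r)) (cong (encodeℕ k ++_) p)

result-accepts : ∀ c → result reducer c ≢ [] → proj₁ c ≡ finished
result-accepts (m , μ) h with m ≟ finished
... | yes p = p
... | no  _ = ⊥-elim (h refl)

-- Acceptance forces a complete parse, and every other run yields the empty word.
transduce-sound : ∀ w → transduce reducer w ≢ [] →
                  ∃[ n ] Σ[ Cs ∈ List (Circuit n n) ] w ≡ encodeℕ n ++ encodeCircuits Cs
transduce-sound w h = sound-readSize 0 w
  (result-accepts (process reducer (readSize , initialMemory (length w)) w) h)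

-- Unique decoding

encodeℕ-injective : ∀ i j {r r′} → encodeℕ i ++ r ≡ encodeℕ j ++ r′ → i ≡ j × r ≡ r′
encodeℕ-injective zero    zero    refl = refl , refl
encodeℕ-injective (suc i) (suc j) e    =
  let p , q = encodeℕ-injective i j (∷-injectiveʳ e) in cong suc p , q

operands-injective : ∀ i j i′ j′ {r r′} →
  (encodeℕ i ++ encodeℕ j) ++ r ≡ (encodeℕ i′ ++ encodeℕ j′) ++ r′ → (i ≡ i′ × j ≡ j′) × r ≡ r′
operands-injective i j i′ j′ {r} {r′} e =
  let p , e′ = encodeℕ-injective i i′
                 (trans (sym (++-assoc (encodeℕ i) (encodeℕ j) r)) (trans e (++-assoc (encodeℕ i′) (encodeℕ j′) r′)))
      q , e″ = encodeℕ-injective j j′ e′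
  in (p , q) , e″

encodeRaw-injective : ∀ g g′ {r r′} → encodeRaw g ++ r ≡ encodeRaw g′ ++ r′ → g ≡ g′ × r ≡ r′
encodeRaw-injective (inp i) (inp j) e =
  let p , q = encodeℕ-injective i j (∷-injectiveʳ (∷-injectiveʳ e)) in cong inp p , q
encodeRaw-injective (cst b) (cst c) refl = refl , refl
encodeRaw-injective (neg i) (neg j) e =
  let p , q = encodeℕ-injective i j (∷-injectiveʳ (∷-injectiveʳ e)) in cong neg p , q
encodeRaw-injective (conj i j) (conj i′ j′) e =
  let (p , p′) , q = operands-injective i j i′ j′ (∷-injectiveʳ (∷-injectiveʳ (∷-injectiveʳ e))) in cong₂ conj p p′ , q
encodeRaw-injective (disj i j) (disj i′ j′) e =
  let (p , p′) , q = operands-injective i j i′ j′ (∷-injectiveʳ (∷-injectiveʳ (∷-injectiveʳ e))) in cong₂ disj p p′ , q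
encodeRaw-injective (inp _)    (cst _)    ()
encodeRaw-injective (inp _)    (neg _)    ()
encodeRaw-injective (inp _)    (conj _ _) ()
encodeRaw-injective (inp _)    (disj _ _) ()
encodeRaw-injective (cst _)    (inp _)    ()
encodeRaw-injective (cst _)    (neg _)    ()
encodeRaw-injective (cst _)    (conj _ _) ()
encodeRaw-injective (cst _)    (disj _ _) ()
encodeRaw-injective (neg _)    (inp _)    ()
encodeRaw-injective (neg _)    (cst _)    ()
encodeRaw-injective (neg _)    (conj _ _) ()
encodeRaw-injective (neg _)    (disj _ _) ()
encodeRaw-injective (conj _ _) (inp _)    ()
encodeRaw-injective (conj _ _) (cst _)    ()
encodeRaw-injective (conj _ _) (neg _)    ()
encodeRaw-injective (conj _ _) (disj _ _) ()
encodeRaw-injective (disj _ _) (inp _)    ()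
encodeRaw-injective (disj _ _) (cst _)    ()
encodeRaw-injective (disj _ _) (neg _)    ()
encodeRaw-injective (disj _ _) (conj _ _) ()

-- The code of a gate is prefix-free, and the marker in front of each item tells a further gate from
-- the end. Working with raw gates avoids comparing circuits of possibly different sizes in their
-- types.
encodeRaws-injective : ∀ gs hs {r r′} → encodeRaws gs ++ false ∷ r ≡ encodeRaws hs ++ false ∷ r′ → gs ≡ hs × r ≡ r′
encodeRaws-injective []       []       refl = refl , refl
encodeRaws-injective (g ∷ gs) (h ∷ hs) {r} {r′} e =
  let p , e′ = encodeRaw-injective g h (trans (sym (++-assoc (encodeRaw g) (encodeRaws gs) (false ∷ r)))
                 (trans (∷-injectiveʳ e) (++-assoc (encodeRaw h) (encodeRaws hs) (false ∷ r′))))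
      q , e″ = encodeRaws-injective gs hs e′
  in cong₂ _∷_ p q , e″

-- `Weak-Tournament-Source` supplies some circuit with the given text, not necessarily the one
-- constructed. Equal texts have equal raw gates, and evaluation of raw gates is deterministic.
eval-determined : ∀ {n} (C D : Circuit n 1) → encodeCircuit C ≡ encodeCircuit D → ∀ x →
                  Vec.head (eval C x) ≡ Vec.head (eval D x)
eval-determined (circuit Γ (o ∷ [])) (circuit Δ (p ∷ [])) e x = just-unique
  (trans (cong₂ nth values (sym same-index)) (nth-toList (evalGates Γ x) o))
  (nth-toList (evalGates Δ x) p)
  where
  raws = encodeRaws-injective (rawGates Γ) (rawGates Δ)
    (trans (cong (_++ _) (encodeRaws-raw Γ)) (trans e (cong (_++ _) (sym (encodeRaws-raw Δ)))))
  same-index : toℕ o ≡ toℕ p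
  same-index = proj₁ (encodeℕ-injective (toℕ o) (toℕ p) (proj₂ raws))
  values : toList (evalGates Δ x) ≡ toList (evalGates Γ x)
  values = runs-unique (runs-raw Δ x)
    (subst (λ gs → Runs (toList x) gs [] (toList (evalGates Γ x))) (proj₁ raws) (runs-raw Γ x))

-- Correctness of the reduction

length-encodeCircuits : ∀ {n k} (Cs : List (Circuit n k)) → length Cs < length (encodeCircuits Cs)
length-encodeCircuits []       = s≤s z≤n
length-encodeCircuits (C ∷ Cs) = s≤s (≤-trans (length-encodeCircuits Cs)
  (≤-trans (m≤n+m _ (length (encodeCircuit C))) (≤-reflexive (sym (length-++ (encodeCircuit C))))))

module _ {n : ℕ} (Cs : List (Circuit n n)) where

  private
    W = length (encodeℕ n ++ encodeCircuits Cs)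

    enough : length Cs < W
    enough = ≤-trans (length-encodeCircuits Cs)
      (≤-trans (m≤n+m _ (length (encodeℕ n))) (≤-reflexive (sym (length-++ (encodeℕ n)))))

    built = tournament W Cs enough

  reducedCircuit : Circuit (n + n) 1
  reducedCircuit = proj₁ built

  reduced-encoding : reduced Cs ≡ encodeℕ n ++ encodeCircuit reducedCircuit
  reduced-encoding = cong (encodeℕ n ++_) (sym (proj₁ (proj₂ built)))

  beats⇔margin : ∀ x y → Vec.head (eval reducedCircuit (x Vec.++ y)) ≡ true ⇔ margin Cs x y ℤ.> 0ℤ
  beats⇔margin = proj₂ (proj₂ built)

  winner⇒source : ∀ {x} → IsCondorcetWinner Cs x → IsWeakSource reducedCircuit x
  winner⇒source {x} wins y y≢x = Equivalence.from (beats⇔margin x y) (wins y y≢x) , loses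
    where
    loses-by : ∀ b → Vec.head (eval reducedCircuit (y Vec.++ x)) ≡ b → b ≡ false
    loses-by false e = refl
    -- Otherwise both margins would be positive, although one is the negative of the other.
    loses-by true  e = ⊥-elim (ℤ.<-asym (Equivalence.to (beats⇔margin y x) e)
      (subst (ℤ._< 0ℤ) (sym (margin-antisym Cs x y)) (ℤ.neg-mono-< (wins y y≢x))))
    loses : Vec.head (eval reducedCircuit (y Vec.++ x)) ≡ false
    loses = loses-by _ refl

  source⇒winner : ∀ {x} → IsWeakSource reducedCircuit x → IsCondorcetWinner Cs x
  source⇒winner {x} source y y≢x = Equivalence.to (beats⇔margin x y) (proj₁ (source y y≢x))

condorcet⇒source : ∀ {w} → Ckt-Condorcet w → Weak-Tournament-Source (transduce reducer w)
condorcet⇒source (n , Cs , refl , x , wins) =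
  n , reducedCircuit Cs , trans (transduce-encoding Cs) (reduced-encoding Cs) , x , winner⇒source Cs wins

encoding-nonempty : ∀ n {r w} → w ≡ encodeℕ n ++ r → w ≢ []
encoding-nonempty zero    refl ()
encoding-nonempty (suc n) refl ()

source⇒condorcet : ∀ w → Weak-Tournament-Source (transduce reducer w) → Ckt-Condorcet w
source⇒condorcet w (n , D , e , x , source) = decoded (transduce-sound w (encoding-nonempty n e)) e
  where
  -- The sizes are identified first, since `eval-determined` compares circuits with the same number
  -- of inputs.
  same-size : ∀ {k} (Cs : List (Circuit k k)) → k ≡ n × encodeCircuit (reducedCircuit Cs) ≡ encodeCircuit D →
              Ckt-Condorcet (encodeℕ k ++ encodeCircuits Cs)
  same-size Cs (refl , e) = n , Cs , refl , x , source⇒winner Cs λ y y≢x →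
    trans (same (x Vec.++ y)) (proj₁ (source y y≢x)) , trans (same (y Vec.++ x)) (proj₂ (source y y≢x))
    where
    same : ∀ z → Vec.head (eval (reducedCircuit Cs) z) ≡ Vec.head (eval D z)
    same = eval-determined (reducedCircuit Cs) D e
  decoded : (∃[ k ] Σ[ Cs ∈ List (Circuit k k) ] w ≡ encodeℕ k ++ encodeCircuits Cs) →
            transduce reducer w ≡ encodeℕ n ++ encodeCircuit D → Ckt-Condorcet w
  decoded (k , Cs , refl) e = same-size Cs
    (encodeℕ-injective k n (trans (sym (trans (transduce-encoding Cs) (reduced-encoding Cs))) e))

theorem4p2 : PCW ⊆ PTW
theorem4p2 (f , polyTime , reduces) =
  transduce reducer ∘ f , polyTime-transduce reducer f polyTime , λ w →
    IsEquivalence.trans ⇔-isEquivalence (reduces w) (mk⇔ condorcet⇒source (source⇒condorcet (f w)))
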